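{- For every $(\lambda^{(1)}|\cdots|\lambda^{(r)})\in\mathrm{Par}^r$, $$\mathcal{S}_{(\lambda^{(1)}|\cdots|\lambda^{(r)})}=m_{(\lambda^{(1)}|\cdots|\lambda^{(r)})}+\sum_{(\mu^{(1)}|\cdots|\mu^{(r)})\triangleleft(\lambda^{(1)}|\cdots|\lambda^{(r)})}K^{(\lambda^{(1)}|\cdots|\lambda^{(r)})}_{(\mu^{(1)}|\cdots|\mu^{(r)})}\,m_{(\mu^{(1)}|\cdots|\mu^{(r)})},$$ and every Kostka coefficient $K^{(\lambda)}_{(\mu)}$ appearing in this sum (i.e. for every $(\mu)\triangleleft(\lambda)$) is nonzero.
   Context: Key polynomials $\mathcal{K}_\alpha$ ($\alpha\in\mathbb{Z}_{\ge0}^n$): unique polynomials with $\mathcal{K}_\alpha=x^\alpha$ if $\alpha$ weakly decreasing and $\mathcal{K}_{s_i\alpha}=\xi_i\mathcal{K}_\alpha$ whenever $\alpha_i>\alpha_{i+1}$, where $\xi_if=\frac{x_if-x_{i+1}s_if}{x_i-x_{i+1}}$. $\mathrm{rev}(\lambda)=(\lambda_{\ell(\lambda)},\dots,\lambda_1)$, $*$ concatenation, $0^m$ $m$ zeros. $\mathcal{S}_{(\lambda^{(1)}|\cdots|\lambda^{(r)})}(X_1|\cdots|X_r)$ is the coefficientwise limit as all $n_i\to\infty$ of $\mathcal{K}_\gamma(x_{1,1},\dots,x_{1,n_1},\dots,x_{r,1},\dots,x_{r,n_r})$, $\gamma=(0^{n_1-\ell(\lambda^{(1)})}*\mathrm{rev}(\lambda^{(1)}))*\cdots*(0^{n_r-\ell(\lambda^{(r)})}*\mathrm{rev}(\lambda^{(r)}))$,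 an element of $\Lambda(X_1)\otimes\cdots\otimes\Lambda(X_r)$. $m_{(\mu^{(1)}|\cdots|\mu^{(r)})}=m_{\mu^{(1)}}(X_1)\cdots m_{\mu^{(r)}}(X_r)$, and $K^{(\lambda)}_{(\mu)}$ are the coefficients of $\mathcal{S}_{(\lambda)}$ in this basis. Order $\triangleleft$ on $\mathrm{Par}^r$ (partitions padded with infinitely many zeros): $(\mu)\triangleleft(\lambda)$ if $(\mu)$ is obtained from $(\lambda)$ by a nonempty finite sequence of the following moves on $(\nu^{(1)}|\cdots|\nu^{(r)})$: Move 1: if $\nu^{(i_1)}_{j_1}<\nu^{(i_2)}_{j_2}$ with $i_1<i_2$, swap these two entries and re-sort each partition; Move 2: if $\nu^{(i)}_j>\nu^{(i)}_k+1$ with $j<k$, replace $\nu^{(i)}$ by $\nu^{(i)}+e_k-e_j$ and re-sort; Move 3: if $\nu^{(i_1)}_{j_1}+1<\nu^{(i_2)}_{j_2}$ with $i_1<i_2$, replace these entries by $\nu^{(i_1)}_{j_1}+1$ and $\nu^{(i_2)}_{j_2}-1$ respectively and re-sort each partition. -}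

module Defs where

open import Data.Nat using (ℕ; zero; suc; _∸_; _<_; _≤_; _≥_; _≤ᵇ_)
import Data.Nat as ℕ
open import Data.Integer as ℤ using (ℤ)
open import Data.Fin using (Fin; toℕ)
open import Data.List using (List; []; _∷_; _++_; map; concatMap; allFin; replicate; reverse; length; foldr; filter)
open import Data.List.Properties using (≡-dec)
open import Data.List.Relation.Unary.Linked using (Linked)
open import Data.List.Relation.Unary.All using (All)
open import Data.Product using (_×_; _,_; proj₁; proj₂; Σ; ∃)
open import Data.Bool using (if_then_else_)
open import Relation.Nullary using (¬_; yes; no)
open import Relation.Nullary.Decidable using (⌊_⌋)
open import Relation.Binary.PropositionalEquality using (_≡_; _≢_)

-- Lists of naturals viewed as sequences padded by infinitely many zeros

at : List ℕ → ℕ → ℕ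
at []       _       = 0
at (x ∷ xs) zero    = x
at (x ∷ xs) (suc j) = at xs j

setAt : ℕ → ℕ → List ℕ → List ℕ
setAt zero    v []       = v ∷ []
setAt zero    v (x ∷ xs) = v ∷ xs
setAt (suc j) v []       = 0 ∷ setAt j v []
setAt (suc j) v (x ∷ xs) = x ∷ setAt j v xs

insertDesc : ℕ → List ℕ → List ℕ
insertDesc x []       = x ∷ []
insertDesc x (y ∷ ys) = if y ≤ᵇ x then x ∷ y ∷ ys else y ∷ insertDesc x ys

norm : List ℕ → List ℕ
norm []             = []
norm (zero  ∷ xs)   = norm xs
norm (suc x ∷ xs)   = insertDesc (suc x) (norm xs)

IsPartition : List ℕ → Set
IsPartition l = Linked _≥_ l × All (λ x → 0 < x) l

MultiPar : ℕ → Set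
MultiPar r = Fin r → List ℕ

IsMultiPar : ∀ {r} → MultiPar r → Set
IsMultiPar {r} ν = (i : Fin r) → IsPartition (ν i)

OthersEq : ∀ {r} → Fin r → Fin r → MultiPar r → MultiPar r → Set
OthersEq {r} i₁ i₂ ν ν' = (k : Fin r) → k ≢ i₁ → k ≢ i₂ → ν' k ≡ ν k

data Move {r : ℕ} (ν ν' : MultiPar r) : Set where
  move1 : (i₁ i₂ : Fin r) (j₁ j₂ : ℕ) → toℕ i₁ < toℕ i₂ →
          at (ν i₁) j₁ < at (ν i₂) j₂ →
          ν' i₁ ≡ norm (setAt j₁ (at (ν i₂) j₂) (ν i₁)) →
          ν' i₂ ≡ norm (setAt j₂ (at (ν i₁) j₁) (ν i₂)) →
          OthersEq i₁ i₂ ν ν' → Move ν ν'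
  move2 : (i : Fin r) (j k : ℕ) → j < k →
          suc (at (ν i) k) < at (ν i) j →
          ν' i ≡ norm (setAt k (suc (at (ν i) k)) (setAt j (at (ν i) j ∸ 1) (ν i))) →
          OthersEq i i ν ν' → Move ν ν'
  move3 : (i₁ i₂ : Fin r) (j₁ j₂ : ℕ) → toℕ i₁ < toℕ i₂ →
          suc (at (ν i₁) j₁) < at (ν i₂) j₂ →
          ν' i₁ ≡ norm (setAt j₁ (suc (at (ν i₁) j₁)) (ν i₁)) →
          ν' i₂ ≡ norm (setAt j₂ (at (ν i₂) j₂ ∸ 1) (ν i₂)) →
          OthersEq i₁ i₂ ν ν' → Move ν ν'

data _◁_ {r : ℕ} (μ λ' : MultiPar r) : Set where
  one  : Move λ' μ → μ ◁ λ'
  more : (ν : MultiPar r) → Move λ' ν → μ ◁ ν → μ ◁ λ'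

-- Polynomials with integer coefficients, as formal sums of monomials.
-- A term (c , e) stands for c · x^e (e = exponent list; the number of
-- variables is the length of e).

Poly : Set
Poly = List (ℤ × List ℕ)

coeff : Poly → List ℕ → ℤ
coeff []             e = ℤ.0ℤ
coeff ((c , e') ∷ p) e with ≡-dec ℕ._≟_ e' e
... | yes _ = c ℤ.+ coeff p e
... | no  _ = coeff p e

_≈_ : Poly → Poly → Set
p ≈ q = (e : List ℕ) → coeff p e ≡ coeff q e

monomial : List ℕ → Poly
monomial α = (ℤ.1ℤ , α) ∷ []

incAt : ℕ → List ℕ → List ℕ
incAt _       []       = []
incAt zero    (x ∷ xs) = suc x ∷ xs
incAt (suc i) (x ∷ xs) = x ∷ incAt i xs

swapAt : ℕ → List ℕ → List ℕ
swapAt zero    (x ∷ y ∷ xs) = y ∷ x ∷ xs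
swapAt (suc i) (x ∷ xs)     = x ∷ swapAt i xs
swapAt _       xs           = xs

mulVar : ℕ → Poly → Poly
mulVar i = map (λ t → proj₁ t , incAt i (proj₂ t))

sPoly : ℕ → Poly → Poly
sPoly i = map (λ t → proj₁ t , swapAt i (proj₂ t))

negP : Poly → Poly
negP = map (λ t → ℤ.- proj₁ t , proj₂ t)

_-P_ : Poly → Poly → Poly
p -P q = p ++ negP q

-- Key polynomials.  K is a key family if K α = x^α for weakly decreasing α,
-- and K (s_i α) = ξ_i (K α) whenever α_i > α_{i+1}, where g = ξ_i f is
-- the polynomial with (x_i − x_{i+1}) g = x_i f − x_{i+1} s_i f.
-- (Indices 0-based; α ranges over all lists, i.e. all n.)

IsKeyFamily : (List ℕ → Poly) → Set
IsKeyFamily K =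
  ((α : List ℕ) → Linked _≥_ α → K α ≈ monomial α) ×
  ((α : List ℕ) (i : ℕ) → suc i < length α → at α (suc i) < at α i →
     (mulVar i (K (swapAt i α)) -P mulVar (suc i) (K (swapAt i α)))
       ≈ (mulVar i (K α) -P mulVar (suc i) (sPoly i (K α))))

gammaVec : ∀ {r} → MultiPar r → (Fin r → ℕ) → List ℕ
gammaVec {r} λ' n =
  concatMap (λ i → replicate (n i ∸ length (λ' i)) 0 ++ reverse (λ' i)) (allFin r)

-- the exponent of the monomial ∏_{i,j} x_{i,j}^{e⁽ⁱ⁾_j} in the variables
-- x_{1,1..n₁},…,x_{r,1..n_r}; e⁽ⁱ⁾ is a finite list, padded by zeros
expoVec : ∀ {r} → (Fin r → List ℕ) → (Fin r → ℕ) → List ℕ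
expoVec {r} e n =
  concatMap (λ i → e i ++ replicate (n i ∸ length (e i)) 0) (allFin r)

-- the coefficient of x^e in 𝒮_(λ) equals c : the coefficient of x^e in
-- 𝒦_γ(x_{1,1},…,x_{r,n_r}) is eventually c when all n_i → ∞
LimCoeff : ∀ {r} → (List ℕ → Poly) → MultiPar r → (Fin r → List ℕ) → ℤ → Set
LimCoeff {r} K λ' e c =
  Σ ℕ λ B → (n : Fin r → ℕ) → ((i : Fin r) → B ≤ n i) →
    coeff (K (gammaVec λ' n)) (expoVec e n) ≡ c

-- the partition tuple of a monomial x^e, i.e. the (μ) with x^e a term of m_(μ)
normMulti : ∀ {r} → (Fin r → List ℕ) → MultiPar r
normMulti e i = norm (e i)

_≐_ : ∀ {r} → MultiPar r → MultiPar r → Set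
_≐_ {r} μ ν = (i : Fin r) → μ i ≡ ν i

{-# OPTIONS --safe #-}
-- The support of 𝒦_α is the set of exponents reachable from α by transfers: move k units from an entry α_q to
-- an earlier entry α_p with k ≤ α_q − α_p.  That the support contains no other exponents is seen by applying
-- the operators ξ_i one at a time.  That it contains all of these needs positivity, to exclude cancellation,
-- and positivity comes from branching: the coefficient of x_1^s in 𝒦_α(x_1,…,x_n) is a sum of key polynomials
-- in x_2,…,x_n.  The operators ξ_2, ξ_3, … preserve such sums, which reduces branching to those α that decrease
-- weakly after the first entry, where ξ_1 can be evaluated explicitly.  The limit exists because 𝒦_γ is
-- symmetric in every block and inserting a zero at the same place of γ and of the exponent preserves the
-- coefficient; and up to sorting the blocks a transfer is a sequence of moves 1, 2 and 3.

module Submission where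

open import Defs
open import Data.Bool using (true; false; T)
open import Data.Empty using (⊥-elim)
open import Data.Fin using (Fin; zero; suc; toℕ)
import Data.Fin as Fin
import Data.Fin.Properties as Finₚ
open import Data.Integer using (ℤ; 0ℤ; 1ℤ)
import Data.Integer as ℤ
import Data.Integer.Properties as ℤₚ
import Data.Integer.Tactic.RingSolver as ℤ-Solver
open import Data.List using (List; []; _∷_; _++_; length; map; replicate; reverse; concatMap; tabulate)
open import Data.List.Properties using (≡-dec; ∷-injective; ∷-injectiveˡ; ∷-injectiveʳ; ++-assoc; ++-cancelʳ;
  ++-identityʳ; length-++; length-replicate; length-reverse; unfold-reverse)
open import Data.List.Relation.Binary.Permutation.Propositional as ↭ using (_↭_; ↭-refl; ↭-sym; ↭-trans)
open import Data.List.Relation.Binary.Permutation.Propositional.Properties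
  using (↭-length; drop-∷; shift; ++⁺ʳ; All-resp-↭; ↭-reverse; ++-comm)
open import Data.List.Relation.Unary.All as All using (All; []; _∷_)
open import Data.List.Relation.Unary.All.Properties using (++⁺)
open import Data.List.Relation.Unary.Linked as Linked using (Linked; []; [-]; _∷_)
open import Data.Nat using (ℕ; zero; suc; _+_; _*_; _∸_; _≤_; _<_; _≥_; _>_; _≤ᵇ_; z≤n; s≤s)
import Data.Nat as ℕ
open import Data.Nat.Induction using (<-wellFounded)
open import Data.Nat.ListAction using (sum)
import Data.Nat.Properties as ℕₚ
import Data.Nat.Tactic.RingSolver as ℕ-Solver
open import Data.Product using (_×_; _,_; Σ; ∃; ∃₂; proj₁; proj₂)
open import Data.Sum using (_⊎_; inj₁; inj₂; [_,_]′)
open import Function using (_∘_; flip)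
open import Induction.WellFounded using (Acc; acc)
open import Relation.Binary using (tri<; tri≈; tri>)
open import Relation.Binary.Construct.Closure.ReflexiveTransitive using (Star; ε; _◅_; _◅◅_; gmap)
open import Relation.Binary.PropositionalEquality
open import Relation.Nullary using (¬_; Dec; yes; no)

-- `ξ` is taken on arbitrary functions of the exponents, so divisibility and finite support are
-- never an issue: every fact about it is a computation along one antidiagonal. Two obstacles shape
-- the proof. The defining recursion speaks of strict descents only, so it does not say that 𝒦_α is
-- symmetric in x_i and x_(i+1) when α_i = α_(i+1); this rests on the braid relation. And `ξ` is not
-- a positive operator: for b > a + 1 it sends x^a y^b to -(x^(a+1) y^(b-1) + ... + x^(b-1)
-- y^(a+1)). Positive is only its action on key polynomials, each of which it sends to a key
-- polynomial. In the explicit evaluation for branching, a term x^m A_y is a sum of keys by itself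
-- only if m dominates the entries of the keys in A_y; the terms with smaller m have to be
-- collected, and together they are again ξ_1 of a sum of keys.

-- If f a b is the coefficient of x^a y^b in F, then ξ f a b is that in (x F − y sF) / (x − y), where s swaps
-- x and y: the recursion is the comparison of coefficients in (x − y) G = x F − y sF.
ξ : (ℕ → ℕ → ℤ) → ℕ → ℕ → ℤ
ξ f a zero    = f a zero
ξ f a (suc b) = (f a (suc b) ℤ.- f b (suc a)) ℤ.+ ξ f (suc a) b

ξ-cong : ∀ {f g} → (∀ a b → f a b ≡ g a b) → ∀ a b → ξ f a b ≡ ξ g a b
ξ-cong f≗g a zero    = f≗g a zero
ξ-cong f≗g a (suc b) =
  cong₂ ℤ._+_ (cong₂ ℤ._-_ (f≗g a (suc b)) (f≗g b (suc a))) (ξ-cong f≗g (suc a) b)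

ξ-0 : ∀ a b → ξ (λ _ _ → 0ℤ) a b ≡ 0ℤ
ξ-0 a zero    = refl
ξ-0 a (suc b) = cong (λ u → 0ℤ ℤ.+ u) (ξ-0 (suc a) b)

private
  ring-+ : ∀ a b c d x y → ((a ℤ.+ b) ℤ.- (c ℤ.+ d)) ℤ.+ (x ℤ.+ y) ≡
           ((a ℤ.- c) ℤ.+ x) ℤ.+ ((b ℤ.- d) ℤ.+ y)
  ring-+ = ℤ-Solver.solve-∀

ξ-+ : ∀ f g a b → ξ (λ x y → f x y ℤ.+ g x y) a b ≡ ξ f a b ℤ.+ ξ g a b
ξ-+ f g a zero    = refl
ξ-+ f g a (suc b) = trans
  (cong₂ ℤ._+_ (refl {x = (f a (suc b) ℤ.+ g a (suc b)) ℤ.- (f b (suc a) ℤ.+ g b (suc a))}) (ξ-+ f g (suc a) b))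
  (ring-+ (f a (suc b)) (g a (suc b)) (f b (suc a)) (g b (suc a)) (ξ f (suc a) b) (ξ g (suc a) b))

below : (ℕ → ℕ → ℤ) → ℕ → ℕ → ℤ
below f zero    c = 0ℤ
below f (suc b) c = f b c ℤ.+ below f b (suc c)

above : (ℕ → ℕ → ℤ) → ℕ → ℕ → ℤ
above f a zero    = f a zero
above f a (suc b) = f a (suc b) ℤ.+ above f (suc a) b

-- diagonal f a b is the sum of f over all pairs with sum a + b.
diagonal : (ℕ → ℕ → ℤ) → ℕ → ℕ → ℤ
diagonal f a b = below f a (suc b) ℤ.+ above f a b

private
  ring-shift : ∀ x y z → (x ℤ.+ y) ℤ.+ z ≡ y ℤ.+ (x ℤ.+ z)
  ring-shift = ℤ-Solver.solve-∀

diagonal-shift : ∀ f a b → diagonal f a (suc b) ≡ diagonal f (suc a) b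
diagonal-shift f a b = sym (ring-shift (f a (suc b)) _ _)

diagonal-comm : ∀ f a b → diagonal f a b ≡ diagonal f b a
diagonal-comm f a b = trans (go a b) (trans (cong (diagonal f 0) (ℕₚ.+-comm a b)) (sym (go b a)))
  where
  go : ∀ a b → diagonal f a b ≡ diagonal f 0 (a + b)
  go zero    b = refl
  go (suc a) b = trans (sym (diagonal-shift f a b))
    (trans (go a (suc b)) (cong (diagonal f 0) (ℕₚ.+-suc a b)))

private
  ring-ξ₀ : ∀ x → x ≡ x ℤ.- 0ℤ
  ring-ξ₀ = ℤ-Solver.solve-∀
  ring-ξ₁ : ∀ x y z w → (x ℤ.- y) ℤ.+ (z ℤ.- w) ≡ (x ℤ.+ z) ℤ.- (y ℤ.+ w)
  ring-ξ₁ = ℤ-Solver.solve-∀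
  ring-ξ₂ : ∀ u v w → u ℤ.- w ≡ (v ℤ.+ u) ℤ.- (v ℤ.+ w)
  ring-ξ₂ = ℤ-Solver.solve-∀

ξ-above : ∀ f a b → ξ f a b ≡ above f a b ℤ.- below f b (suc a)
ξ-above f a zero    = ring-ξ₀ _
ξ-above f a (suc b) = trans (cong₂ ℤ._+_ (refl {x = f a (suc b) ℤ.- f b (suc a)}) (ξ-above f (suc a) b))
  (ring-ξ₁ (f a (suc b)) (f b (suc a)) (above f (suc a) b) (below f b (suc (suc a))))

-- On the antidiagonal of (a , b) let D be the total of f and S(c) the sum of the f x y with x < c.
-- Then ξ f a b = D - S(a) - S(b), which is symmetric in a and b.
ξ-sym : ∀ f a b → ξ f a b ≡ ξ f b a
ξ-sym f a b = trans (go a b) (trans (cong₂ ℤ._-_ (diagonal-comm f a b) (ℤₚ.+-comm (below f a (suc b)) _)) (sym (go b a)))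
  where
  go : ∀ a b → ξ f a b ≡ diagonal f a b ℤ.- (below f a (suc b) ℤ.+ below f b (suc a))
  go a b = trans (ξ-above f a b) (ring-ξ₂ _ (below f a (suc b)) _)

private
  ring-fix : ∀ x y → (x ℤ.- y) ℤ.+ y ≡ x
  ring-fix = ℤ-Solver.solve-∀

ξ-fix : ∀ f → (∀ a b → f a b ≡ f b a) → ∀ a b → ξ f a b ≡ f a b
ξ-fix f s a zero    = refl
ξ-fix f s a (suc b) = trans (cong₂ (λ u v → (f a (suc b) ℤ.- u) ℤ.+ v) (s b (suc a)) (ξ-fix f s (suc a) b)) (ring-fix _ _)

-- Two facts standing in for the braid relation: if f is symmetric in two adjacent variables then
-- applying ξ first to the pair overlapping it on one side and then to that pair itself
-- produces a function symmetric in the other pair.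

module _ (f : ℕ → ℕ → ℕ → ℤ) (f-sym : ∀ a b c → f a b c ≡ f a c b) where
  private
    g h : ℕ → ℕ → ℕ → ℤ
    g a b c = ξ (λ x y → f x y c) a b
    h a b c = ξ (λ y z → g a y z) b c

    g-sym : ∀ a b c → g a b c ≡ g b a c
    g-sym a b c = ξ-sym (λ x y → f x y c) a b

    r₀ : ∀ p q r → r ℤ.- ((p ℤ.- q) ℤ.+ r) ≡ q ℤ.- p
    r₀ = ℤ-Solver.solve-∀

    r₁ : ∀ g₁ g₂ g₃ h₁ h₂ f₁ f₂ f₃ g₆ → h₁ ℤ.- h₂ ≡ g₆ ℤ.- g₂ →
         ((g₃ ℤ.- g₁) ℤ.+ h₁) ℤ.- ((((f₂ ℤ.- f₁) ℤ.+ g₃) ℤ.- g₂) ℤ.+ h₂) ≡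
         ((f₁ ℤ.- f₃) ℤ.+ g₆) ℤ.- ((f₂ ℤ.- f₃) ℤ.+ g₁)
    r₁ g₁ g₂ g₃ h₁ h₂ f₁ f₂ f₃ g₆ e = trans (s g₁ g₂ g₃ h₁ h₂ f₁ f₂) (trans (cong (λ u → (f₁ ℤ.- f₂ ℤ.+ g₂ ℤ.- g₁) ℤ.+ u) e) (t g₁ g₂ f₁ f₂ f₃ g₆))
      where
      s : ∀ g₁ g₂ g₃ h₁ h₂ f₁ f₂ → ((g₃ ℤ.- g₁) ℤ.+ h₁) ℤ.- ((((f₂ ℤ.- f₁) ℤ.+ g₃) ℤ.- g₂) ℤ.+ h₂) ≡ (f₁ ℤ.- f₂ ℤ.+ g₂ ℤ.- g₁) ℤ.+ (h₁ ℤ.- h₂)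
      s = ℤ-Solver.solve-∀
      t : ∀ g₁ g₂ f₁ f₂ f₃ g₆ → (f₁ ℤ.- f₂ ℤ.+ g₂ ℤ.- g₁) ℤ.+ (g₆ ℤ.- g₂) ≡ ((f₁ ℤ.- f₃) ℤ.+ g₆) ℤ.- ((f₂ ℤ.- f₃) ℤ.+ g₁)
      t = ℤ-Solver.solve-∀

    -- For `braid-left`, by induction on the third exponent: one triple unfolds to h a (b+1) c, the
    -- swapped one to h b (a+1) c, with different g terms. The hypothesis turns the former into h
    -- (b+1) a c, and this identity accounts for the rest.
    key : ∀ a b c → h (suc b) a c ℤ.- h b (suc a) c ≡ g a c (suc b) ℤ.- g b c (suc a)
    key a b zero = trans (r₀ (f b (suc a) 0) (f a (suc b) 0) (g (suc b) a 0)) (cong₂ ℤ._-_ (f-sym a _ _) (f-sym b _ _))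
    key a b (suc c) = trans
      (r₁ (g (suc b) c (suc a)) (g b c (suc (suc a))) (g (suc b) a (suc c)) (h (suc b) (suc a) c) (h b (suc (suc a)) c)
          (f a (suc b) (suc c)) (f b (suc a) (suc c)) (f c (suc a) (suc b)) (g (suc a) c (suc b)) (key (suc a) b c))
      (cong₂ ℤ._-_
        (cong (λ u → (u ℤ.- f c (suc a) (suc b)) ℤ.+ g (suc a) c (suc b)) (f-sym a _ _))
        (cong₂ (λ u v → (u ℤ.- v) ℤ.+ g (suc b) c (suc a)) (f-sym b _ _) (f-sym c _ _)))

    r₂ : ∀ p q h₁ h₂ h₃ G → h₁ ≡ h₂ → h₂ ℤ.- h₃ ≡ p ℤ.- q → (G ℤ.- p) ℤ.+ h₁ ≡ (G ℤ.- q) ℤ.+ h₃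
    r₂ p q h₁ h₂ h₃ G refl e = trans (s p h₁ h₃ G) (trans (cong (λ u → ((G ℤ.- p) ℤ.+ h₃) ℤ.+ u) e) (t p q h₃ G))
      where
      s : ∀ p h₁ h₃ G → (G ℤ.- p) ℤ.+ h₁ ≡ ((G ℤ.- p) ℤ.+ h₃) ℤ.+ (h₁ ℤ.- h₃)
      s = ℤ-Solver.solve-∀
      t : ∀ p q h₃ G → ((G ℤ.- p) ℤ.+ h₃) ℤ.+ (p ℤ.- q) ≡ (G ℤ.- q) ℤ.+ h₃
      t = ℤ-Solver.solve-∀

  braid-left : ∀ a b c → h a b c ≡ h b a c
  braid-left a b zero    = g-sym a b 0
  braid-left a b (suc c) = trans
    (r₂ (g a c (suc b)) (g b c (suc a)) _ _ (h b (suc a) c) (g a b (suc c)) (braid-left a (suc b) c) (key a b c))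
    (cong (λ u → (u ℤ.- g b c (suc a)) ℤ.+ h b (suc a) c) (g-sym a b (suc c)))

module _ (f : ℕ → ℕ → ℕ → ℤ) (f-sym : ∀ a b c → f a b c ≡ f b a c) where
  private
    g h : ℕ → ℕ → ℕ → ℤ
    g a b c = ξ (λ y z → f a y z) b c
    h a b c = ξ (λ x y → g x y c) a b

    g-sym : ∀ a b c → g a b c ≡ g a c b
    g-sym a b c = ξ-sym (λ y z → f a y z) b c

    h-sym : ∀ a b c → h a b c ≡ h b a c
    h-sym a b c = ξ-sym (λ x y → g x y c) a b

    -- The recursion of `ξ` read backwards, so that it lowers the first exponent, on which
    -- `braid-right` runs its induction.
    h-suc : ∀ x y z → h (suc x) y z ≡ (h x (suc y) z ℤ.- g x (suc y) z) ℤ.+ g y (suc x) z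
    h-suc x y z = r (h (suc x) y z) (g x (suc y) z) (g y (suc x) z)
      where
      r : ∀ H p q → H ≡ (((p ℤ.- q) ℤ.+ H) ℤ.- p) ℤ.+ q
      r = ℤ-Solver.solve-∀

    h-0 : ∀ y z → h 0 y z ≡ f y z 0
    h-0 y z = trans (h-sym 0 y z) (g-sym y 0 z)

    s₀ : ∀ A B F₁ F₂ P → F₁ ℤ.- F₂ ≡
         ((A ℤ.- B) ℤ.- ((P ℤ.- B) ℤ.+ F₂)) ℤ.+ ((P ℤ.- A) ℤ.+ F₁)
    s₀ = ℤ-Solver.solve-∀

    -- Moves a unit from the second exponent to the third. After this the two unfoldings in
    -- `braid-right` contain h x y (z+1) and h x (z+1) y, which the hypothesis for x identifies.
    key : ∀ x y z → h x (suc y) z ℤ.- h x y (suc z) ≡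
          ((f x z (suc y) ℤ.- f x y (suc z)) ℤ.- g y (suc x) z) ℤ.+ g z (suc x) y
    key zero y z = trans (cong₂ ℤ._-_ (trans (h-0 (suc y) z) (f-sym (suc y) z 0)) (h-0 y (suc z)))
      (trans (s₀ (f 0 z (suc y)) (f 0 y (suc z)) (f z (suc y) 0) (f y (suc z) 0) (f y z 1))
      (cong₂ (λ u v → ((f 0 z (suc y) ℤ.- f 0 y (suc z)) ℤ.- u) ℤ.+ v)
        (sym (trans (g-sym y 1 z) (cong₂ (λ u v → (f y z 1 ℤ.- u) ℤ.+ v) (f-sym y 0 (suc z)) refl)))
        (sym (trans (g-sym z 1 y) (cong₂ (λ u v → (u ℤ.- v) ℤ.+ f z (suc y) 0) (f-sym z y 1) (f-sym z 0 (suc y)))))))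
    key (suc x) y z = trans (cong₂ ℤ._-_ (h-suc x (suc y) z) (h-suc x y (suc z)))
      (trans (s (h x (suc (suc y)) z) (h x (suc y) (suc z)) (g x (suc (suc y)) z) (g (suc y) (suc x) z) (g x (suc y) (suc z)) (g y (suc x) (suc z)))
      (trans (cong (λ u → u ℤ.+ (((g (suc y) (suc x) z ℤ.- g x (suc (suc y)) z) ℤ.+ g x (suc y) (suc z)) ℤ.- g y (suc x) (suc z))) (key x (suc y) z))
      (trans (t (f x z (suc (suc y))) (f x (suc y) (suc z)) (g (suc y) (suc x) z) (g x (suc (suc y)) z)
                (f y (suc x) (suc z)) (f z (suc x) (suc y)) (f y z (suc (suc x))) (g y (suc (suc x)) z) (g z (suc (suc x)) y) (f z y (suc (suc x))) (f-sym z y _))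
      (cong₂ (λ u v → ((u ℤ.- v) ℤ.- g y (suc (suc x)) z) ℤ.+ g z (suc (suc x)) y) (f-sym z (suc x) (suc y)) (f-sym y (suc x) (suc z))))))
      where
      s : ∀ h₁ h₂ p q r w → ((h₁ ℤ.- p) ℤ.+ q) ℤ.- ((h₂ ℤ.- r) ℤ.+ w) ≡ (h₁ ℤ.- h₂) ℤ.+ (((q ℤ.- p) ℤ.+ r) ℤ.- w)
      s = ℤ-Solver.solve-∀
      t : ∀ F₁ F₂ q p A B C w w' C' → C' ≡ C →
        (((F₁ ℤ.- F₂) ℤ.- q) ℤ.+ ((B ℤ.- C') ℤ.+ w')) ℤ.+ (((q ℤ.- p) ℤ.+ ((F₂ ℤ.- F₁) ℤ.+ p)) ℤ.- ((A ℤ.- C) ℤ.+ w))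
         ≡ ((B ℤ.- A) ℤ.- w) ℤ.+ w'
      t F₁ F₂ q p A B C w w' .C refl = t' F₁ F₂ q p A B C w w'
        where
        t' : ∀ F₁ F₂ q p A B C w w' → (((F₁ ℤ.- F₂) ℤ.- q) ℤ.+ ((B ℤ.- C) ℤ.+ w')) ℤ.+ (((q ℤ.- p) ℤ.+ ((F₂ ℤ.- F₁) ℤ.+ p)) ℤ.- ((A ℤ.- C) ℤ.+ w))
             ≡ ((B ℤ.- A) ℤ.- w) ℤ.+ w'
        t' = ℤ-Solver.solve-∀

  braid-right : ∀ a b c → h a b c ≡ h a c b
  braid-right zero    b c = trans (h-0 b c) (trans (f-sym b c 0) (sym (h-0 c b)))
  braid-right (suc x) y z = trans (h-suc x y z) (trans (trans (s (h x (suc y) z) (h x y (suc z)) (g x (suc y) z) (g y (suc x) z))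
    (trans (cong (λ u → u ℤ.+ ((h x y (suc z) ℤ.- g x (suc y) z) ℤ.+ g y (suc x) z)) (key x y z))
    (trans (t (f x z (suc y)) (f x y (suc z)) (g y (suc x) z) (g z (suc x) y) (h x y (suc z)) (g x (suc y) z))
      (cong₂ (λ u v → (u ℤ.- v) ℤ.+ g z (suc x) y) (braid-right x y (suc z)) (g-sym x y (suc z))))))
    (sym (h-suc x z y)))
    where
    s : ∀ h₁ h₂ p q → (h₁ ℤ.- p) ℤ.+ q ≡ (h₁ ℤ.- h₂) ℤ.+ ((h₂ ℤ.- p) ℤ.+ q)
    s = ℤ-Solver.solve-∀
    t : ∀ F₁ F₂ q w h₂ p → (((F₁ ℤ.- F₂) ℤ.- q) ℤ.+ w) ℤ.+ ((h₂ ℤ.- p) ℤ.+ q) ≡ (h₂ ℤ.- ((F₂ ℤ.- F₁) ℤ.+ p)) ℤ.+ w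
    t = ℤ-Solver.solve-∀

-- Isobaric divided differences on coefficient functions

Ξ : ℕ → (List ℕ → ℤ) → List ℕ → ℤ
Ξ zero    c (a ∷ b ∷ e) = ξ (λ x y → c (x ∷ y ∷ e)) a b
Ξ zero    c (a ∷ [])    = c (a ∷ [])
Ξ zero    c []          = c []
Ξ (suc i) c (s ∷ e)     = Ξ i (λ e′ → c (s ∷ e′)) e
Ξ (suc i) c []          = c []

Ξ-cong : ∀ i {c d} → (∀ e → c e ≡ d e) → ∀ e → Ξ i c e ≡ Ξ i d e
Ξ-cong zero    c≗d (a ∷ b ∷ e) = ξ-cong (λ x y → c≗d (x ∷ y ∷ e)) a b
Ξ-cong zero    c≗d (a ∷ [])    = c≗d _
Ξ-cong zero    c≗d []          = c≗d _
Ξ-cong (suc i) c≗d (s ∷ e)     = Ξ-cong i (λ e′ → c≗d (s ∷ e′)) e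
Ξ-cong (suc i) c≗d []          = c≗d _

Ξ-0 : ∀ i e → Ξ i (λ _ → 0ℤ) e ≡ 0ℤ
Ξ-0 zero    (a ∷ b ∷ e) = ξ-0 a b
Ξ-0 zero    (a ∷ [])    = refl
Ξ-0 zero    []          = refl
Ξ-0 (suc i) (s ∷ e)     = Ξ-0 i e
Ξ-0 (suc i) []          = refl

Ξ-+ : ∀ i c d e → Ξ i (λ e → c e ℤ.+ d e) e ≡ Ξ i c e ℤ.+ Ξ i d e
Ξ-+ zero    c d (a ∷ b ∷ e) = ξ-+ (λ x y → c (x ∷ y ∷ e)) (λ x y → d (x ∷ y ∷ e)) a b
Ξ-+ zero    c d (a ∷ [])    = refl
Ξ-+ zero    c d []          = refl
Ξ-+ (suc i) c d (s ∷ e)     = Ξ-+ i (λ e′ → c (s ∷ e′)) (λ e′ → d (s ∷ e′)) e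
Ξ-+ (suc i) c d []          = refl

Symm : ℕ → (List ℕ → ℤ) → Set
Symm zero    c = ∀ a b e → c (a ∷ b ∷ e) ≡ c (b ∷ a ∷ e)
Symm (suc i) c = ∀ s → Symm i (λ e → c (s ∷ e))

Symm-cong : ∀ i {c d} → (∀ e → c e ≡ d e) → Symm i c → Symm i d
Symm-cong zero    c≗d s a b e = trans (sym (c≗d _)) (trans (s a b e) (c≗d _))
Symm-cong (suc i) c≗d s x     = Symm-cong i (λ e → c≗d (x ∷ e)) (s x)

Symm⇒swapAt : ∀ i {c} → Symm i c → ∀ e → c (swapAt i e) ≡ c e
Symm⇒swapAt zero    s []          = refl
Symm⇒swapAt zero    s (a ∷ [])    = refl
Symm⇒swapAt zero    s (a ∷ b ∷ e) = s b a e
Symm⇒swapAt (suc i) s []          = refl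
Symm⇒swapAt (suc i) s (x ∷ e)     = Symm⇒swapAt i (s x) e

swapAt⇒Symm : ∀ i {c} → (∀ e → c (swapAt i e) ≡ c e) → Symm i c
swapAt⇒Symm zero    h a b e = sym (h (a ∷ b ∷ e))
swapAt⇒Symm (suc i) h x     = swapAt⇒Symm i (λ e → h (x ∷ e))

Ξ-Symm : ∀ i c → Symm i (Ξ i c)
Ξ-Symm zero    c a b e = ξ-sym (λ x y → c (x ∷ y ∷ e)) a b
Ξ-Symm (suc i) c s     = Ξ-Symm i (λ e → c (s ∷ e))

Ξ-fix : ∀ i {c} → Symm i c → ∀ e → Ξ i c e ≡ c e
Ξ-fix zero    s (a ∷ b ∷ e) = ξ-fix _ (λ x y → s x y e) a b
Ξ-fix zero    s (a ∷ [])    = refl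
Ξ-fix zero    s []          = refl
Ξ-fix (suc i) s (x ∷ e)     = Ξ-fix i (s x) e
Ξ-fix (suc i) s []          = refl

Ξ-braidˡ : ∀ i {c} → Symm (suc i) c → Symm i (Ξ (suc i) (Ξ i c))
Ξ-braidˡ zero {c} s a b []      = ξ-sym (λ x y → c (x ∷ y ∷ [])) a b
Ξ-braidˡ zero {c} s a b (z ∷ e) = braid-left (λ x y z → c (x ∷ y ∷ z ∷ e)) (λ x y z → s x y z e) a b z
Ξ-braidˡ (suc i) s x = Ξ-braidˡ i (s x)

Ξ-braidʳ : ∀ i {c} → Symm i c → Symm (suc i) (Ξ i (Ξ (suc i) c))
Ξ-braidʳ zero {c} s x a b e = braid-right (λ x y z → c (x ∷ y ∷ z ∷ e)) (λ x y z → s x y (z ∷ e)) x a b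
Ξ-braidʳ (suc i) s x = Ξ-braidʳ i (s x)

-- Adjacent transpositions and sorting

data Far : ℕ → ℕ → Set where
  far-< : ∀ {j} → Far 0 (suc (suc j))
  far-> : ∀ {i} → Far (suc (suc i)) 0
  far-s : ∀ {i j} → Far i j → Far (suc i) (suc j)

data Proximity (i : ℕ) : ℕ → Set where
  same : Proximity i i
  next : Proximity i (suc i)
  prev : ∀ {j} → i ≡ suc j → Proximity i j
  far  : ∀ {j} → Far i j → Proximity i j

proximity : ∀ i j → Proximity i j
proximity zero zero = same
proximity zero (suc zero) = next
proximity zero (suc (suc j)) = far far-<
proximity (suc zero) zero = prev refl
proximity (suc (suc i)) zero = far far->
proximity (suc i) (suc j) with proximity i j
... | same = same
... | next = next
... | prev p = prev (cong suc p)
... | far f = far (far-s f)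

Ξ-Far : ∀ {i j} → Far i j → ∀ {c} → Symm i c → Symm i (Ξ j c)
Ξ-Far (far-< {j}) s a b e = Ξ-cong j (λ e′ → s a b e′) e
Ξ-Far (far-> {i}) {c} s x y = swapAt⇒Symm i (λ e → ξ-cong (λ p q → Symm⇒swapAt i {λ e → c (p ∷ q ∷ e)} (s p q) e) x y)
Ξ-Far (far-s f) s x     = Ξ-Far f (s x)

data At (R : ℕ → ℕ → Set) : ℕ → List ℕ → Set where
  here  : ∀ {a b l} → R a b → At R 0 (a ∷ b ∷ l)
  there : ∀ {i x l} → At R i l → At R (suc i) (x ∷ l)

At-map : ∀ {R S : ℕ → ℕ → Set} → (∀ {a b} → R a b → S a b) → ∀ {i α} → At R i α → At S i α
At-map f (here p)  = here (f p)
At-map f (there p) = there (At-map f p)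

At-far : ∀ {R i j α} → Far i j → At R i α → At R i (swapAt j α)
At-far far-< (here r) = here r
At-far {α = x ∷ []} far-> (there ())
At-far {α = x ∷ y ∷ l} far-> (there (there p)) = there (there p)
At-far (far-s f) (there p) = there (At-far f p)

swapAt-involutive : ∀ i l → swapAt i (swapAt i l) ≡ l
swapAt-involutive zero    []          = refl
swapAt-involutive zero    (x ∷ [])    = refl
swapAt-involutive zero    (x ∷ y ∷ l) = refl
swapAt-involutive (suc i) []          = refl
swapAt-involutive (suc i) (x ∷ l)     = cong (x ∷_) (swapAt-involutive i l)

At-swap : ∀ {R i α} → At R i α → At (flip R) i (swapAt i α)
At-swap (here r)  = here r
At-swap (there p) = there (At-swap p)

swapAt-flat : ∀ {i α} → At _≡_ i α → swapAt i α ≡ α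
swapAt-flat (here refl) = refl
swapAt-flat (there p)   = cong (_ ∷_) (swapAt-flat p)

length-swapAt : ∀ i l → length (swapAt i l) ≡ length l
length-swapAt zero    []          = refl
length-swapAt zero    (x ∷ [])    = refl
length-swapAt zero    (x ∷ y ∷ l) = refl
length-swapAt (suc i) []          = refl
length-swapAt (suc i) (x ∷ l)     = cong suc (length-swapAt i l)

swapAt-short : ∀ i l → length l ≤ suc i → swapAt i l ≡ l
swapAt-short zero    []          _ = refl
swapAt-short zero    (x ∷ [])    _ = refl
swapAt-short zero    (x ∷ y ∷ l) (s≤s ())
swapAt-short (suc i) []          _ = refl
swapAt-short (suc i) (x ∷ l)     (s≤s p) = cong (x ∷_) (swapAt-short i l p)

compareAt : ∀ i α → At _>_ i α ⊎ At _≤_ i α ⊎ length α ≤ suc i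
compareAt zero []       = inj₂ (inj₂ z≤n)
compareAt zero (x ∷ []) = inj₂ (inj₂ (s≤s z≤n))
compareAt zero (x ∷ y ∷ α) with x ℕ.≤? y
... | yes p = inj₂ (inj₁ (here p))
... | no ¬p = inj₁ (here (ℕₚ.≰⇒> ¬p))
compareAt (suc i) [] = inj₂ (inj₂ z≤n)
compareAt (suc i) (x ∷ α) with compareAt i α
... | inj₁ p = inj₁ (there p)
... | inj₂ (inj₁ p) = inj₂ (inj₁ (there p))
... | inj₂ (inj₂ p) = inj₂ (inj₂ (s≤s p))

dec-or-asc : ∀ α → Linked _≥_ α ⊎ ∃ λ i → At _<_ i α
dec-or-asc []       = inj₁ []
dec-or-asc (x ∷ []) = inj₁ [-]
dec-or-asc (x ∷ y ∷ α) with y ℕ.≤? x | dec-or-asc (y ∷ α)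
... | no ¬p | _              = inj₂ (0 , here (ℕₚ.≰⇒> ¬p))
... | yes p | inj₁ d         = inj₁ (p ∷ d)
... | yes p | inj₂ (i , asc) = inj₂ (suc i , there asc)

-- Each entry counts once for every position before it, so moving a larger entry to the left past a
-- smaller one lowers the weight.
weight : List ℕ → ℕ
weight []      = 0
weight (x ∷ l) = sum l + weight l

sum-swapAt : ∀ i l → sum (swapAt i l) ≡ sum l
sum-swapAt zero    []          = refl
sum-swapAt zero    (x ∷ [])    = refl
sum-swapAt zero    (x ∷ y ∷ l) = trans (sym (ℕₚ.+-assoc y x (sum l)))
  (trans (cong (_+ sum l) (ℕₚ.+-comm y x)) (ℕₚ.+-assoc x y (sum l)))
sum-swapAt (suc i) []          = refl
sum-swapAt (suc i) (x ∷ l)     = cong (x +_) (sum-swapAt i l)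

weight-swapAt : ∀ {i α} → At _<_ i α → weight (swapAt i α) < weight α
weight-swapAt (here p) = ℕₚ.+-monoˡ-< _ (ℕₚ.+-monoˡ-< _ p)
weight-swapAt {suc i} {x ∷ α} (there p) = subst (λ u → u + weight (swapAt i α) < sum α + weight α) (sym (sum-swapAt i α))
  (ℕₚ.+-monoʳ-< (sum α) (weight-swapAt p))

sorting-induction : (Q : List ℕ → Set) → (∀ α → Linked _≥_ α → Q α) →
  (∀ i α → At _>_ i α → Q α → Q (swapAt i α)) → ∀ α → Q α
sorting-induction Q base step α = go α (<-wellFounded (weight α))
  where
  go : ∀ α → Acc _<_ (weight α) → Q α
  go α (acc rec) with dec-or-asc α
  ... | inj₁ d = base α d
  ... | inj₂ (i , asc) = subst Q (swapAt-involutive i α)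
    (step i (swapAt i α) (At-swap asc) (go (swapAt i α) (rec (weight-swapAt asc))))

-- For a < b, (a , a , b) becomes (a , b , a) and then (b , a , a): undoing two ascents shifts the
-- equal pair one place to the right, which is the situation of `Ξ-braidˡ`.
flat-asc : ∀ {i α} → At _≡_ i α → At _<_ (suc i) α →
  At _<_ i (swapAt (suc i) α) × At _≡_ (suc i) (swapAt i (swapAt (suc i) α))
flat-asc (here refl) (there (here p)) = here p , there (here refl)
flat-asc (there f) (there a) with flat-asc f a
... | p , q = there p , there q

asc-flat : ∀ {i α} → At _≡_ (suc i) α → At _<_ i α →
  At _<_ (suc i) (swapAt i α) × At _≡_ i (swapAt (suc i) (swapAt i α))
asc-flat (there (here refl)) (here p) = there (here p) , here refl
asc-flat (there f) (there a) with asc-flat f a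
... | p , q = there p , there q

-- Key polynomials as coefficient functions, and their symmetry at weak ascents

record IsKeyCoeff (k : List ℕ → List ℕ → ℤ) : Set where
  field
    k-length : ∀ α e → length e ≢ length α → k α e ≡ 0ℤ
    k-refl   : ∀ α → Linked _≥_ α → k α α ≡ 1ℤ
    k-dec    : ∀ α e → Linked _≥_ α → e ≢ α → k α e ≡ 0ℤ
    k-swap   : ∀ i α → At _>_ i α → ∀ e → k (swapAt i α) e ≡ Ξ i (k α) e

module Symmetry {k : List ℕ → List ℕ → ℤ} (isKey : IsKeyCoeff k) where
  open IsKeyCoeff isKey

  k-asc : ∀ {i α} → At _<_ i α → ∀ e → k α e ≡ Ξ i (k (swapAt i α)) e
  k-asc {i} {α} asc e = subst (λ β → k β e ≡ Ξ i (k (swapAt i α)) e) (swapAt-involutive i α)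
    (k-swap i (swapAt i α) (At-swap asc) e)

  -- Induction on `weight`. For weakly decreasing α the coefficients are the indicator of α.
  -- Otherwise an ascent at j is undone: if j is far from i, the symmetry survives ξ_j; if j is
  -- adjacent to i, a second ascent is undone and a braid lemma applies.
  Symm-flat : ∀ {i} α → At _≡_ i α → Symm i (k α)
  Symm-flat α = go α (<-wellFounded (weight α))
    where
    go : ∀ {i} α → Acc _<_ (weight α) → At _≡_ i α → Symm i (k α)
    go {i} α (acc rec) flat with dec-or-asc α
    ... | inj₁ d = swapAt⇒Symm i δ-sym
      where
      δ-sym : ∀ e → k α (swapAt i e) ≡ k α e
      δ-sym e with ≡-dec ℕ._≟_ e α
      ... | yes refl = cong (k e) (swapAt-flat flat)
      ... | no e≢α = trans (k-dec α (swapAt i e) d λ q → e≢α (trans (sym (swapAt-involutive i e)) (trans (cong (swapAt i) q) (swapAt-flat flat))))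
        (sym (k-dec α e d e≢α))
    ... | inj₂ (j , asc) with proximity i j
    ...   | same   = Symm-cong i (sym ∘ k-asc asc) (Ξ-Symm i _)
    ...   | far f  = Symm-cong i (sym ∘ k-asc asc) (Ξ-Far f (go (swapAt j α) (rec (weight-swapAt asc)) (At-far f flat)))
    ...   | next   = Symm-cong i (λ e → sym (trans (k-asc asc e) (Ξ-cong (suc i) (k-asc asc′) e)))
                       (Ξ-braidˡ i (go _ (rec (ℕₚ.<-trans (weight-swapAt asc′) (weight-swapAt asc))) flat′))
      where
      asc′  = proj₁ (flat-asc flat asc)
      flat′ = proj₂ (flat-asc flat asc)
    ...   | prev refl = Symm-cong i (λ e → sym (trans (k-asc asc e) (Ξ-cong j (k-asc asc′) e)))
                       (Ξ-braidʳ j (go _ (rec (ℕₚ.<-trans (weight-swapAt asc′) (weight-swapAt asc))) flat′))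
      where
      asc′  = proj₁ (asc-flat flat asc)
      flat′ = proj₂ (asc-flat flat asc)

  At-≤-split : ∀ {i α} → At _≤_ i α → At _<_ i α ⊎ At _≡_ i α
  At-≤-split (here p) with ℕₚ.m≤n⇒m<n∨m≡n p
  ... | inj₁ q = inj₁ (here q)
  ... | inj₂ q = inj₂ (here q)
  At-≤-split (there p) with At-≤-split p
  ... | inj₁ q = inj₁ (there q)
  ... | inj₂ q = inj₂ (there q)

  Symm-k : ∀ {i} α → At _≤_ i α → Symm i (k α)
  Symm-k {i} α p with At-≤-split p
  ... | inj₁ asc  = Symm-cong i (sym ∘ k-asc asc) (Ξ-Symm i _)
  ... | inj₂ flat = Symm-flat α flat

  Symm-short : ∀ i α → length α ≤ suc i → Symm i (k α)
  Symm-short i α short = swapAt⇒Symm i λ e → go e (length e ℕ.≟ length α)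
    where
    go : ∀ e → _ → k α (swapAt i e) ≡ k α e
    go e (yes q) = cong (k α) (swapAt-short i e (subst (_≤ suc i) (sym q) short))
    go e (no ¬q) = trans (k-length α _ (¬q ∘ trans (sym (length-swapAt i e)))) (sym (k-length α e ¬q))

  -- At a descent ξ_i gives the next key polynomial; at a weak ascent, or outside the variables, 𝒦_α
  -- is symmetric and hence fixed. So ξ_i never leaves the set of key polynomials, which is the
  -- source of positivity.
  Ξ-k : ∀ i α → ∃ λ β → (∀ e → Ξ i (k α) e ≡ k β e) ×
        ((At _>_ i α × β ≡ swapAt i α) ⊎ (Symm i (k α) × β ≡ α))
  Ξ-k i α with compareAt i α
  ... | inj₁ d        = swapAt i α , (λ e → sym (k-swap i α d e)) , inj₁ (d , refl)
  ... | inj₂ (inj₁ p) = α , Ξ-fix i (Symm-k α p) , inj₂ (Symm-k α p , refl)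
  ... | inj₂ (inj₂ p) = α , Ξ-fix i (Symm-short i α p) , inj₂ (Symm-short i α p , refl)

-- Transfers and supports

-- x is the earlier entry in the list. The conditions place x′ and y′ both between x and y, so x′ -
-- x units, at most y - x, have moved from y to x; x ≤ y follows.
record Transfer (x y x′ y′ : ℕ) : Set where
  constructor transfer
  field
    total : x + y ≡ x′ + y′
    ≤₁    : x ≤ x′
    ≤₂    : x ≤ y′

-- The integral points of the segment from (a , b) to (b , a), where all exponents of ξ (x^a y^b)
-- lie.
Hull : ℕ → ℕ → ℕ → ℕ → Set
Hull a b a′ b′ = Transfer a b a′ b′ ⊎ Transfer b a a′ b′

Transfer-swap : ∀ {x y x′ y′} → Transfer x y x′ y′ → Transfer x y y′ x′
Transfer-swap {x′ = x′} {y′} (transfer t p q) = transfer (trans t (ℕₚ.+-comm x′ y′)) q p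

Hull-swap : ∀ {x y x′ y′} → Hull x y x′ y′ → Hull x y y′ x′
Hull-swap (inj₁ t) = inj₁ (Transfer-swap t)
Hull-swap (inj₂ t) = inj₂ (Transfer-swap t)

Transfer-refl : ∀ {x y} → x ≤ y → Transfer x y x y
Transfer-refl p = transfer refl ℕₚ.≤-refl p

Hull-refl : ∀ x y → Hull x y x y
Hull-refl x y with ℕₚ.≤-total x y
... | inj₁ p = inj₁ (Transfer-refl p)
... | inj₂ p = inj₂ (Transfer-swap (Transfer-refl p))

Transfer-trans : ∀ {x y x₁ y₁ x₂ y₂} → Transfer x y x₁ y₁ → Transfer x₁ y₁ x₂ y₂ → Transfer x y x₂ y₂
Transfer-trans (transfer t p q) (transfer t′ p′ q′) =
  transfer (trans t t′) (ℕₚ.≤-trans p p′) (ℕₚ.≤-trans p q′)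

Hull-Transfer : ∀ {x y x₁ y₁ x₂ y₂} → Hull x y x₁ y₁ → Transfer x₁ y₁ x₂ y₂ → Hull x y x₂ y₂
Hull-Transfer (inj₁ s) t = inj₁ (Transfer-trans s t)
Hull-Transfer (inj₂ s) t = inj₂ (Transfer-trans s t)

-- In both lemmas one transfer touches one entry of a hull pair; it is replayed on the pair
-- (m , M) spanning the hull, either at one entry only or, when the hull becomes too narrow, at both.

transfer-into : ∀ {x y x′ y′ z m M} → Transfer x y x′ y′ → Transfer m M y z →
  (∃ λ w → Transfer x M x′ w × Transfer m w y′ z) ⊎
  (∃ λ x₁ → Transfer x m x₁ y′ × Transfer x₁ M x′ z)
transfer-into {x} {y} {x′} {y′} {z} {m} {M} (transfer t p q) (transfer t′ p′ q′)
  with ℕₚ.m≤n⇒∃[o]m+o≡n p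
... | k , refl with ℕₚ.+-cancelˡ-≡ x y (k + y′) (trans t (ℕₚ.+-assoc x k y′))
...   | refl with ℕₚ.m≤n⇒∃[o]m+o≡n q′
...     | j , refl with ℕₚ.+-cancelˡ-≡ m M ((k + y′) + j) (trans t′ (s₁ k y′ m j))
  where
  s₁ : ∀ k y′ m j → (k + y′) + (m + j) ≡ m + ((k + y′) + j)
  s₁ = ℕ-Solver.solve-∀
...       | refl with ℕₚ.≤-total m y′
...         | inj₁ m≤y′ = inj₁ (y′ + j , transfer (s₂ x k y′ j) p (ℕₚ.≤-trans q (ℕₚ.m≤m+n y′ j)) , transfer (s₃ m y′ j) m≤y′ q′)
  where
  s₂ : ∀ x k y′ j → x + ((k + y′) + j) ≡ (x + k) + (y′ + j)
  s₂ = ℕ-Solver.solve-∀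
  s₃ : ∀ m y′ j → m + (y′ + j) ≡ y′ + (m + j)
  s₃ = ℕ-Solver.solve-∀
-- Now y′ is at most m, so the hull of m and M is too narrow: x first takes m - y′ units from m,
-- then the remaining ones from M, which leaves z.
...         | inj₂ y′≤m with ℕₚ.m≤n⇒∃[o]m+o≡n y′≤m
...           | i , refl with ℕₚ.m≤n⇒∃[o]m+o≡n (ℕₚ.+-cancelˡ-≤ y′ i k (subst (y′ + i ≤_) (ℕₚ.+-comm k y′) p′))
...             | l , refl = inj₂ (x + i , transfer (s₂ x y′ i) (ℕₚ.m≤m+n x i) q ,
                  transfer (s₃ x i l y′ j) (subst (x + i ≤_) (ℕₚ.+-assoc x i l) (ℕₚ.m≤m+n (x + i) l))
                    (ℕₚ.≤-trans (ℕₚ.+-monoˡ-≤ i q) (ℕₚ.m≤m+n (y′ + i) j)))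
  where
  s₂ : ∀ x y′ i → x + (y′ + i) ≡ (x + i) + y′
  s₂ = ℕ-Solver.solve-∀
  s₃ : ∀ x i l y′ j → (x + i) + (((i + l) + y′) + j) ≡ (x + (i + l)) + ((y′ + i) + j)
  s₃ = ℕ-Solver.solve-∀

transfer-out : ∀ {x y x′ y′ z m M} → Transfer y x y′ x′ → Transfer m M y z →
  (∃ λ w → Transfer m x w x′ × Transfer w M y′ z) ⊎
  (∃ λ x₁ → Transfer M x y′ x₁ × Transfer m x₁ z x′)
transfer-out {x} {y} {x′} {y′} {z} {m} {M} (transfer t p q) (transfer t′ p′ q′)
  with ℕₚ.m≤n⇒∃[o]m+o≡n p
... | k , refl with ℕₚ.+-cancelˡ-≡ y x (k + x′) (trans t (ℕₚ.+-assoc y k x′))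
...   | refl with ℕₚ.m≤n⇒∃[o]m+o≡n q′
...     | j , refl with ℕₚ.+-cancelˡ-≡ m M (y + j) (trans t′ (s₁ y m j))
  where
  s₁ : ∀ y m j → y + (m + j) ≡ m + (y + j)
  s₁ = ℕ-Solver.solve-∀
...       | refl with ℕₚ.≤-total k j
...         | inj₁ k≤j = inj₁ (m + k , transfer (sym (ℕₚ.+-assoc m k x′)) (ℕₚ.m≤m+n m k) (ℕₚ.≤-trans p′ q) ,
                transfer (s₂ m k y j) (ℕₚ.+-monoˡ-≤ k p′) (ℕₚ.+-monoʳ-≤ m k≤j))
  where
  s₂ : ∀ m k y j → (m + k) + (y + j) ≡ (y + k) + (m + j)
  s₂ = ℕ-Solver.solve-∀
-- Now y′ is at least M: M is raised to y′ and then m to z, both at the expense of x.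
...         | inj₂ j≤k with ℕₚ.m≤n⇒∃[o]m+o≡n j≤k
...           | i , refl = inj₂ (x′ + j ,
                transfer (s₂ y j i x′) (ℕₚ.+-monoʳ-≤ y (ℕₚ.m≤m+n j i)) (ℕₚ.+-monoˡ-≤ j q) ,
                transfer (s₃ m x′ j) (ℕₚ.m≤m+n m j) (ℕₚ.≤-trans p′ q))
  where
  s₂ : ∀ y j i x′ → (y + j) + ((j + i) + x′) ≡ (y + (j + i)) + (x′ + j)
  s₂ = ℕ-Solver.solve-∀
  s₃ : ∀ m x′ j → m + (x′ + j) ≡ (m + j) + x′
  s₃ = ℕ-Solver.solve-∀

-- Paths of transfers and their commutation with hull steps

data Repl (y y′ : ℕ) : List ℕ → List ℕ → Set where
  here  : ∀ {l} → Repl y y′ (y ∷ l) (y′ ∷ l)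
  there : ∀ {x l l′} → Repl y y′ l l′ → Repl y y′ (x ∷ l) (x ∷ l′)

infix 4 _⟶_ _⟶*_

data _⟶_ : List ℕ → List ℕ → Set where
  hd : ∀ {x y x′ y′ u v} → Transfer x y x′ y′ → Repl y y′ u v → x ∷ u ⟶ x′ ∷ v
  tl : ∀ {x u v} → u ⟶ v → x ∷ u ⟶ x ∷ v

_⟶*_ : List ℕ → List ℕ → Set
_⟶*_ = Star _⟶_

data HullAt : ℕ → List ℕ → List ℕ → Set where
  here  : ∀ {a b a′ b′ l} → Hull a b a′ b′ → HullAt 0 (a ∷ b ∷ l) (a′ ∷ b′ ∷ l)
  there : ∀ {i x u v} → HullAt i u v → HullAt (suc i) (x ∷ u) (x ∷ v)

Repl-split : ∀ {x x′ u v} → Repl x x′ u v → ∀ x₁ → ∃ λ w → Repl x x₁ u w × Repl x₁ x′ w v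
Repl-split here      x₁ = _ , here , here
Repl-split (there r) x₁ with Repl-split r x₁
... | w , r₁ , r₂ = _ , there r₁ , there r₂

Repl-refl⇒≡ : ∀ {y u v} → Repl y y u v → u ≡ v
Repl-refl⇒≡ here      = refl
Repl-refl⇒≡ (there r) = cong (_ ∷_) (Repl-refl⇒≡ r)

Repl-swapAt : ∀ i {y y′ u v} → Repl y y′ u v → Repl y y′ (swapAt i u) (swapAt i v)
Repl-swapAt zero {u = _ ∷ []} here = here
Repl-swapAt zero {u = _ ∷ _ ∷ _} here = there here
Repl-swapAt zero {u = _ ∷ _ ∷ _} (there here) = here
Repl-swapAt zero {u = _ ∷ _ ∷ _} (there (there r)) = there (there r)
Repl-swapAt (suc i) here = here
Repl-swapAt (suc i) (there r) = there (Repl-swapAt i r)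

-- Puts a bystander p back behind the head, so that a path found without p becomes one with p.
insertSecond : ℕ → List ℕ → List ℕ
insertSecond p []      = []
insertSecond p (x ∷ u) = x ∷ p ∷ u

insertSecond-⟶ : ∀ p {u v} → u ⟶ v → insertSecond p u ⟶ insertSecond p v
insertSecond-⟶ p (hd t r) = hd t (there r)
insertSecond-⟶ p (tl s)   = tl (tl s)

hull-into : ∀ {x y x′ y′ z a b l} → Transfer x y x′ y′ → Hull a b y z →
  ∃₂ λ a′ b′ → x ∷ a ∷ b ∷ l ⟶* x′ ∷ a′ ∷ b′ ∷ l × Hull a′ b′ y′ z
hull-into t (inj₁ h) with transfer-into t h
... | inj₁ (w , t₁ , h₁)  = _ , _ , hd t₁ (there here) ◅ ε , inj₁ h₁
... | inj₂ (x₁ , t₁ , t₂) = _ , _ , hd t₁ here ◅ hd t₂ (there here) ◅ ε , Hull-refl _ _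
hull-into t (inj₂ h) with transfer-into t h
... | inj₁ (w , t₁ , h₁)  = _ , _ , hd t₁ here ◅ ε , inj₂ h₁
... | inj₂ (x₁ , t₁ , t₂) = _ , _ , hd t₁ (there here) ◅ hd t₂ here ◅ ε , Hull-swap (Hull-refl _ _)

hull-out : ∀ {x y x′ y′ z a b u v} → Transfer y x y′ x′ → Repl x x′ u v → Hull a b y z →
  ∃₂ λ a′ b′ → a ∷ b ∷ u ⟶* a′ ∷ b′ ∷ v × Hull a′ b′ y′ z
hull-out t r (inj₁ h) with transfer-out t h
... | inj₁ (w , t₁ , h₁)  = _ , _ , hd t₁ (there r) ◅ ε , inj₁ h₁
... | inj₂ (x₁ , t₁ , t₂) with Repl-split r x₁
...   | _ , r₁ , r₂ = _ , _ , tl (hd t₁ r₁) ◅ hd t₂ (there r₂) ◅ ε , Hull-swap (Hull-refl _ _)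
hull-out t r (inj₂ h) with transfer-out t h
... | inj₁ (w , t₁ , h₁)  = _ , _ , tl (hd t₁ r) ◅ ε , inj₂ h₁
... | inj₂ (x₁ , t₁ , t₂) with Repl-split r x₁
...   | _ , r₁ , r₂ = _ , _ , hd t₁ (there r₁) ◅ tl (hd t₂ r₂) ◅ ε , Hull-refl _ _

HullAt-hd : ∀ {i u v w x y x′ y′} → HullAt i u v → Repl y y′ v w → Transfer x y x′ y′ →
  ∃ λ u′ → x ∷ u ⟶* x′ ∷ u′ × HullAt i u′ w
HullAt-hd (here h) here t with hull-into t h
... | _ , _ , s , h′ = _ , s , here h′
HullAt-hd (here h) (there here) t with hull-into t (Hull-swap h)
... | _ , _ , s , h′ = _ , s , here (Hull-swap h′)
HullAt-hd (here h) (there (there r)) t = _ , hd t (there (there r)) ◅ ε , here h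
HullAt-hd (there h) here t = _ , hd t here ◅ ε , there h
HullAt-hd (there {x = p} h) (there r) t with HullAt-hd h r t
... | _ , s , h′ = _ , gmap (insertSecond p) (insertSecond-⟶ p) s , there h′

-- A hull step can be postponed past a transfer: a transfer within the pair is absorbed by the hull,
-- a disjoint one commutes, and one that shares a single entry with the pair is replayed by
-- `transfer-into` or `transfer-out`. In the proof of full support this carries a swap at the start
-- of a path to its end, where it matches an application of ξ_i.
HullAt-⟶ : ∀ {i u v w} → HullAt i u v → v ⟶ w → ∃ λ u′ → u ⟶* u′ × HullAt i u′ w
HullAt-⟶ (here h) (hd t here) = _ , ε , here (Hull-Transfer h t)
HullAt-⟶ (here h) (hd t (there r)) with hull-out t r h
... | _ , _ , s , h′ = _ , s , here h′
HullAt-⟶ (here h) (tl (hd t r)) with hull-out t r (Hull-swap h)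
... | _ , _ , s , h′ = _ , s , here (Hull-swap h′)
HullAt-⟶ (here h) (tl (tl s)) = _ , tl (tl s) ◅ ε , here h
HullAt-⟶ (there h) (hd t r) with HullAt-hd h r t
... | _ , s , h′ = _ , s , there h′
HullAt-⟶ (there h) (tl s) with HullAt-⟶ h s
... | _ , s′ , h′ = _ , gmap (_ ∷_) tl s′ , there h′

HullAt-⟶* : ∀ {i u v w} → HullAt i u v → v ⟶* w → ∃ λ u′ → u ⟶* u′ × HullAt i u′ w
HullAt-⟶* h ε = _ , ε , h
HullAt-⟶* h (s ◅ ss) with HullAt-⟶ h s
... | _ , s′ , h′ with HullAt-⟶* h′ ss
...   | _ , ss′ , h″ = _ , s′ ◅◅ ss′ , h″

asc-⟶ : ∀ {i α} → At _≤_ i α → α ⟶ swapAt i α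
asc-⟶ (here p)  = hd (Transfer-swap (Transfer-refl p)) here
asc-⟶ (there p) = tl (asc-⟶ p)

HullAt-⟶-or : ∀ {i u v} → HullAt i u v → (u ⟶ v) ⊎ (swapAt i u ⟶ v)
HullAt-⟶-or (here (inj₁ t)) = inj₁ (hd t here)
HullAt-⟶-or (here (inj₂ t)) = inj₂ (hd t here)
HullAt-⟶-or (there h) with HullAt-⟶-or h
... | inj₁ s = inj₁ (tl s)
... | inj₂ s = inj₂ (tl s)

HullAt-swapAt : ∀ {i α} → At _>_ i α → HullAt i α (swapAt i α)
HullAt-swapAt (here p)  = here (Hull-swap (Hull-refl _ _))
HullAt-swapAt (there p) = there (HullAt-swapAt p)

⟶-swapAt : ∀ i {u v} → u ⟶ v → (swapAt i u ⟶ swapAt i v) ⊎ (u ⟶ swapAt i v)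
⟶-swapAt zero (hd t here)              = inj₂ (hd (Transfer-swap t) here)
⟶-swapAt zero (hd t (there r))         = inj₁ (tl (hd t r))
⟶-swapAt zero (tl (hd t r))            = inj₁ (hd t (there r))
⟶-swapAt zero (tl (tl s))              = inj₁ (tl (tl s))
⟶-swapAt (suc i) (hd t r)              = inj₁ (hd t (Repl-swapAt i r))
⟶-swapAt (suc i) (tl s) with ⟶-swapAt i s
... | inj₁ s′ = inj₁ (tl s′)
... | inj₂ s′ = inj₂ (tl s′)

-- A path is conjugated by the transposition step by step; a step at the swapped pair itself
-- can end in either order of the pair, so there conjugation is not needed.
⟶*-swapAt : ∀ {i β} → At _≤_ i β → ∀ {e} → β ⟶* e → β ⟶* swapAt i e
⟶*-swapAt {i} {β} asc = go ε (asc-⟶ asc ◅ ε)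
  where
  go : ∀ {x e} → β ⟶* x → β ⟶* swapAt i x → x ⟶* e → β ⟶* swapAt i e
  go p q ε = q
  go p q (s ◅ ss) with ⟶-swapAt i s
  ... | inj₁ s′ = go (p ◅◅ s ◅ ε) (q ◅◅ s′ ◅ ε) ss
  ... | inj₂ s′ = go (p ◅◅ s ◅ ε) (p ◅◅ s′ ◅ ε) ss

⟶*-HullAt : ∀ {i β} → At _≤_ i β → ∀ {e e′} → β ⟶* e → HullAt i e e′ → β ⟶* e′
⟶*-HullAt asc p h with HullAt-⟶-or h
... | inj₁ s = p ◅◅ s ◅ ε
... | inj₂ s = ⟶*-swapAt asc p ◅◅ s ◅ ε

-- Applying ξ_i enlarges a support by hull steps at most. `swapAt i α` reaches α by one transfer,
-- and since it has an ascent at i, what it reaches is closed under swaps at i and thus under hull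
-- steps.
⟶*-HullAt-desc : ∀ {i α} → At _>_ i α → ∀ {e e′} → α ⟶* e → HullAt i e e′ → swapAt i α ⟶* e′
⟶*-HullAt-desc {i} {α} desc p h = ⟶*-HullAt asc (subst (swapAt i α ⟶_) (swapAt-involutive i α) (asc-⟶ asc) ◅ p) h
  where asc = At-map ℕₚ.<⇒≤ (At-swap desc)

-- Invariants of paths and the upper bound for the support

Repl-All : ∀ {P : ℕ → Set} {y y′ u v} → Repl y y′ u v → P y′ → All P u → All P v
Repl-All here      p (_ ∷ ps) = p ∷ ps
Repl-All (there r) p (q ∷ ps) = q ∷ Repl-All r p ps

Repl-lookup : ∀ {P : ℕ → Set} {y y′ u v} → Repl y y′ u v → All P u → P y
Repl-lookup here      (p ∷ _) = p
Repl-lookup (there r) (_ ∷ p) = Repl-lookup r p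

Repl-length : ∀ {y y′ u v} → Repl y y′ u v → length u ≡ length v
Repl-length here      = refl
Repl-length (there r) = cong suc (Repl-length r)

⟶-length : ∀ {u v} → u ⟶ v → length u ≡ length v
⟶-length (hd _ r) = cong suc (Repl-length r)
⟶-length (tl s)   = cong suc (⟶-length s)

⟶*-length : ∀ {u v} → u ⟶* v → length u ≡ length v
⟶*-length ε        = refl
⟶*-length (s ◅ ss) = trans (⟶-length s) (⟶*-length ss)

Transfer-≤ˡ : ∀ {x y x′ y′} → Transfer x y x′ y′ → x′ ≤ y
Transfer-≤ˡ {x} {y} {x′} {y′} (transfer t p q) = ℕₚ.+-cancelˡ-≤ x x′ y
  (ℕₚ.≤-trans (ℕₚ.+-monoˡ-≤ x′ q) (ℕₚ.≤-reflexive (trans (ℕₚ.+-comm y′ x′) (sym t))))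

Transfer-≤ʳ : ∀ {x y x′ y′} → Transfer x y x′ y′ → y′ ≤ y
Transfer-≤ʳ = Transfer-≤ˡ ∘ Transfer-swap

⟶-All≤ : ∀ {M u v} → u ⟶ v → All (_≤ M) u → All (_≤ M) v
⟶-All≤ (hd t r) (p ∷ ps) = ℕₚ.≤-trans (Transfer-≤ˡ t) q ∷ Repl-All r (ℕₚ.≤-trans (Transfer-≤ʳ t) q) ps
  where q = Repl-lookup r ps
⟶-All≤ (tl s)   (p ∷ ps) = p ∷ ⟶-All≤ s ps

⟶*-All≤ : ∀ {M u v} → u ⟶* v → All (_≤ M) u → All (_≤ M) v
⟶*-All≤ ε        ps = ps
⟶*-All≤ (s ◅ ss) ps = ⟶*-All≤ ss (⟶-All≤ s ps)

-- A transfer into a maximal head d has d ≤ x′ ≤ y ≤ d, so it changes nothing.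
⟶*-max-head : ∀ {d u v} → All (_≤ d) u → d ∷ u ⟶* v → ∃ λ u′ → v ≡ d ∷ u′ × u ⟶* u′
⟶*-max-head ps ε = _ , refl , ε
⟶*-max-head {d} ps (hd {y = y} {x′} {y′} t@(transfer e p q) r ◅ ss)
  with ℕₚ.≤-antisym p (ℕₚ.≤-trans (Transfer-≤ˡ t) (Repl-lookup r ps))
... | refl with ℕₚ.+-cancelˡ-≡ d y y′ e
...   | refl with Repl-refl⇒≡ r
...     | refl = ⟶*-max-head ps ss
⟶*-max-head ps (tl s ◅ ss) with ⟶*-max-head (⟶-All≤ s ps) ss
... | _ , refl , ss′ = _ , refl , s ◅ ss′

linked-head : ∀ {x α} → Linked _≥_ (x ∷ α) → All (_≤ x) α
linked-head [-]      = []
linked-head (p ∷ ps) = p ∷ go p (linked-head ps)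
  where
  go : ∀ {x y α} → y ≤ x → All (_≤ y) α → All (_≤ x) α
  go p []       = []
  go p (q ∷ qs) = ℕₚ.≤-trans q p ∷ go p qs

linked-cons : ∀ {x α} → All (_≤ x) α → Linked _≥_ α → Linked _≥_ (x ∷ α)
linked-cons []      []  = [-]
linked-cons (p ∷ _) l = p ∷ l

⟶*-dec : ∀ {α e} → Linked _≥_ α → α ⟶* e → e ≡ α
⟶*-dec {[]} l ε = refl
⟶*-dec {x ∷ α} l ss with ⟶*-max-head (linked-head l) ss
... | _ , refl , ss′ = cong (x ∷_) (⟶*-dec (Linked.tail l) ss′)

-- Started with the smaller exponent in second place, the recursion meets f only at pairs with an
-- entry not exceeding that exponent, and (a , b) lies in the hull of each such pair. The symmetry
-- of `ξ` permits this start.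
ξ-support : ∀ f a b → ξ f a b ≢ 0ℤ → ∃₂ λ a′ b′ → Hull a′ b′ a b × f a′ b′ ≢ 0ℤ
ξ-support f a b nz = go₂ (ℕₚ.≤-total b a)
  where
  go : ∀ {a₀ b₀} a b → a + b ≡ a₀ + b₀ → b ≤ a₀ → b ≤ b₀ → ξ f a b ≢ 0ℤ →
       ∃₂ λ a′ b′ → Hull a′ b′ a₀ b₀ × f a′ b′ ≢ 0ℤ
  go a zero    e p q nz = a , zero , inj₂ (transfer (trans (ℕₚ.+-comm 0 a) e) z≤n z≤n) , nz
  go a (suc b) e p q nz with f a (suc b) ℤ.≟ 0ℤ | f b (suc a) ℤ.≟ 0ℤ
  ... | no ¬z | _ = a , suc b , inj₂ (transfer (trans (ℕₚ.+-comm (suc b) a) e) p q) , ¬z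
  ... | yes _ | no ¬z = b , suc a , inj₁ (transfer (trans (trans (ℕₚ.+-suc b a) (ℕₚ.+-comm (suc b) a)) e) (ℕₚ.<⇒≤ p) (ℕₚ.<⇒≤ q)) , ¬z
  ... | yes z | yes z′ = go (suc a) b (trans (sym (ℕₚ.+-suc a b)) e) (ℕₚ.<⇒≤ p) (ℕₚ.<⇒≤ q)
    λ z″ → nz (cong₂ ℤ._+_ (cong₂ ℤ._-_ z z′) z″)

  go₂ : b ≤ a ⊎ a ≤ b → ∃₂ λ a′ b′ → Hull a′ b′ a b × f a′ b′ ≢ 0ℤ
  go₂ (inj₁ b≤a) = go a b refl b≤a ℕₚ.≤-refl nz
  go₂ (inj₂ a≤b) with go b a refl a≤b ℕₚ.≤-refl (nz ∘ trans (ξ-sym f a b))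
  ... | a′ , b′ , h , nz′ = a′ , b′ , Hull-swap h , nz′

Ξ-support : ∀ i c e → Ξ i c e ≢ 0ℤ → ∃ λ e′ → (e′ ≡ e ⊎ HullAt i e′ e) × c e′ ≢ 0ℤ
Ξ-support zero c (a ∷ b ∷ e) nz with ξ-support _ a b nz
... | _ , _ , h , nz′ = _ , inj₂ (here h) , nz′
Ξ-support zero c (a ∷ []) nz = _ , inj₁ refl , nz
Ξ-support zero c []       nz = _ , inj₁ refl , nz
Ξ-support (suc i) c (s ∷ e) nz with Ξ-support i _ e nz
... | _ , inj₁ refl , nz′ = _ , inj₁ refl , nz′
... | _ , inj₂ h    , nz′ = _ , inj₂ (there h) , nz′
Ξ-support (suc i) c []    nz = _ , inj₁ refl , nz

module Support {k : List ℕ → List ℕ → ℤ} (isKey : IsKeyCoeff k) where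
  open IsKeyCoeff isKey
  open Symmetry isKey

  k-support : ∀ α e → k α e ≢ 0ℤ → α ⟶* e
  k-support = sorting-induction _ base step
    where
    base : ∀ α → Linked _≥_ α → ∀ e → k α e ≢ 0ℤ → α ⟶* e
    base α d e nz with ≡-dec ℕ._≟_ e α
    ... | yes refl = ε
    ... | no ¬e = ⊥-elim (nz (k-dec α e d ¬e))
    step : ∀ i α → At _>_ i α → (∀ e → k α e ≢ 0ℤ → α ⟶* e) → ∀ e → k (swapAt i α) e ≢ 0ℤ → swapAt i α ⟶* e
    step i α desc ih e nz with Ξ-support i (k α) e (nz ∘ trans (k-swap i α desc e))
    ... | e′ , inj₂ h , nz′ = ⟶*-HullAt-desc desc (ih e′ nz′) h
    ... | e′ , inj₁ refl , nz′ = subst (swapAt i α ⟶_) (swapAt-involutive i α) (asc-⟶ (At-map ℕₚ.<⇒≤ (At-swap desc))) ◅ ih e′ nz′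

-- Branching, positivity and the full support

infixr 5 _⊲_

-- The coefficients of x_1^d c(x_2, x_3, ...).
_⊲_ : ℕ → (List ℕ → ℤ) → List ℕ → ℤ
(d ⊲ c) []      = 0ℤ
(d ⊲ c) (s ∷ e) with s ℕ.≟ d
... | yes _ = c e
... | no  _ = 0ℤ

⊲-here : ∀ d c e → (d ⊲ c) (d ∷ e) ≡ c e
⊲-here d c e with d ℕ.≟ d
... | yes _ = refl
... | no ¬p = ⊥-elim (¬p refl)

⊲-there : ∀ {d s} c e → s ≢ d → (d ⊲ c) (s ∷ e) ≡ 0ℤ
⊲-there {d} {s} c e s≢d with s ℕ.≟ d
... | yes p = ⊥-elim (s≢d p)
... | no  _ = refl

⊲-zero : ∀ {d c e} s → c e ≡ 0ℤ → (d ⊲ c) (s ∷ e) ≡ 0ℤ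
⊲-zero {d} s z with s ℕ.≟ d
... | yes _ = z
... | no  _ = refl

⊲-cong : ∀ d {c c′} → (∀ e → c e ≡ c′ e) → ∀ e → (d ⊲ c) e ≡ (d ⊲ c′) e
⊲-cong d c≗c′ []      = refl
⊲-cong d c≗c′ (s ∷ e) with s ℕ.≟ d
... | yes _ = c≗c′ e
... | no  _ = refl

⊲-0 : ∀ d e → (d ⊲ λ _ → 0ℤ) e ≡ 0ℤ
⊲-0 d []      = refl
⊲-0 d (s ∷ e) with s ℕ.≟ d
... | yes _ = refl
... | no  _ = refl

⊲-+ : ∀ d c c′ e → (d ⊲ λ e → c e ℤ.+ c′ e) e ≡ (d ⊲ c) e ℤ.+ (d ⊲ c′) e
⊲-+ d c c′ []      = refl
⊲-+ d c c′ (s ∷ e) with s ℕ.≟ d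
... | yes _ = refl
... | no  _ = refl

Ξ-⊲ : ∀ i d c e → Ξ (suc i) (d ⊲ c) e ≡ (d ⊲ Ξ i c) e
Ξ-⊲ i d c []      = refl
Ξ-⊲ i d c (s ∷ e) with s ℕ.≟ d
... | yes _ = refl
... | no  _ = Ξ-0 i e

-- Two coefficients need comparing only where one of them is nonzero, and there the support lemmas
-- supply the shape of the exponent.
agree : ∀ {x y : ℤ} → (x ≢ 0ℤ → x ≡ y) → (y ≢ 0ℤ → x ≡ y) → x ≡ y
agree {x} {y} f g with x ℤ.≟ 0ℤ | y ℤ.≟ 0ℤ
... | no p  | _     = f p
... | yes _ | no q  = g q
... | yes p | yes q = trans p (sym q)

module _ {d : ℕ} {c : List ℕ → ℤ} (bound : ∀ y e → c (y ∷ e) ≢ 0ℤ → y ≤ d) where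
  private
    f : List ℕ → ℕ → ℕ → ℤ
    f e x y = (d ⊲ c) (x ∷ y ∷ e)

  ⊲-nonzero : ∀ {x y e} → f e x y ≢ 0ℤ → x ≡ d × y ≤ d
  ⊲-nonzero {x} {y} {e} nz with x ℕ.≟ d
  ... | yes p = p , bound y e nz
  ... | no ¬p = ⊥-elim (nz refl)

  Ξ-⊲-support : ∀ s t e → Ξ 0 (d ⊲ c) (s ∷ t ∷ e) ≢ 0ℤ → ∃ λ y → Transfer y d s t
  Ξ-⊲-support s t e nz with ξ-support (f e) s t nz
  ... | x , y , h , nz′ with ⊲-nonzero {x} {y} {e} nz′
  Ξ-⊲-support s t e nz | x , y , inj₂ tr , nz′ | refl , y≤d = y , tr
  Ξ-⊲-support s t e nz | x , y , inj₁ tr , nz′ | refl , y≤d with ℕₚ.≤-antisym y≤d (ℕₚ.≤-trans (Transfer.≤₁ tr) (Transfer-≤ˡ tr))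
  ... | refl = y , tr

  -- For y ≤ d, ξ sends x_1^d x_2^y to the sum of all x_1^s x_2^t with s + t = d + y and s, t ≥ y,
  -- each with coefficient 1. As s + t determines y, a single coefficient of c contributes.
  Ξ-⊲-value : ∀ {y} s t e → Transfer y d s t → Ξ 0 (d ⊲ c) (s ∷ t ∷ e) ≡ c (y ∷ e)
  Ξ-⊲-value {zero} s zero e (transfer p q r) rewrite trans (ℕₚ.+-comm 0 s) (sym p) = ⊲-here d c (0 ∷ e)
  Ξ-⊲-value {suc y} s zero e (transfer p q ())
  Ξ-⊲-value {y} s (suc t) e tr@(transfer p q r) with s ℕ.≟ d | t ℕ.≟ d
  ... | _ | yes refl = ⊥-elim (ℕₚ.<-irrefl refl (Transfer-≤ʳ tr))
  ... | yes refl | no _ with ℕₚ.+-cancelˡ-≡ s y (suc t) (trans (ℕₚ.+-comm s y) p)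
  ...   | refl = trans (cong₂ ℤ._+_ (ℤₚ.+-identityʳ (c (suc t ∷ e))) zero-rest) (ℤₚ.+-identityʳ (c (suc t ∷ e)))
    where
    zero-rest : ξ (f e) (suc s) t ≡ 0ℤ
    zero-rest with ξ (f e) (suc s) t ℤ.≟ 0ℤ
    ... | yes z = z
    ... | no nz = ⊥-elim (ℕₚ.<-irrefl refl (Transfer-≤ˡ (proj₂ (Ξ-⊲-support (suc s) t e nz))))
  Ξ-⊲-value {y} s (suc t) e tr@(transfer p q r) | no s≢d | no _ =
    trans (ℤₚ.+-identityˡ _) (Ξ-⊲-value (suc s) t e (transfer (trans p (ℕₚ.+-suc s t)) (ℕₚ.m≤n⇒m≤1+n q) y≤t))
    where
    s<d : s < d
    s<d = ℕₚ.≤∧≢⇒< (Transfer-≤ˡ tr) s≢d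
    y≤t : y ≤ t
    y≤t = ℕₚ.≤-pred (ℕₚ.+-cancelˡ-< d y (suc t) (subst (_< d + suc t) (trans (sym p) (ℕₚ.+-comm y d)) (ℕₚ.+-monoˡ-< (suc t) s<d)))

HullAt-length : ∀ {i u v} → HullAt i u v → length u ≡ length v
HullAt-length (here h)  = refl
HullAt-length (there h) = cong suc (HullAt-length h)

All-swapAt : ∀ {P : ℕ → Set} i {α} → All P α → All P (swapAt i α)
All-swapAt zero    []           = []
All-swapAt zero    (p ∷ [])     = p ∷ []
All-swapAt zero    (p ∷ q ∷ ps) = q ∷ p ∷ ps
All-swapAt (suc i) []           = []
All-swapAt (suc i) (p ∷ ps)     = p ∷ All-swapAt i ps

All-≤-sum : ∀ α → All (_≤ sum α) α
All-≤-sum []      = []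
All-≤-sum (x ∷ α) = ℕₚ.m≤m+n x (sum α) ∷ All.map (λ p → ℕₚ.≤-trans p (ℕₚ.m≤n+m (sum α) x)) (All-≤-sum α)

module Positivity {k : List ℕ → List ℕ → ℤ} (isKey : IsKeyCoeff k) where
  open IsKeyCoeff isKey
  open Symmetry isKey
  open Support isKey

  -- With a maximal first entry only the tail needs sorting, and this uses ξ_2, ξ_3, ..., which do
  -- not touch the factor x_1^d.
  k-∷-max : ∀ d α → All (_≤ d) α → ∀ e → k (d ∷ α) e ≡ (d ⊲ k α) e
  k-∷-max d = sorting-induction _ base step
    where
    base : ∀ α → Linked _≥_ α → All (_≤ d) α → ∀ e → k (d ∷ α) e ≡ (d ⊲ k α) e
    base α l ps []      = k-length _ _ λ ()
    base α l ps (s ∷ e) with s ℕ.≟ d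
    ... | no s≢d = k-dec _ _ (linked-cons ps l) (s≢d ∘ ∷-injectiveˡ)
    ... | yes refl with ≡-dec ℕ._≟_ e α
    ...   | yes refl = trans (k-refl _ (linked-cons ps l)) (sym (k-refl _ l))
    ...   | no ¬p = trans (k-dec _ _ (linked-cons ps l) (¬p ∘ ∷-injectiveʳ)) (sym (k-dec _ _ l ¬p))
    step : ∀ i α → At _>_ i α → (All (_≤ d) α → ∀ e → k (d ∷ α) e ≡ (d ⊲ k α) e) →
           All (_≤ d) (swapAt i α) → ∀ e → k (d ∷ swapAt i α) e ≡ (d ⊲ k (swapAt i α)) e
    step i α desc ih ps e =
      trans (k-swap (suc i) (d ∷ α) (there desc) e)
      -- The bound on the entries passes from `swapAt i α` to α because one transfer leads from the
      -- former to the latter.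
      (trans (Ξ-cong (suc i) (ih (⟶-All≤ (subst (swapAt i α ⟶_) (swapAt-involutive i α) (asc-⟶ (At-map ℕₚ.<⇒≤ (At-swap desc)))) ps)) e)
      (trans (Ξ-⊲ i d (k α) e)
             (⊲-cong d (λ e → sym (k-swap i α desc e)) e)))

  k-bound : ∀ {M} α → All (_≤ M) α → ∀ e → k α e ≢ 0ℤ → All (_≤ M) e
  k-bound α ps e nz = ⟶*-All≤ (k-support α e nz) ps

  sumKeys : List (List ℕ) → List ℕ → ℤ
  sumKeys []       e = 0ℤ
  sumKeys (β ∷ βs) e = k β e ℤ.+ sumKeys βs e

  -- The bound M is carried along because x_1^d 𝒦_β(x_2, ...) is known to be a key polynomial when d
  -- bounds the entries of β.
  record KeySum (M : ℕ) (c : List ℕ → ℤ) : Set where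
    constructor keySum
    field
      keys    : List (List ℕ)
      bounded : All (All (_≤ M)) keys
      expand  : ∀ e → c e ≡ sumKeys keys e

  KeySum-cong : ∀ {M c c′} → (∀ e → c e ≡ c′ e) → KeySum M c → KeySum M c′
  KeySum-cong c≗c′ (keySum βs b h) = keySum βs b λ e → trans (sym (c≗c′ e)) (h e)

  KeySum-weaken : ∀ {M N c} → M ≤ N → KeySum M c → KeySum N c
  KeySum-weaken p (keySum βs b h) = keySum βs (All.map (All.map (λ q → ℕₚ.≤-trans q p)) b) h

  KeySum-0 : ∀ {M} → KeySum M (λ _ → 0ℤ)
  KeySum-0 = keySum [] [] λ _ → refl

  KeySum-k : ∀ {M} β → All (_≤ M) β → KeySum M (k β)
  KeySum-k β p = keySum (β ∷ []) (p ∷ []) λ e → sym (ℤₚ.+-identityʳ (k β e))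

  sumKeys-++ : ∀ βs γs e → sumKeys (βs ++ γs) e ≡ sumKeys βs e ℤ.+ sumKeys γs e
  sumKeys-++ []       γs e = sym (ℤₚ.+-identityˡ _)
  sumKeys-++ (β ∷ βs) γs e = trans (cong (λ u → k β e ℤ.+ u) (sumKeys-++ βs γs e))
    (sym (ℤₚ.+-assoc (k β e) (sumKeys βs e) (sumKeys γs e)))

  KeySum-+ : ∀ {M c c′} → KeySum M c → KeySum M c′ → KeySum M (λ e → c e ℤ.+ c′ e)
  KeySum-+ (keySum βs b h) (keySum γs b′ h′) = keySum (βs ++ γs) (++⁺ b b′)
    λ e → trans (cong₂ ℤ._+_ (h e) (h′ e)) (sym (sumKeys-++ βs γs e))

  KeySum-Ξ : ∀ {M c} i → KeySum M c → KeySum M (Ξ i c)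
  KeySum-Ξ {M} i (keySum βs b h) = KeySum-cong (λ e → sym (Ξ-cong i h e)) (go βs b)
    where
    go : ∀ βs → All (All (_≤ M)) βs → KeySum M (Ξ i (sumKeys βs))
    go []       []       = KeySum-cong (λ e → sym (Ξ-0 i e)) KeySum-0
    go (β ∷ βs) (p ∷ ps) = KeySum-cong (λ e → sym (Ξ-+ i (k β) (sumKeys βs) e))
      (KeySum-+ single (go βs ps))
      where
      single : KeySum M (Ξ i (k β))
      single with Ξ-k i β
      ... | β′ , eq , inj₁ (_ , refl) = KeySum-cong (sym ∘ eq) (KeySum-k _ (All-swapAt i p))
      ... | β′ , eq , inj₂ (_ , refl) = KeySum-cong (sym ∘ eq) (KeySum-k _ p)

  KeySum-⊲ : ∀ {M c} d → M ≤ d → KeySum M c → KeySum d (d ⊲ c)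
  KeySum-⊲ {M} d M≤d (keySum βs b h) = KeySum-cong (λ e → sym (⊲-cong d h e)) (go βs b)
    where
    go : ∀ βs → All (All (_≤ M)) βs → KeySum d (d ⊲ sumKeys βs)
    go []       []       = KeySum-cong (λ e → sym (⊲-0 d e)) KeySum-0
    go (β ∷ βs) (p ∷ ps) = KeySum-cong (λ e → sym (⊲-+ d (k β) (sumKeys βs) e))
      (KeySum-+ (KeySum-cong (k-∷-max d β p′) (KeySum-k _ (ℕₚ.≤-refl ∷ p′))) (go βs ps))
      where p′ = All.map (λ q → ℕₚ.≤-trans q M≤d) p

  -- 𝒦_(a,d,δ) is reduced to A = 𝒦_(a,δ), which has one variable less: since d is maximal, x_1^d
  -- A(x_2, ...) is 𝒦_(d,a,δ), and a single ξ_1 is left to apply.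
  module Ascent (a d : ℕ) (δ : List ℕ) (a<d : a < d) (δ≤d : All (_≤ d) δ) where
    A : List ℕ → ℤ
    A = k (a ∷ δ)

    A-bound : ∀ y e → A (y ∷ e) ≢ 0ℤ → y ≤ d
    A-bound y e nz = All.head (k-bound (a ∷ δ) (ℕₚ.<⇒≤ a<d ∷ δ≤d) (y ∷ e) nz)

    unfold : ∀ e → k (a ∷ d ∷ δ) e ≡ Ξ 0 (d ⊲ A) e
    unfold e = trans (k-swap 0 (d ∷ a ∷ δ) (here a<d) e) (Ξ-cong 0 (k-∷-max d (a ∷ δ) (ℕₚ.<⇒≤ a<d ∷ δ≤d)) e)

    k-value : ∀ {y s t} e → Transfer y d s t → k (a ∷ d ∷ δ) (s ∷ t ∷ e) ≡ A (y ∷ e)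
    k-value {s = s} {t} e tr = trans (unfold _) (Ξ-⊲-value A-bound s t e tr)

    k-transfer : ∀ s t e → k (a ∷ d ∷ δ) (s ∷ t ∷ e) ≢ 0ℤ → ∃ λ y → Transfer y d s t
    k-transfer s t e nz = Ξ-⊲-support A-bound s t e (nz ∘ trans (unfold _))

    -- ladder p s = ∑_{y ≤ s} x^(p+y) A_y, where A_y is the coefficient of x^y in A
    ladder : ℕ → ℕ → List ℕ → ℤ
    ladder p zero    = (p + 0) ⊲ (λ e → A (0 ∷ e))
    ladder p (suc s) = λ e → ladder p s e ℤ.+ ((p + suc s) ⊲ (λ e → A (suc s ∷ e))) e

    ladder-out : ∀ p s t e → (∀ y → y ≤ s → t ≢ p + y) → ladder p s (t ∷ e) ≡ 0ℤ
    ladder-out p zero    t e h = ⊲-there _ e (h 0 z≤n)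
    ladder-out p (suc s) t e h = cong₂ ℤ._+_ (ladder-out p s t e λ y q → h y (ℕₚ.m≤n⇒m≤1+n q)) (⊲-there _ e (h (suc s) ℕₚ.≤-refl))

    ladder-in : ∀ p s y e → y ≤ s → ladder p s (p + y ∷ e) ≡ A (y ∷ e)
    ladder-in p zero    .0 e z≤n = ⊲-here (p + 0) _ e
    ladder-in p (suc s) y e q with ℕₚ.m≤n⇒m<n∨m≡n q
    ... | inj₂ refl = trans (cong₂ ℤ._+_ (ladder-out p s (p + suc s) e λ z z≤s eq →
                                ℕₚ.<-irrefl (sym (ℕₚ.+-cancelˡ-≡ p (suc s) z eq)) (s≤s z≤s)) (⊲-here (p + suc s) _ e))
                        (ℤₚ.+-identityˡ _)
    ... | inj₁ y<s = trans (cong₂ ℤ._+_ (ladder-in p s y e (ℕₚ.≤-pred y<s))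
                               (⊲-there _ e λ eq → ℕₚ.<-irrefl (ℕₚ.+-cancelˡ-≡ p y (suc s) eq) y<s))
                       (ℤₚ.+-identityʳ _)

    ladder-[] : ∀ p s → ladder p s [] ≡ 0ℤ
    ladder-[] p zero    = refl
    ladder-[] p (suc s) = cong (λ u → u ℤ.+ 0ℤ) (ladder-[] p s)

    ladder-nonzero : ∀ p s t e → ladder p s (t ∷ e) ≢ 0ℤ → ∃ λ y → y ≤ s × t ≡ p + y
    ladder-nonzero p s t e nz with p ℕ.≤? t
    ... | no ¬p = ⊥-elim (nz (ladder-out p s t e λ y _ eq → ¬p (subst (p ≤_) (sym eq) (ℕₚ.m≤m+n p y))))
    ... | yes p≤t with ℕₚ.m≤n⇒∃[o]m+o≡n p≤t
    ...   | y , refl with y ℕ.≤? s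
    ...     | yes q = y , q , refl
    ...     | no ¬q = ⊥-elim (nz (ladder-out p s t e λ z z≤s eq → ¬q (subst (_≤ s) (sym (ℕₚ.+-cancelˡ-≡ p y z eq)) z≤s)))

    -- a<d gives 𝒦_(a,d,δ) = ξ_1 (x_1^d A(x_2,…)); only exponents s ≤ d of x_1 occur.
    slice : ∀ p s → d ≡ p + s → ∀ e → k (a ∷ d ∷ δ) (s ∷ e) ≡ ladder p s e
    slice p s d≡ []      = trans (k-length _ _ λ ()) (sym (ladder-[] p s))
    slice p s refl (t ∷ e) = agree
      (λ nz → let (y , tr) = k-transfer s t e nz in go y (from y tr) tr)
      (λ nz → let (y , y≤s , eq) = ladder-nonzero p s t e nz in
        go y eq (transfer (trans (r₁ y p s) (cong (s +_) (sym eq))) y≤s (subst (y ≤_) (sym eq) (ℕₚ.m≤n+m y p))))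
      where
      r₁ : ∀ y p s → y + (p + s) ≡ s + (p + y)
      r₁ = ℕ-Solver.solve-∀
      from : ∀ y → Transfer y (p + s) s t → t ≡ p + y
      from y (transfer q _ _) = sym (ℕₚ.+-cancelˡ-≡ s (p + y) t (trans (sym (r₁ y p s)) q))
      go : ∀ y → t ≡ p + y → Transfer y (p + s) s t → k (a ∷ (p + s) ∷ δ) (s ∷ t ∷ e) ≡ ladder p s (t ∷ e)
      go y refl tr = trans (k-value e tr) (sym (ladder-in p s y e (Transfer.≤₁ tr)))

    -- The A_y are sums of keys with entries at most θ, so a term whose exponent is at least θ is a
    -- sum of keys by itself. Such terms are split off from the top until the top exponent is θ;
    -- what is left is the ladder of `base`.
    ladder-KeySum : ∀ {θ} → (∀ s → KeySum θ (λ e → A (s ∷ e))) →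
      (∀ p s → p + s ≡ θ → KeySum θ (ladder p s)) → ∀ p s → θ ≤ p + s → KeySum (p + s) (ladder p s)
    ladder-KeySum {θ} h base p s θ≤ with ℕₚ.m≤n⇒m<n∨m≡n θ≤
    ... | inj₂ θ≡ = KeySum-weaken θ≤ (base p s (sym θ≡))
    ladder-KeySum {θ} h base p zero    θ≤ | inj₁ _ = KeySum-⊲ (p + 0) θ≤ (h 0)
    ladder-KeySum {θ} h base p (suc s) θ≤ | inj₁ θ< = KeySum-+
      (KeySum-weaken (ℕₚ.+-monoʳ-≤ p (ℕₚ.n≤1+n s)) (ladder-KeySum h base p s (ℕₚ.≤-pred (subst (θ <_) (ℕₚ.+-suc p s) θ<))))
      (KeySum-⊲ (p + suc s) θ≤ (h (suc s)))

    -- Here A = x^a 𝒦_δ, so only the term with y = a can be nonzero, and it occurs exactly when a ≤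
    -- s.
    ladder-dom : All (_≤ a) δ → ∀ p s → KeySum (p + s) (ladder p s)
    ladder-dom δ≤a p s with a ℕ.≤? s
    ... | yes a≤s = KeySum-cong single
                      (KeySum-weaken (ℕₚ.+-monoʳ-≤ p a≤s) (KeySum-⊲ (p + a) (ℕₚ.m≤n+m a p) (KeySum-k δ δ≤a)))
      where
      value : ∀ e → ladder p s (p + a ∷ e) ≡ k δ e
      value e = trans (ladder-in p s a e a≤s) (trans (k-∷-max a δ δ≤a (a ∷ e)) (⊲-here a (k δ) e))
      single : ∀ e → ((p + a) ⊲ k δ) e ≡ ladder p s e
      single [] = sym (ladder-[] p s)
      single (t ∷ e) with t ℕ.≟ p + a
      ... | yes refl = sym (value e)
      ... | no t≢ with ladder p s (t ∷ e) ℤ.≟ 0ℤ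
      ...   | yes z = sym z
      ...   | no nz with ladder-nonzero p s t e nz
      ...     | y , y≤s , refl = sym (trans (ladder-in p s y e y≤s) (trans (k-∷-max a δ δ≤a (y ∷ e))
                  (⊲-there (k δ) e (t≢ ∘ cong (p +_)))))
    ... | no a≰s = KeySum-cong (λ e → sym (vanish e)) KeySum-0
      where
      vanish : ∀ e → ladder p s e ≡ 0ℤ
      vanish [] = ladder-[] p s
      vanish (t ∷ e) with ladder p s (t ∷ e) ℤ.≟ 0ℤ
      ... | yes z = z
      ... | no nz with ladder-nonzero p s t e nz
      ...   | y , y≤s , refl = trans (ladder-in p s y e y≤s) (trans (k-∷-max a δ δ≤a (y ∷ e))
                (⊲-there (k δ) e λ y≡a → a≰s (subst (_≤ s) y≡a y≤s)))

  module DoubleAscent (a d θ : ℕ) (δ : List ℕ) (a<d : a < d) (a<θ : a < θ) (δ≤θ : All (_≤ θ) δ) (θ≤d : θ ≤ d) where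
    open Ascent a d (θ ∷ δ) a<d (θ≤d ∷ All.map (λ q → ℕₚ.≤-trans q θ≤d) δ≤θ)
    module Inner = Ascent a θ δ a<θ δ≤θ

    slice-bound : ∀ s y e → A (s ∷ y ∷ e) ≢ 0ℤ → y ≤ θ
    slice-bound s y e nz = All.head (All.tail (k-bound (a ∷ θ ∷ δ) (ℕₚ.<⇒≤ a<θ ∷ ℕₚ.≤-refl ∷ δ≤θ) (s ∷ y ∷ e) nz))

    -- The ladder with top exponent θ is ξ_1 (x_1^θ A_s(x_2, ...)). Since A = 𝒦_(a,θ,δ) itself
    -- starts with an ascent, both sides at (t , t′) are coefficients of 𝒦_(a,δ) with the same first
    -- exponent s + t + t′ - 2θ: on the left through y′ = t + t′ - θ, on the right through y = t -
    -- p.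
    ladder-Ξ : ∀ p s → p + s ≡ θ → ∀ e → Ξ 0 (θ ⊲ (λ e → A (s ∷ e))) e ≡ ladder p s e
    ladder-Ξ p s eq [] = sym (ladder-[] p s)
    ladder-Ξ p s eq (t ∷ []) = trans (⊲-zero t (k-length _ _ λ ())) (sym (zero-ladder (ladder p s (t ∷ []) ℤ.≟ 0ℤ)))
      where
      zero-ladder : Dec (ladder p s (t ∷ []) ≡ 0ℤ) → ladder p s (t ∷ []) ≡ 0ℤ
      zero-ladder (yes z) = z
      zero-ladder (no nz) = let (y , y≤s , t≡) = ladder-nonzero p s t [] nz in
        trans (cong (λ u → ladder p s (u ∷ [])) t≡) (trans (ladder-in p s y [] y≤s) (k-length _ _ λ ()))
    ladder-Ξ p s refl (t ∷ t′ ∷ e) = agree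
      (λ nz → let (y′ , tr) = Ξ-⊲-support (slice-bound s) t t′ e nz
                  (y″ , tr′) = Inner.k-transfer s y′ e (nz ∘ trans (Ξ-⊲-value (slice-bound s) t t′ e tr))
              in down y′ y″ tr tr′)
      (λ nz → let (y , y≤s , t≡) = ladder-nonzero p s t (t′ ∷ e) nz
                  (y″ , tr) = Inner.k-transfer y t′ e (nz ∘ trans (trans (cong (λ u → ladder p s (u ∷ t′ ∷ e)) t≡) (ladder-in p s y (t′ ∷ e) y≤s)))
              in chain y y″ t≡ y≤s tr)
      where
      r₁ : ∀ p y″ s → (p + y″) + (p + s) ≡ p + (y″ + (p + s))
      r₁ = ℕ-Solver.solve-∀
      r₂ : ∀ p y″ s → y″ + (p + s) ≡ s + (p + y″)
      r₂ = ℕ-Solver.solve-∀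
      chain : ∀ y y″ → t ≡ p + y → y ≤ s → Transfer y″ (p + s) y t′ →
              Ξ 0 ((p + s) ⊲ (λ e → A (s ∷ e))) (t ∷ t′ ∷ e) ≡ ladder p s (t ∷ t′ ∷ e)
      chain y y″ refl y≤s tr@(transfer q q₁ q₂) =
        trans (Ξ-⊲-value (slice-bound s) (p + y) t′ e
                 (transfer (trans (r₁ p y″ s) (trans (cong (p +_) q) (sym (ℕₚ.+-assoc p y t′)))) (ℕₚ.+-monoʳ-≤ p q₁)
                   (ℕₚ.+-cancelˡ-≤ y (p + y″) t′ (subst₂ _≤_ (ℕₚ.+-comm (p + y″) y) q
                     (subst₂ _≤_ (sym (ℕₚ.+-assoc p y″ y)) refl (ℕₚ.≤-trans (ℕₚ.≤-reflexive (r₃ p y″ y)) (ℕₚ.+-monoʳ-≤ y″ (ℕₚ.+-monoʳ-≤ p y≤s))))))))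
        (trans (Inner.k-value e (transfer (r₂ p y″ s) (ℕₚ.≤-trans q₁ y≤s) (ℕₚ.m≤n+m y″ p)))
        (trans (sym (Inner.k-value e tr)) (sym (ladder-in p s y (t′ ∷ e) y≤s))))
        where
        r₃ : ∀ p y″ y → p + (y″ + y) ≡ y″ + (p + y)
        r₃ = ℕ-Solver.solve-∀
      down : ∀ y′ y″ → Transfer y′ (p + s) t t′ → Transfer y″ (p + s) s y′ →
             Ξ 0 ((p + s) ⊲ (λ e → A (s ∷ e))) (t ∷ t′ ∷ e) ≡ ladder p s (t ∷ t′ ∷ e)
      down y′ y″ tr (transfer q q₁ q₂) with ℕₚ.+-cancelˡ-≡ s (p + y″) y′ (trans (sym (r₂ p y″ s)) q)
      ... | refl with ℕₚ.m≤n⇒∃[o]m+o≡n (ℕₚ.≤-trans (ℕₚ.m≤m+n p y″) (Transfer.≤₁ tr))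
      ...   | y , refl = chain y y″ refl (ℕₚ.+-cancelˡ-≤ p y s (Transfer-≤ˡ tr))
                (transfer (ℕₚ.+-cancelˡ-≡ p _ _ (trans (sym (r₁ p y″ s)) (trans (Transfer.total tr) (ℕₚ.+-assoc p y t′))))
                  (ℕₚ.+-cancelˡ-≤ p y″ y (Transfer.≤₁ tr)) (ℕₚ.≤-trans (ℕₚ.m≤n+m y″ p) (Transfer.≤₂ tr)))

  -- Induction on δ. If its first entry d exceeds a, the coefficient of x_1^s is a ladder over 𝒦 of
  -- a followed by the rest of δ. Either a dominates that rest and one term remains, or the
  -- hypothesis expands the coefficients A_y.
  branch-dec : ∀ a δ {M} → Linked _≥_ δ → All (_≤ M) (a ∷ δ) → ∀ s → KeySum M (λ e → k (a ∷ δ) (s ∷ e))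
  branch-dom : ∀ a δ {M} → All (_≤ a) δ → All (_≤ M) (a ∷ δ) → ∀ s → KeySum M (λ e → k (a ∷ δ) (s ∷ e))

  branch-dom a δ δ≤a (p ∷ ps) s with s ℕ.≟ a
  ... | yes refl = KeySum-cong (λ e → sym (trans (k-∷-max a δ δ≤a (s ∷ e)) (⊲-here s (k δ) e))) (KeySum-k δ ps)
  ... | no s≢a   = KeySum-cong (λ e → sym (trans (k-∷-max a δ δ≤a (s ∷ e)) (⊲-there (k δ) e s≢a))) KeySum-0

  branch-dec a [] l ps s = branch-dom a [] [] ps s
  branch-dec a (d ∷ δ) {M} l (pa ∷ pd ∷ ps) s with d ℕ.≤? a
  ... | yes d≤a = branch-dom a (d ∷ δ) (d≤a ∷ All.map (λ q → ℕₚ.≤-trans q d≤a) (linked-head l)) (pa ∷ pd ∷ ps) s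
  ... | no d≰a with s ℕ.≤? d
  ...   | no s≰d = KeySum-cong (λ e → sym (vanish e)) KeySum-0
    where
    vanish : ∀ e → k (a ∷ d ∷ δ) (s ∷ e) ≡ 0ℤ
    vanish e with k (a ∷ d ∷ δ) (s ∷ e) ℤ.≟ 0ℤ
    ... | yes z = z
    ... | no nz = ⊥-elim (s≰d (All.head (k-bound _ (ℕₚ.<⇒≤ (ℕₚ.≰⇒> d≰a) ∷ ℕₚ.≤-refl ∷ linked-head l) _ nz)))
  ...   | yes s≤d with ℕₚ.m≤n⇒∃[o]m+o≡n s≤d
  ...     | p , refl = KeySum-cong (λ e → sym (Ascent.slice a (s + p) δ a<d δ≤d p s (ℕₚ.+-comm s p) e))
              (KeySum-weaken (subst (_≤ M) (ℕₚ.+-comm s p) pd) (ladder-sum δ l δ≤d))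
    where
    a<d = ℕₚ.≰⇒> d≰a
    δ≤d = linked-head l
    ladder-sum : ∀ δ → Linked _≥_ ((s + p) ∷ δ) → (δ≤d : All (_≤ (s + p)) δ) →
                 KeySum (p + s) (Ascent.ladder a (s + p) δ a<d δ≤d p s)
    ladder-sum [] _ _ = Ascent.ladder-dom a (s + p) [] a<d [] [] p s
    ladder-sum (θ ∷ δ) (θ≤d ∷ l) (θ≤d′ ∷ δ≤d) with θ ℕ.≤? a
    ... | yes θ≤a = Ascent.ladder-dom a (s + p) (θ ∷ δ) a<d (θ≤d′ ∷ δ≤d) (θ≤a ∷ All.map (λ q → ℕₚ.≤-trans q θ≤a) (linked-head l)) p s
    ... | no θ≰a  = Ascent.ladder-KeySum a (s + p) (θ ∷ δ) a<d (θ≤d′ ∷ δ≤d)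
      (branch-dec a (θ ∷ δ) l (ℕₚ.<⇒≤ a<θ ∷ ℕₚ.≤-refl ∷ linked-head l))
      (λ p s eq → KeySum-cong (DoubleAscent.ladder-Ξ a _ θ δ a<d a<θ (linked-head l) θ≤d p s eq)
        (KeySum-Ξ 0 (KeySum-⊲ θ ℕₚ.≤-refl (branch-dec a (θ ∷ δ) l (ℕₚ.<⇒≤ a<θ ∷ ℕₚ.≤-refl ∷ linked-head l) s))))
      p s (subst (θ ≤_) (ℕₚ.+-comm s p) θ≤d)
      where a<θ = ℕₚ.≰⇒> θ≰a

  branch : ∀ a δ s → ∃ λ M → KeySum M (λ e → k (a ∷ δ) (s ∷ e))
  branch a = sorting-induction _
    (λ δ l s → sum (a ∷ δ) , branch-dec a δ l (All-≤-sum (a ∷ δ)) s)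
    λ i δ desc ih s → proj₁ (ih s) , KeySum-cong (λ e → sym (k-swap (suc i) (a ∷ δ) (there desc) (s ∷ e)))
      (KeySum-Ξ i (proj₂ (ih s)))

  -- Induction on the exponent: by `branch` the coefficient at s ∷ e is a sum of coefficients of key
  -- polynomials at e.
  k-nonneg : ∀ e α → 0ℤ ℤ.≤ k α e
  k-nonneg [] []      = subst (0ℤ ℤ.≤_) (sym (k-refl [] [])) (ℤ.+≤+ z≤n)
  k-nonneg [] (a ∷ α) = subst (0ℤ ℤ.≤_) (sym (k-length (a ∷ α) [] λ ())) ℤₚ.≤-refl
  k-nonneg (s ∷ e) [] = subst (0ℤ ℤ.≤_) (sym (k-length [] (s ∷ e) λ ())) ℤₚ.≤-refl
  k-nonneg (s ∷ e) (a ∷ δ) with branch a δ s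
  ... | M , keySum βs _ h = subst (0ℤ ℤ.≤_) (sym (h e)) (go βs)
    where
    go : ∀ βs → 0ℤ ℤ.≤ sumKeys βs e
    go []       = ℤₚ.≤-refl
    go (β ∷ βs) = ℤₚ.+-mono-≤ (k-nonneg e β) (go βs)

  k-pos : ∀ α e → k α e ≢ 0ℤ → 0ℤ ℤ.< k α e
  k-pos α e nz = ℤₚ.≤∧≢⇒< (k-nonneg e α) (nz ∘ sym)

  Ξ-sumKeys-nonneg : ∀ i βs e → 0ℤ ℤ.≤ Ξ i (sumKeys βs) e
  Ξ-sumKeys-nonneg i []       e = ℤₚ.≤-reflexive (sym (Ξ-0 i e))
  Ξ-sumKeys-nonneg i (β ∷ βs) e = subst (0ℤ ℤ.≤_) (sym (Ξ-+ i (k β) (sumKeys βs) e))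
    (ℤₚ.+-mono-≤ (subst (0ℤ ℤ.≤_) (sym (proj₁ (proj₂ (Ξ-k i β)) e)) (k-nonneg e _)) (Ξ-sumKeys-nonneg i βs e))

  ⟶*-Ξ-k : ∀ i β {e e′} → HullAt i e′ e → k β e′ ≢ 0ℤ → proj₁ (Ξ-k i β) ⟶* e
  ⟶*-Ξ-k i β {e} {e′} h nz with Ξ-k i β
  ... | _ , _ , inj₁ (desc , refl) = ⟶*-HullAt-desc desc (k-support β e′ nz) h
  ... | _ , _ , inj₂ (symm , refl) with HullAt-⟶-or h
  ...   | inj₁ s = k-support β e′ nz ◅◅ s ◅ ε
  ...   | inj₂ s = k-support β (swapAt i e′) (nz ∘ trans (sym (Symm⇒swapAt i symm e′))) ◅◅ s ◅ ε

  -- After ξ_i every summand is still a key polynomial, hence nonnegative at e. A summand that is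
  -- nonzero at e′ yields one whose index reaches e, and `full` makes it positive there, so nothing
  -- cancels.
  Ξ-sumKeys-pos : ∀ i βs {e e′} → (∀ β → β ⟶* e → k β e ≢ 0ℤ) → HullAt i e′ e →
    sumKeys βs e′ ≢ 0ℤ → 0ℤ ℤ.< Ξ i (sumKeys βs) e
  Ξ-sumKeys-pos i [] full h nz = ⊥-elim (nz refl)
  Ξ-sumKeys-pos i (β ∷ βs) {e} {e′} full h nz = subst (0ℤ ℤ.<_) (sym (Ξ-+ i (k β) (sumKeys βs) e)) (go (k β e′ ℤ.≟ 0ℤ))
    where
    Ξβ = proj₁ (proj₂ (Ξ-k i β)) e
    go : Dec (k β e′ ≡ 0ℤ) → 0ℤ ℤ.< Ξ i (k β) e ℤ.+ Ξ i (sumKeys βs) e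
    go (no nzβ) = ℤₚ.+-mono-<-≤ (subst (0ℤ ℤ.<_) (sym Ξβ) (k-pos _ e (full _ (⟶*-Ξ-k i β h nzβ)))) (Ξ-sumKeys-nonneg i βs e)
    go (yes z)  = ℤₚ.+-mono-≤-< (subst (0ℤ ℤ.≤_) (sym Ξβ) (k-nonneg e _))
      (Ξ-sumKeys-pos i βs full h λ z′ → nz (cong₂ ℤ._+_ z z′))

  private
    -- The outer induction is on the number of variables, the inner one sorts δ while the first
    -- entry stays fixed. For sorted δ, `Ascent.k-value` removes a variable. A swap in δ acts as an
    -- operator on the coefficient of x_1^s, a sum of keys in one variable less, to which the outer
    -- hypothesis applies.
    full-support : ∀ n e α → length e ≡ n → α ⟶* e → k α e ≢ 0ℤ
    full-support n e [] len p z with ⟶*-dec [] p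
    ... | refl with trans (sym (k-refl [] [])) z
    ...   | ()
    full-support n [] (a ∷ δ) len p z with ⟶*-length p
    ... | ()
    full-support (suc n) (s ∷ e) (a ∷ δ) eq = sorting-induction Q base step δ s e (ℕₚ.suc-injective eq)
      where
      Q : List ℕ → Set
      Q δ = ∀ s e → length e ≡ n → a ∷ δ ⟶* s ∷ e → k (a ∷ δ) (s ∷ e) ≢ 0ℤ

      dominant : ∀ {α e} → Linked _≥_ α → α ⟶* e → k α e ≢ 0ℤ
      dominant l p z with ⟶*-dec l p
      ... | refl with trans (sym (k-refl _ l)) z
      ...   | ()

      base : ∀ δ → Linked _≥_ δ → Q δ
      base [] l s e len p = dominant [-] p
      base (d ∷ δ) l s e len p with d ℕ.≤? a
      ... | yes d≤a = dominant (d≤a ∷ l) p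
      -- (a , d , δ) is one hull step away from (d , a , δ). Postponing that step gives a path from
      -- (d , a , δ), whose maximal head stays d, so the path takes place in (a , δ).
      ... | no d≰a with HullAt-⟶* (here {a = d} {a} (Hull-swap (Hull-refl d a))) p
      ...   | u , p′ , h with ⟶*-max-head (ℕₚ.<⇒≤ (ℕₚ.≰⇒> d≰a) ∷ linked-head l) p′
      base (d ∷ δ) l s (t ∷ e) len p | no d≰a | _ , p′ , here {b = y} h | _ , refl , p″ = λ z →
        full-support n (y ∷ e) (a ∷ δ) len p″ (trans (sym (Ascent.k-value a d δ a<d (linked-head l) e (tr h))) z)
        where
        a<d = ℕₚ.≰⇒> d≰a
        tr : Hull d y s t → Transfer y d s t
        tr (inj₂ t) = t
        tr (inj₁ t) with ℕₚ.≤-antisym (All.head (⟶*-All≤ p″ (ℕₚ.<⇒≤ a<d ∷ linked-head l))) (ℕₚ.≤-trans (Transfer.≤₁ t) (Transfer-≤ˡ t))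
        ... | refl = t

      step : ∀ i δ → At _>_ i δ → Q δ → Q (swapAt i δ)
      step i δ desc ih s e len p with HullAt-⟶* (HullAt-swapAt (there desc)) p
      ... | _ , p′ , there {u = e′} h with branch a δ s
      ...   | M , keySum βs _ expand = λ z → ℤₚ.<-irrefl (sym (trans (sym (trans (k-swap (suc i) (a ∷ δ) (there desc) (s ∷ e)) (Ξ-cong i expand e))) z))
        (Ξ-sumKeys-pos i βs (λ β → full-support n e β len) h
          (ih s e′ (trans (HullAt-length h) len) p′ ∘ trans (expand e′)))

  ⟶*⇒k≢0 : ∀ {α e} → α ⟶* e → k α e ≢ 0ℤ
  ⟶*⇒k≢0 {α} {e} = full-support _ e α refl

-- Leading coefficient, zeros and symmetry in weakly increasing blocks

squares : List ℕ → ℕ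
squares []      = 0
squares (x ∷ l) = x * x + squares l

private
  squares-expand : ∀ x k l → x * x + (k + (x + l)) * (k + (x + l)) ≡
                   (x + k) * (x + k) + (x + l) * (x + l) + 2 * (k * l)
  squares-expand = ℕ-Solver.solve-∀

  Transfer-expand : ∀ {x y x′ y′} → Transfer x y x′ y′ →
    ∃₂ λ k l → x′ ≡ x + k × y′ ≡ x + l × x * x + y * y ≡ x′ * x′ + y′ * y′ + 2 * (k * l)
  Transfer-expand {x} {y} (transfer t p q) with ℕₚ.m≤n⇒∃[o]m+o≡n p | ℕₚ.m≤n⇒∃[o]m+o≡n q
  ... | k , refl | l , refl with ℕₚ.+-cancelˡ-≡ x y (k + (x + l)) (trans t (ℕₚ.+-assoc x k (x + l)))
  ...   | refl = k , l , refl , refl , squares-expand x k l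

Transfer-squares : ∀ {x y x′ y′} → Transfer x y x′ y′ → x′ * x′ + y′ * y′ ≤ x * x + y * y
Transfer-squares t with Transfer-expand t
... | k , l , _ , _ , eq = ℕₚ.≤-trans (ℕₚ.m≤m+n _ _) (ℕₚ.≤-reflexive (sym eq))

Transfer-squares-< : ∀ {x y x′ y′} → Transfer x y x′ y′ → x < x′ → x < y′ → x′ * x′ + y′ * y′ < x * x + y * y
Transfer-squares-< {x} t p q with Transfer-expand t
... | zero  , l     , refl , _ , _ = ⊥-elim (ℕₚ.<-irrefl (sym (ℕₚ.+-identityʳ x)) p)
... | suc k , zero  , _ , refl , _ = ⊥-elim (ℕₚ.<-irrefl (sym (ℕₚ.+-identityʳ x)) q)
... | suc k , suc l , _ , _ , eq = ℕₚ.≤-trans (ℕₚ.m<m+n _ (s≤s z≤n)) (ℕₚ.≤-reflexive (sym eq))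

Repl-squares : ∀ {y y′ u v} → Repl y y′ u v → squares u + y′ * y′ ≡ squares v + y * y
Repl-squares {y} {y′} (here {l}) = r (y * y) (squares l) (y′ * y′)
  where
  r : ∀ a b c → (a + b) + c ≡ (c + b) + a
  r = ℕ-Solver.solve-∀
Repl-squares {y} {y′} (there {x} {u} {v} h) = trans (ℕₚ.+-assoc (x * x) (squares u) (y′ * y′))
  (trans (cong (x * x +_) (Repl-squares h)) (sym (ℕₚ.+-assoc (x * x) (squares v) (y * y))))

⟶-squares : ∀ {u v} → u ⟶ v → squares v ≤ squares u
⟶-squares (tl {x} s) = ℕₚ.+-monoʳ-≤ (x * x) (⟶-squares s)
⟶-squares (hd {x} {y} {x′} {y′} {u} {v} t h) = ℕₚ.+-cancelʳ-≤ (y * y) _ _ (begin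
  (x′ * x′ + squares v) + y * y  ≡⟨ ℕₚ.+-assoc (x′ * x′) (squares v) (y * y) ⟩
  x′ * x′ + (squares v + y * y)  ≡⟨ cong (x′ * x′ +_) (sym (Repl-squares h)) ⟩
  x′ * x′ + (squares u + y′ * y′) ≡⟨ r (x′ * x′) (squares u) (y′ * y′) ⟩
  (x′ * x′ + y′ * y′) + squares u ≤⟨ ℕₚ.+-monoˡ-≤ (squares u) (Transfer-squares t) ⟩
  (x * x + y * y) + squares u    ≡⟨ sym (r (x * x) (squares u) (y * y)) ⟩
  x * x + (squares u + y * y)    ≡⟨ sym (ℕₚ.+-assoc (x * x) (squares u) (y * y)) ⟩
  (x * x + squares u) + y * y    ∎)
  where
  open ℕₚ.≤-Reasoning
  r : ∀ a b c → a + (b + c) ≡ (a + c) + b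
  r = ℕ-Solver.solve-∀

⟶*-squares : ∀ {u v} → u ⟶* v → squares v ≤ squares u
⟶*-squares ε        = ℕₚ.≤-refl
⟶*-squares (s ◅ ss) = ℕₚ.≤-trans (⟶*-squares ss) (⟶-squares s)

ξ-extreme : ∀ f a b → (∀ a′ b′ → a′ + b′ ≡ a + b → a′ < b ⊎ b′ < b → f a′ b′ ≡ 0ℤ) → ξ f a b ≡ f a b
ξ-extreme f a zero    h = refl
ξ-extreme f a (suc b) h = trans (cong₂ (λ u v → (f a (suc b) ℤ.- u) ℤ.+ v)
    (h b (suc a) (trans (ℕₚ.+-comm b (suc a)) (sym (ℕₚ.+-suc a b))) (inj₁ ℕₚ.≤-refl))
    (outside (suc a) b (sym (ℕₚ.+-suc a b)) ℕₚ.≤-refl))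
  (trans (ℤₚ.+-identityʳ _) (ℤₚ.+-identityʳ _))
  where
  outside : ∀ a′ b′ → a′ + b′ ≡ a + suc b → b′ < suc b → ξ f a′ b′ ≡ 0ℤ
  outside a′ zero     e p = h a′ 0 e (inj₂ p)
  outside a′ (suc b′) e p = cong₂ ℤ._+_ (cong₂ ℤ._-_ (h a′ (suc b′) e (inj₂ p))
      (h b′ (suc a′) (trans (trans (ℕₚ.+-comm b′ (suc a′)) (sym (ℕₚ.+-suc a′ b′))) e) (inj₁ (ℕₚ.<-trans (ℕₚ.n<1+n b′) p))))
    (outside (suc a′) b′ (trans (sym (ℕₚ.+-suc a′ b′)) e) (ℕₚ.<-trans (ℕₚ.n<1+n b′) p))

Ξ-extreme : ∀ {i c α} → At _≥_ i α → (∀ e → squares α < squares e → c e ≡ 0ℤ) → Ξ i c α ≡ c α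
Ξ-extreme {c = c} (here {a} {b} {l} b≤a) h = ξ-extreme (λ x y → c (x ∷ y ∷ l)) a b outside
  where
  outside : ∀ a′ b′ → a′ + b′ ≡ a + b → a′ < b ⊎ b′ < b → c (a′ ∷ b′ ∷ l) ≡ 0ℤ
  outside a′ b′ e (inj₁ p) = h _ (subst₂ _<_ (ℕₚ.+-assoc (a * a) (b * b) (squares l)) (ℕₚ.+-assoc (a′ * a′) (b′ * b′) (squares l))
    (ℕₚ.+-monoˡ-< (squares l) (Transfer-squares-< (transfer e (ℕₚ.≤-trans (ℕₚ.<⇒≤ p) b≤a) (ℕₚ.<⇒≤ p)) (ℕₚ.<-≤-trans p b≤a) p)))
  outside a′ b′ e (inj₂ p) = h _ (subst₂ _<_ (ℕₚ.+-assoc (a * a) (b * b) (squares l)) (ℕₚ.+-assoc (a′ * a′) (b′ * b′) (squares l))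
    (ℕₚ.+-monoˡ-< (squares l) (subst (a * a + b * b <_) (ℕₚ.+-comm (b′ * b′) (a′ * a′))
      (Transfer-squares-< (transfer (trans (ℕₚ.+-comm b′ a′) e) (ℕₚ.≤-trans (ℕₚ.<⇒≤ p) b≤a) (ℕₚ.<⇒≤ p)) (ℕₚ.<-≤-trans p b≤a) p))))
Ξ-extreme {c = c} (there {x = x} p) h = Ξ-extreme p λ e q → h (x ∷ e) (ℕₚ.+-monoʳ-< (x * x) q)

At-++ : ∀ {R : ℕ → ℕ → Set} {x y} A C → R x y → At R (length A) (A ++ x ∷ y ∷ C)
At-++ []      C r = here r
At-++ (_ ∷ A) C r = there (At-++ A C r)

swapAt-++ : ∀ A {x y} C → swapAt (length A) (A ++ x ∷ y ∷ C) ≡ A ++ y ∷ x ∷ C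
swapAt-++ []      C = refl
swapAt-++ (a ∷ A) C = cong (a ∷_) (swapAt-++ A C)

Symm-++ : ∀ A {c x y} C → Symm (length A) c → c (A ++ x ∷ y ∷ C) ≡ c (A ++ y ∷ x ∷ C)
Symm-++ []      C s = s _ _ C
Symm-++ (a ∷ A) C s = Symm-++ A C (s a)

Ξ-zero-second : ∀ A {c x} C → Ξ (length A) c (A ++ x ∷ 0 ∷ C) ≡ c (A ++ x ∷ 0 ∷ C)
Ξ-zero-second []      C = refl
Ξ-zero-second (a ∷ A) C = Ξ-zero-second A C

At-snoc : ∀ {R i α z} → At R i α → At R i (α ++ z ∷ [])
At-snoc (here p)  = here p
At-snoc (there p) = there (At-snoc p)

At-length : ∀ {R i α} → At R i α → suc i < length α
At-length (here p)  = s≤s (s≤s z≤n)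
At-length (there p) = s≤s (At-length p)

swapAt-snoc : ∀ {R i α z} → At R i α → swapAt i α ++ z ∷ [] ≡ swapAt i (α ++ z ∷ [])
swapAt-snoc (here p)  = refl
swapAt-snoc (there p) = cong (_ ∷_) (swapAt-snoc p)

Ξ-snoc : ∀ i c e z → suc i < length e → Ξ i c (e ++ z ∷ []) ≡ Ξ i (λ e → c (e ++ z ∷ [])) e
Ξ-snoc zero    c (x ∷ y ∷ e) z p = refl
Ξ-snoc zero    c (x ∷ []) z (s≤s ())
Ξ-snoc (suc i) c (x ∷ e) z (s≤s p) = Ξ-snoc i (λ e → c (x ∷ e)) e z p

linked-snoc-0 : ∀ {α} → Linked _≥_ α → Linked _≥_ (α ++ 0 ∷ [])
linked-snoc-0 []      = [-]
linked-snoc-0 [-]     = z≤n ∷ [-]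
linked-snoc-0 (p ∷ l) = p ∷ linked-snoc-0 l

module Stability {k : List ℕ → List ℕ → ℤ} (isKey : IsKeyCoeff k) where
  open IsKeyCoeff isKey
  open Symmetry isKey
  open Support isKey

  -- By symmetry the exponent s_i α may be replaced by α. There ξ_i adds to k α α only coefficients
  -- at exponents with a larger sum of squares, and these are outside the support, as transfers
  -- never increase that sum.
  k-diagonal : ∀ α → k α α ≡ 1ℤ
  k-diagonal = sorting-induction _ k-refl step
    where
    step : ∀ i α → At _>_ i α → k α α ≡ 1ℤ → k (swapAt i α) (swapAt i α) ≡ 1ℤ
    step i α desc ih = trans (Symm⇒swapAt i (Symm-k (swapAt i α) (At-map ℕₚ.<⇒≤ (At-swap desc))) α)
      (trans (k-swap i α desc α) (trans (Ξ-extreme (At-map ℕₚ.<⇒≤ desc) larger) ih))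
      where
      larger : ∀ e → squares α < squares e → k α e ≡ 0ℤ
      larger e p with k α e ℤ.≟ 0ℤ
      ... | yes z = z
      ... | no nz = ⊥-elim (ℕₚ.<⇒≱ p (⟶*-squares (k-support α e nz)))

  k-snoc-0 : ∀ α e → k (α ++ 0 ∷ []) (e ++ 0 ∷ []) ≡ k α e
  k-snoc-0 = sorting-induction _ base step
    where
    base : ∀ α → Linked _≥_ α → ∀ e → k (α ++ 0 ∷ []) (e ++ 0 ∷ []) ≡ k α e
    base α l e with ≡-dec ℕ._≟_ e α
    ... | yes refl = trans (k-refl _ (linked-snoc-0 l)) (sym (k-refl _ l))
    ... | no ¬p = trans (k-dec _ _ (linked-snoc-0 l) (¬p ∘ ++-cancelʳ (0 ∷ []) e α)) (sym (k-dec _ _ l ¬p))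
    step : ∀ i α → At _>_ i α → (∀ e → k (α ++ 0 ∷ []) (e ++ 0 ∷ []) ≡ k α e) →
           ∀ e → k (swapAt i α ++ 0 ∷ []) (e ++ 0 ∷ []) ≡ k (swapAt i α) e
    step i α desc ih e with length e ℕ.≟ length α
    ... | no ¬p = trans (k-length _ _ λ q → ¬p (trans
        (ℕₚ.+-cancelʳ-≡ 1 _ _ (trans (sym (length-++ e)) (trans q (length-++ (swapAt i α))))) (length-swapAt i α)))
      (sym (k-length _ _ λ q → ¬p (trans q (length-swapAt i α))))
    ... | yes p = trans (cong (λ β → k β (e ++ 0 ∷ [])) (swapAt-snoc desc))
      (trans (k-swap i (α ++ 0 ∷ []) (At-snoc desc) (e ++ 0 ∷ []))
      (trans (Ξ-snoc i _ e 0 (subst (suc i <_) (sym p) (At-length desc)))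
      (trans (Ξ-cong i ih e) (sym (k-swap i α desc e)))))

  -- Symmetry at the weak ascent (0 , b) turns the left exponent into the right one, and ξ_i does
  -- not change a coefficient whose second exponent is 0.
  k-move-0 : ∀ A C b A′ C′ b′ → length A′ ≡ length A →
    k (A ++ 0 ∷ b ∷ C) (A′ ++ 0 ∷ b′ ∷ C′) ≡ k (A ++ b ∷ 0 ∷ C) (A′ ++ b′ ∷ 0 ∷ C′)
  k-move-0 A C b A′ C′ b′ len = trans
    (Symm-++ A′ C′ (subst (λ i → Symm i (k (A ++ 0 ∷ b ∷ C))) (sym len) (Symm-k _ (At-++ A C z≤n)))) (go b)
    where
    go : ∀ b → k (A ++ 0 ∷ b ∷ C) (A′ ++ b′ ∷ 0 ∷ C′) ≡ k (A ++ b ∷ 0 ∷ C) (A′ ++ b′ ∷ 0 ∷ C′)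
    go zero    = refl
    go (suc b) = trans (k-asc (At-++ A C (s≤s z≤n)) _)
      (trans (cong (λ β → Ξ (length A) (k β) (A′ ++ b′ ∷ 0 ∷ C′)) (swapAt-++ A C))
      (subst (λ i → Ξ i (k (A ++ suc b ∷ 0 ∷ C)) (A′ ++ b′ ∷ 0 ∷ C′) ≡ k (A ++ suc b ∷ 0 ∷ C) (A′ ++ b′ ∷ 0 ∷ C′)) len (Ξ-zero-second A′ C′)))

  k-insert-0 : ∀ A C A′ C′ → length A′ ≡ length A → length C′ ≡ length C →
    k (A ++ 0 ∷ C) (A′ ++ 0 ∷ C′) ≡ k (A ++ C) (A′ ++ C′)
  k-insert-0 A [] A′ [] _ _ = trans (k-snoc-0 A A′)
    (cong₂ k (sym (++-identityʳ A)) (sym (++-identityʳ A′)))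
  k-insert-0 A (b ∷ C) A′ (b′ ∷ C′) lenA lenC = trans (k-move-0 A C b A′ C′ b′ lenA)
    (trans (cong₂ k (sym (++-assoc A (b ∷ []) (0 ∷ C))) (sym (++-assoc A′ (b′ ∷ []) (0 ∷ C′))))
    (trans (k-insert-0 (A ++ b ∷ []) C (A′ ++ b′ ∷ []) C′
             (trans (length-++ A′) (trans (cong (_+ 1) lenA) (sym (length-++ A)))) (ℕₚ.suc-injective lenC))
    (cong₂ k (++-assoc A (b ∷ []) C) (++-assoc A′ (b′ ∷ []) C′))))

  k-insert-0s : ∀ p A C A′ C′ → length A′ ≡ length A → length C′ ≡ length C →
    k (A ++ replicate p 0 ++ C) (A′ ++ replicate p 0 ++ C′) ≡ k (A ++ C) (A′ ++ C′)
  k-insert-0s zero    A C A′ C′ lenA lenC = refl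
  k-insert-0s (suc p) A C A′ C′ lenA lenC = trans
    (k-insert-0 A (replicate p 0 ++ C) A′ (replicate p 0 ++ C′) lenA
      (trans (length-++ (replicate p 0)) (trans (cong (length (replicate p 0) +_) lenC) (sym (length-++ (replicate p 0))))))
    (k-insert-0s p A C A′ C′ lenA lenC)

  k-permute : ∀ {X X′} → X ↭ X′ → ∀ A G C A′ C′ → Linked _≤_ G → length A′ ≡ length A → length X ≡ length G →
    k (A ++ G ++ C) (A′ ++ X ++ C′) ≡ k (A ++ G ++ C) (A′ ++ X′ ++ C′)
  k-permute ↭.refl A G C A′ C′ l lenA lenX = refl
  k-permute {x ∷ X} {.x ∷ X′} (↭.prep x p) A (g ∷ G) C A′ C′ l lenA lenX =
    trans (cong₂ k (sym (++-assoc A (g ∷ []) (G ++ C))) (sym (++-assoc A′ (x ∷ []) (X ++ C′))))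
    (trans (k-permute p (A ++ g ∷ []) G C (A′ ++ x ∷ []) C′ (Linked.tail l)
             (trans (length-++ A′) (trans (cong (_+ 1) lenA) (sym (length-++ A)))) (ℕₚ.suc-injective lenX))
    (cong₂ k (++-assoc A (g ∷ []) (G ++ C)) (++-assoc A′ (x ∷ []) (X′ ++ C′))))
  k-permute {x ∷ y ∷ X} {.y ∷ .x ∷ X′} (↭.swap x y p) A (g ∷ g′ ∷ G) C A′ C′ (g≤g′ ∷ l) lenA lenX =
    trans (Symm-++ A′ (X ++ C′) (subst (λ i → Symm i (k (A ++ g ∷ g′ ∷ G ++ C))) (sym lenA) (Symm-k _ (At-++ A (G ++ C) g≤g′))))
    (trans (cong₂ k (sym (++-assoc A (g ∷ g′ ∷ []) (G ++ C))) (sym (++-assoc A′ (y ∷ x ∷ []) (X ++ C′))))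
    (trans (k-permute p (A ++ g ∷ g′ ∷ []) G C (A′ ++ y ∷ x ∷ []) C′ (Linked.tail l)
             (trans (length-++ A′) (trans (cong (_+ 2) lenA) (sym (length-++ A)))) (ℕₚ.suc-injective (ℕₚ.suc-injective lenX)))
    (cong₂ k (++-assoc A (g ∷ g′ ∷ []) (G ++ C)) (++-assoc A′ (y ∷ x ∷ []) (X′ ++ C′)))))
  k-permute (↭.trans p q) A G C A′ C′ l lenA lenX =
    trans (k-permute p A G C A′ C′ l lenA lenX)
          (k-permute q A G C A′ C′ l lenA (trans (sym (↭-length p)) lenX))

-- Coefficients of a key family

coeff-++ : ∀ p q e → coeff (p ++ q) e ≡ coeff p e ℤ.+ coeff q e
coeff-++ [] q e = sym (ℤₚ.+-identityˡ _)
coeff-++ ((c , e′) ∷ p) q e with ≡-dec ℕ._≟_ e′ e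
... | yes _ = trans (cong (λ u → c ℤ.+ u) (coeff-++ p q e)) (sym (ℤₚ.+-assoc c _ _))
... | no  _ = coeff-++ p q e

coeff-negP : ∀ p e → coeff (negP p) e ≡ ℤ.- coeff p e
coeff-negP [] e = refl
coeff-negP ((c , e′) ∷ p) e with ≡-dec ℕ._≟_ e′ e
... | yes _ = trans (cong (λ u → ℤ.- c ℤ.+ u) (coeff-negP p e)) (sym (ℤₚ.neg-distrib-+ c (coeff p e)))
... | no  _ = coeff-negP p e

coeff--P : ∀ p q e → coeff (p -P q) e ≡ coeff p e ℤ.- coeff q e
coeff--P p q e = trans (coeff-++ p (negP q) e) (cong (λ u → coeff p e ℤ.+ u) (coeff-negP q e))

module _ (φ : List ℕ → List ℕ) where
  mapExp : Poly → Poly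
  mapExp = map (λ t → proj₁ t , φ (proj₂ t))

  coeff-mapExp : (∀ {u v} → φ u ≡ φ v → u ≡ v) → ∀ p e → coeff (mapExp p) (φ e) ≡ coeff p e
  coeff-mapExp inj [] e = refl
  coeff-mapExp inj ((c , e′) ∷ p) e with ≡-dec ℕ._≟_ (φ e′) (φ e) | ≡-dec ℕ._≟_ e′ e
  ... | yes _ | yes _ = cong (λ u → c ℤ.+ u) (coeff-mapExp inj p e)
  ... | no  _ | no  _ = coeff-mapExp inj p e
  ... | yes q | no ¬q = ⊥-elim (¬q (inj q))
  ... | no ¬q | yes q = ⊥-elim (¬q (cong φ q))

  coeff-mapExp-miss : ∀ p e → (∀ e′ → φ e′ ≢ e) → coeff (mapExp p) e ≡ 0ℤ
  coeff-mapExp-miss [] e miss = refl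
  coeff-mapExp-miss ((c , e′) ∷ p) e miss with ≡-dec ℕ._≟_ (φ e′) e
  ... | yes q = ⊥-elim (miss e′ q)
  ... | no  _ = coeff-mapExp-miss p e miss

incAt-injective : ∀ i {u v} → incAt i u ≡ incAt i v → u ≡ v
incAt-injective i       {[]}    {[]}    q = refl
incAt-injective zero    {x ∷ u} {y ∷ v} refl = refl
incAt-injective (suc i) {x ∷ u} {y ∷ v} q = cong₂ _∷_ (∷-injectiveˡ q) (incAt-injective i (∷-injectiveʳ q))
incAt-injective zero    {[]}    {y ∷ v} ()
incAt-injective (suc i) {[]}    {y ∷ v} ()
incAt-injective zero    {x ∷ u} {[]}    ()
incAt-injective (suc i) {x ∷ u} {[]}    ()

swapAt-injective : ∀ i {u v} → swapAt i u ≡ swapAt i v → u ≡ v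
swapAt-injective i {u} {v} q = trans (sym (swapAt-involutive i u)) (trans (cong (swapAt i) q) (swapAt-involutive i v))

incAt-++ : ∀ A {x} C → incAt (length A) (A ++ x ∷ C) ≡ A ++ suc x ∷ C
incAt-++ []      C = refl
incAt-++ (a ∷ A) C = cong (a ∷_) (incAt-++ A C)

incAt-suc-++ : ∀ A {x y} C → incAt (suc (length A)) (A ++ x ∷ y ∷ C) ≡ A ++ x ∷ suc y ∷ C
incAt-suc-++ []      C = refl
incAt-suc-++ (a ∷ A) C = cong (a ∷_) (incAt-suc-++ A C)

incAt-miss : ∀ A {x} C e → incAt (suc (length A)) e ≢ A ++ x ∷ 0 ∷ C
incAt-miss []      C (x ∷ y ∷ e) ()
incAt-miss []      C (x ∷ []) ()
incAt-miss []      C [] ()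
incAt-miss (a ∷ A) C [] ()
incAt-miss (a ∷ A) C (x ∷ e) q = incAt-miss A C e (∷-injectiveʳ q)

Ξ-unique : ∀ i {f g : List ℕ → ℤ} →
  (∀ A a C → length A ≡ i → g (A ++ a ∷ 0 ∷ C) ≡ f (A ++ a ∷ 0 ∷ C)) →
  (∀ A a b C → length A ≡ i → g (A ++ a ∷ suc b ∷ C) ≡
     (f (A ++ a ∷ suc b ∷ C) ℤ.- f (A ++ b ∷ suc a ∷ C)) ℤ.+ g (A ++ suc a ∷ b ∷ C)) →
  ∀ e → suc i < length e → g e ≡ Ξ i f e
Ξ-unique zero {f} {g} h₀ h₁ (a ∷ b ∷ e) p = go a b
  where
  go : ∀ a b → g (a ∷ b ∷ e) ≡ ξ (λ x y → f (x ∷ y ∷ e)) a b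
  go a zero    = h₀ [] a e refl
  go a (suc b) = trans (h₁ [] a b e refl) (cong (λ u → (f (a ∷ suc b ∷ e) ℤ.- f (b ∷ suc a ∷ e)) ℤ.+ u) (go (suc a) b))
Ξ-unique zero h₀ h₁ (a ∷ []) (s≤s ())
Ξ-unique (suc i) h₀ h₁ (s ∷ e) (s≤s p) = Ξ-unique i
  (λ A a C len → h₀ (s ∷ A) a C (cong suc len)) (λ A a b C len → h₁ (s ∷ A) a b C (cong suc len)) e p

Ξ-cong-length : ∀ i {c d} e → (∀ e′ → length e′ ≡ length e → c e′ ≡ d e′) → Ξ i c e ≡ Ξ i d e
Ξ-cong-length zero    (a ∷ b ∷ e) h = ξ-cong (λ x y → h (x ∷ y ∷ e) refl) a b
Ξ-cong-length zero    (a ∷ [])    h = h _ refl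
Ξ-cong-length zero    []          h = h _ refl
Ξ-cong-length (suc i) (s ∷ e)     h = Ξ-cong-length i e (λ e′ q → h (s ∷ e′) (cong suc q))
Ξ-cong-length (suc i) []          h = h _ refl

at-swapAt : ∀ {i α} → At _>_ i α → at α (suc i) < at α i
at-swapAt (here p)  = p
at-swapAt (there p) = at-swapAt p

-- IsKeyFamily does not control coefficients at exponent lists of the wrong length, so they are cut off.
keyCoeff : (List ℕ → Poly) → List ℕ → List ℕ → ℤ
keyCoeff K α e with length e ℕ.≟ length α
... | yes _ = coeff (K α) e
... | no  _ = 0ℤ

keyCoeff-≡ : ∀ K α e → length e ≡ length α → keyCoeff K α e ≡ coeff (K α) e
keyCoeff-≡ K α e p with length e ℕ.≟ length α
... | yes _ = refl
... | no ¬p = ⊥-elim (¬p p)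

keyCoeff-≢ : ∀ K α e → length e ≢ length α → keyCoeff K α e ≡ 0ℤ
keyCoeff-≢ K α e ¬p with length e ℕ.≟ length α
... | yes p = ⊥-elim (¬p p)
... | no  _ = refl

coeff-monomial : ∀ α → coeff (monomial α) α ≡ 1ℤ
coeff-monomial α with ≡-dec ℕ._≟_ α α
... | yes _ = refl
... | no ¬p = ⊥-elim (¬p refl)

coeff-monomial-≢ : ∀ α e → e ≢ α → coeff (monomial α) e ≡ 0ℤ
coeff-monomial-≢ α e ¬p with ≡-dec ℕ._≟_ α e
... | yes p = ⊥-elim (¬p (sym p))
... | no _  = refl

module _ {K : List ℕ → Poly} (isKF : IsKeyFamily K) where
  private
    module Swap {i α} (desc : At _>_ i α) where
      f g : List ℕ → ℤ
      f = coeff (K α)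
      g = coeff (K (swapAt i α))

      relation : ∀ E →
        coeff (mulVar i (K (swapAt i α))) E ℤ.- coeff (mulVar (suc i) (K (swapAt i α))) E ≡
        coeff (mulVar i (K α)) E ℤ.- coeff (mulVar (suc i) (sPoly i (K α))) E
      relation E = trans (sym (coeff--P (mulVar i (K (swapAt i α))) (mulVar (suc i) (K (swapAt i α))) E))
        (trans (proj₂ isKF α i (At-length desc) (at-swapAt desc) E)
               (coeff--P (mulVar i (K α)) (mulVar (suc i) (sPoly i (K α))) E))

      r : ∀ x y z w → x ℤ.- y ≡ z ℤ.- w → x ≡ (z ℤ.- w) ℤ.+ y
      r x y z w q = trans (s x y) (cong (λ u → u ℤ.+ y) q)
        where
        s : ∀ x y → x ≡ (x ℤ.- y) ℤ.+ y
        s = ℤ-Solver.solve-∀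

      inc : ∀ A a C p → length A ≡ i → coeff (mulVar i p) (A ++ suc a ∷ C) ≡ coeff p (A ++ a ∷ C)
      inc A a C p refl = trans (cong (coeff (mulVar i p)) (sym (incAt-++ A C)))
        (coeff-mapExp (incAt i) (incAt-injective i) p (A ++ a ∷ C))

      inc-suc : ∀ A a b C p → length A ≡ i → coeff (mulVar (suc i) p) (A ++ a ∷ suc b ∷ C) ≡ coeff p (A ++ a ∷ b ∷ C)
      inc-suc A a b C p refl = trans (cong (coeff (mulVar (suc i) p)) (sym (incAt-suc-++ A C)))
        (coeff-mapExp (incAt (suc i)) (incAt-injective (suc i)) p (A ++ a ∷ b ∷ C))

      inc-miss : ∀ A a C p → length A ≡ i → coeff (mulVar (suc i) p) (A ++ a ∷ 0 ∷ C) ≡ 0ℤ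
      inc-miss A a C p refl = coeff-mapExp-miss (incAt (suc i)) p _ (incAt-miss A C)

      -- Coefficients are compared at the exponent with a + 1 in place of a, where neither product
      -- with the second variable contributes.
      at-zero : ∀ A a C → length A ≡ i → g (A ++ a ∷ 0 ∷ C) ≡ f (A ++ a ∷ 0 ∷ C)
      at-zero A a C len = trans (r (g (A ++ a ∷ 0 ∷ C)) 0ℤ (f (A ++ a ∷ 0 ∷ C)) 0ℤ (subst₂ _≡_
          (cong₂ ℤ._-_ (inc A a (0 ∷ C) (K (swapAt i α)) len) (inc-miss A (suc a) C (K (swapAt i α)) len))
          (cong₂ ℤ._-_ (inc A a (0 ∷ C) (K α) len) (inc-miss A (suc a) C (sPoly i (K α)) len)) (relation (A ++ suc a ∷ 0 ∷ C))))
        (trans (ℤₚ.+-identityʳ (f (A ++ a ∷ 0 ∷ C) ℤ.- 0ℤ)) (ℤₚ.+-identityʳ (f (A ++ a ∷ 0 ∷ C))))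

      at-suc : ∀ A a b C → length A ≡ i → g (A ++ a ∷ suc b ∷ C) ≡
        (f (A ++ a ∷ suc b ∷ C) ℤ.- f (A ++ b ∷ suc a ∷ C)) ℤ.+ g (A ++ suc a ∷ b ∷ C)
      at-suc A a b C refl = r (g (A ++ a ∷ suc b ∷ C)) (g (A ++ suc a ∷ b ∷ C)) (f (A ++ a ∷ suc b ∷ C)) (f (A ++ b ∷ suc a ∷ C)) (subst₂ _≡_
          (cong₂ ℤ._-_ (inc A a (suc b ∷ C) (K (swapAt i α)) refl) (inc-suc A (suc a) b C (K (swapAt i α)) refl))
          (cong₂ ℤ._-_ (inc A a (suc b ∷ C) (K α) refl) (trans (inc-suc A (suc a) b C (sPoly i (K α)) refl)
            (trans (cong (coeff (sPoly i (K α))) (sym (swapAt-++ A C)))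
              (coeff-mapExp (swapAt i) (swapAt-injective i) (K α) (A ++ b ∷ suc a ∷ C)))))
          (relation (A ++ suc a ∷ suc b ∷ C)))

  keyCoeff-isKeyCoeff : IsKeyCoeff (keyCoeff K)
  keyCoeff-isKeyCoeff = record
    { k-length = keyCoeff-≢ K
    ; k-refl   = λ α l → trans (keyCoeff-≡ K α α refl) (trans (proj₁ isKF α l α) (coeff-monomial α))
    ; k-dec    = dec
    ; k-swap   = swap }
    where
    dec : ∀ α e → Linked _≥_ α → e ≢ α → keyCoeff K α e ≡ 0ℤ
    dec α e l e≢α with length e ℕ.≟ length α
    ... | yes _ = trans (proj₁ isKF α l e) (coeff-monomial-≢ α e e≢α)
    ... | no  _ = refl

    swap : ∀ i α → At _>_ i α → ∀ e → keyCoeff K (swapAt i α) e ≡ Ξ i (keyCoeff K α) e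
    swap i α desc e with length e ℕ.≟ length α
    ... | yes p = trans (keyCoeff-≡ K (swapAt i α) e (trans p (sym (length-swapAt i α))))
      (trans (Ξ-unique i at-zero at-suc e (subst (suc i <_) (sym p) (At-length desc)))
             (Ξ-cong-length i e λ e′ q → sym (keyCoeff-≡ K α e′ (trans q p))))
      where open Swap desc
    ... | no ¬p = trans (keyCoeff-≢ K (swapAt i α) e λ q → ¬p (trans q (length-swapAt i α)))
      (sym (trans (Ξ-cong-length i e λ e′ q → keyCoeff-≢ K α e′ λ q′ → ¬p (trans (sym q) q′)) (Ξ-0 i e)))

-- Sorted partitions and moves

insertDesc-≤ : ∀ {x y} l → y ≤ x → insertDesc x (y ∷ l) ≡ x ∷ y ∷ l
insertDesc-≤ {x} {y} l p with y ≤ᵇ x | ℕₚ.≤⇒≤ᵇ p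
... | true | _ = refl

insertDesc-> : ∀ {x y} l → x < y → insertDesc x (y ∷ l) ≡ y ∷ insertDesc x l
insertDesc-> {x} {y} l p with y ≤ᵇ x in eq
... | false = refl
... | true  = ⊥-elim (ℕₚ.<⇒≱ p (ℕₚ.≤ᵇ⇒≤ y x (subst T (sym eq) _)))

insertDesc-comm-≤ : ∀ {x y} l → x ≤ y → insertDesc x (insertDesc y l) ≡ insertDesc y (insertDesc x l)
insertDesc-comm-≤ {x} {y} [] x≤y with ℕₚ.m≤n⇒m<n∨m≡n x≤y
... | inj₂ refl = refl
... | inj₁ x<y  = trans (insertDesc-> [] x<y) (sym (insertDesc-≤ [] x≤y))
insertDesc-comm-≤ {x} {y} (z ∷ l) x≤y with ℕₚ.m≤n⇒m<n∨m≡n x≤y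
... | inj₂ refl = refl
... | inj₁ x<y with z ℕ.≤? y | z ℕ.≤? x
...   | yes z≤y | yes z≤x = trans
          (trans (cong (insertDesc x) (insertDesc-≤ l z≤y)) (trans (insertDesc-> (z ∷ l) x<y) (cong (y ∷_) (insertDesc-≤ l z≤x))))
          (sym (trans (cong (insertDesc y) (insertDesc-≤ l z≤x)) (insertDesc-≤ (z ∷ l) x≤y)))
...   | yes z≤y | no z≰x = trans
          (trans (cong (insertDesc x) (insertDesc-≤ l z≤y)) (trans (insertDesc-> (z ∷ l) x<y) (cong (y ∷_) (insertDesc-> l (ℕₚ.≰⇒> z≰x)))))
          (sym (trans (cong (insertDesc y) (insertDesc-> l (ℕₚ.≰⇒> z≰x))) (insertDesc-≤ (insertDesc x l) z≤y)))
...   | no z≰y | yes z≤x = ⊥-elim (z≰y (ℕₚ.≤-trans z≤x x≤y))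
...   | no z≰y | no z≰x = trans
          (trans (cong (insertDesc x) (insertDesc-> l (ℕₚ.≰⇒> z≰y))) (insertDesc-> (insertDesc y l) (ℕₚ.≰⇒> z≰x)))
          (trans (cong (z ∷_) (insertDesc-comm-≤ l x≤y))
          (sym (trans (cong (insertDesc y) (insertDesc-> l (ℕₚ.≰⇒> z≰x))) (insertDesc-> (insertDesc x l) (ℕₚ.≰⇒> z≰y)))))

insertDesc-comm : ∀ x y l → insertDesc x (insertDesc y l) ≡ insertDesc y (insertDesc x l)
insertDesc-comm x y l with ℕₚ.≤-total x y
... | inj₁ p = insertDesc-comm-≤ l p
... | inj₂ p = sym (insertDesc-comm-≤ l p)

insertDesc-↭ : ∀ x l → insertDesc x l ↭ x ∷ l
insertDesc-↭ x [] = ↭-refl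
insertDesc-↭ x (y ∷ l) with y ≤ᵇ x
... | true  = ↭-refl
... | false = ↭-trans (↭.prep y (insertDesc-↭ x l)) (↭.swap y x ↭-refl)

norm-∷-cong : ∀ x {u v} → norm u ≡ norm v → norm (x ∷ u) ≡ norm (x ∷ v)
norm-∷-cong zero    q = q
norm-∷-cong (suc x) q = cong (insertDesc (suc x)) q

norm-swap : ∀ x y l → norm (x ∷ y ∷ l) ≡ norm (y ∷ x ∷ l)
norm-swap zero    zero    l = refl
norm-swap zero    (suc y) l = refl
norm-swap (suc x) zero    l = refl
norm-swap (suc x) (suc y) l = insertDesc-comm (suc x) (suc y) (norm l)

norm-resp-↭ : ∀ {u v} → u ↭ v → norm u ≡ norm v
norm-resp-↭ ↭.refl = refl
norm-resp-↭ (↭.prep x p) = norm-∷-cong x (norm-resp-↭ p)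
norm-resp-↭ (↭.swap {_} {v} x y p) = trans (norm-∷-cong x (norm-∷-cong y (norm-resp-↭ p))) (norm-swap x y v)
norm-resp-↭ (↭.trans p q) = trans (norm-resp-↭ p) (norm-resp-↭ q)

norm-↭ : ∀ l → ∃ λ m → l ↭ norm l ++ replicate m 0
norm-↭ [] = 0 , ↭-refl
norm-↭ (zero ∷ l) with norm-↭ l
... | m , p = suc m , ↭-trans (↭.prep 0 p) (↭-sym (shift 0 (norm l) (replicate m 0)))
norm-↭ (suc x ∷ l) with norm-↭ l
... | m , p = m , ↭-trans (↭.prep (suc x) p) (++⁺ʳ (replicate m 0) (↭-sym (insertDesc-↭ (suc x) (norm l))))

norm-≡⇒↭ : ∀ {u v} → length u ≡ length v → norm u ≡ norm v → u ↭ v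
norm-≡⇒↭ {u} {v} len q with norm-↭ u | norm-↭ v
... | m , p | m′ , p′ = ↭-trans p (↭-trans (↭.↭-reflexive (cong₂ (λ l m → l ++ replicate m 0) q m≡m′)) (↭-sym p′))
  where
  count : ∀ {w} l m → w ↭ l ++ replicate m 0 → length w ≡ length l + m
  count l m p = trans (↭-length p) (trans (length-++ l) (cong (length l +_) (length-replicate m)))
  m≡m′ : m ≡ m′
  m≡m′ = ℕₚ.+-cancelˡ-≡ (length (norm u)) m m′
    (trans (sym (count (norm u) m p)) (trans len (trans (count (norm v) m′ p′) (cong (λ l → length l + m′) (sym q)))))

insertDesc-All : ∀ {P : ℕ → Set} x l → P x → All P l → All P (insertDesc x l)
insertDesc-All x [] p ps = p ∷ []
insertDesc-All x (y ∷ l) p (q ∷ ps) with y ≤ᵇ x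
... | true  = p ∷ q ∷ ps
... | false = q ∷ insertDesc-All x l p ps

insertDesc-Linked : ∀ x l → Linked _≥_ l → Linked _≥_ (insertDesc x l)
insertDesc-Linked x [] l = [-]
insertDesc-Linked x (y ∷ ys) l with y ℕ.≤? x
... | yes p = subst (Linked _≥_) (sym (insertDesc-≤ ys p)) (p ∷ l)
... | no ¬p = subst (Linked _≥_) (sym (insertDesc-> ys (ℕₚ.≰⇒> ¬p)))
  (linked-cons (insertDesc-All x ys (ℕₚ.<⇒≤ (ℕₚ.≰⇒> ¬p)) (linked-head l)) (insertDesc-Linked x ys (Linked.tail l)))

norm-isPartition : ∀ l → IsPartition (norm l)
norm-isPartition [] = [] , []
norm-isPartition (zero ∷ l) = norm-isPartition l
norm-isPartition (suc x ∷ l) with norm-isPartition l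
... | p , q = insertDesc-Linked (suc x) (norm l) p , insertDesc-All (suc x) (norm l) (s≤s z≤n) q

norm-partition : ∀ {l} → IsPartition l → norm l ≡ l
norm-partition {[]} _ = refl
norm-partition {suc x ∷ l} (p , _ ∷ q) = trans (cong (insertDesc (suc x)) (norm-partition (Linked.tail p , q))) (go l p)
  where
  go : ∀ l → Linked _≥_ (suc x ∷ l) → insertDesc (suc x) l ≡ suc x ∷ l
  go []      _       = refl
  go (y ∷ l) (p ∷ _) = insertDesc-≤ l p

norm-idem : ∀ l → norm (norm l) ≡ norm l
norm-idem l = norm-partition (norm-isPartition l)

insertDesc-cancel : ∀ x {u v} → insertDesc x (norm u) ≡ insertDesc x (norm v) → norm u ≡ norm v
insertDesc-cancel x {u} {v} q = trans (sym (norm-idem u)) (trans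
  (norm-resp-↭ (drop-∷ (↭-trans (↭-sym (insertDesc-↭ x (norm u))) (↭-trans (↭.↭-reflexive q) (insertDesc-↭ x (norm v))))))
  (norm-idem v))

norm-∷-cancel : ∀ x {u v} → norm (x ∷ u) ≡ norm (x ∷ v) → norm u ≡ norm v
norm-∷-cancel zero    q = q
norm-∷-cancel (suc x) {u} {v} q = insertDesc-cancel (suc x) {u} {v} q

norm-setAt : ∀ Q j → ∃ λ R → norm Q ≡ norm (at Q j ∷ R) × ∀ w → norm (setAt j w Q) ≡ norm (w ∷ R)
norm-setAt []      zero    = [] , refl , λ w → refl
norm-setAt []      (suc j) with norm-setAt [] j
... | R , q , h = R , q , h
norm-setAt (x ∷ Q) zero    = Q , refl , λ w → refl
norm-setAt (x ∷ Q) (suc j) with norm-setAt Q j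
... | R , q , h = x ∷ R , trans (norm-∷-cong x q) (norm-swap x (at Q j) R) , λ w → trans (norm-∷-cong x (h w)) (norm-swap x w R)

norm-setAt₂ : ∀ Q {j k} → j < k → ∃ λ R → norm Q ≡ norm (at Q j ∷ at Q k ∷ R) ×
  ∀ v w → norm (setAt k w (setAt j v Q)) ≡ norm (v ∷ w ∷ R)
norm-setAt₂ []      {zero}  {suc k} _ with norm-setAt [] k
... | R , q , h = R , q , λ v w → norm-∷-cong v (h w)
norm-setAt₂ []      {suc j} {suc k} (s≤s p) with norm-setAt₂ [] p
... | R , q , h = R , q , h
norm-setAt₂ (x ∷ Q) {zero}  {suc k} _ with norm-setAt Q k
... | R , q , h = R , norm-∷-cong x q , λ v w → norm-∷-cong v (h w)
norm-setAt₂ (x ∷ Q) {suc j} {suc k} (s≤s p) with norm-setAt₂ Q p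
... | R , q , h = x ∷ R , trans (norm-∷-cong x q) (rotate (at Q j) (at Q k)) , λ v w → trans (norm-∷-cong x (h v w)) (rotate v w)
  where
  rotate : ∀ v w → norm (x ∷ v ∷ w ∷ R) ≡ norm (v ∷ w ∷ x ∷ R)
  rotate v w = trans (norm-swap x v (w ∷ R)) (norm-∷-cong v (norm-swap x w R))

at-insertDesc : ∀ x l → ∃ λ j → at (insertDesc x l) j ≡ x
at-insertDesc x [] = 0 , refl
at-insertDesc x (y ∷ l) with y ≤ᵇ x
... | true  = 0 , refl
... | false with at-insertDesc x l
...   | j , q = suc j , q

at-length : ∀ l → at l (length l) ≡ 0
at-length []      = refl
at-length (x ∷ l) = at-length l

at-norm : ∀ x R → ∃ λ j → at (norm (x ∷ R)) j ≡ x
at-norm zero    R = length (norm R) , at-length (norm R)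
at-norm (suc x) R = at-insertDesc (suc x) (norm R)

at-antitone : ∀ {l j k} → Linked _≥_ l → j ≤ k → at l k ≤ at l j
at-antitone {[]} l p = z≤n
at-antitone {x ∷ xs} {zero} {zero} l p = ℕₚ.≤-refl
at-antitone {x ∷ []} {zero} {suc k} l p = z≤n
at-antitone {x ∷ y ∷ xs} {zero} {suc k} (q ∷ l) p = ℕₚ.≤-trans (at-antitone {y ∷ xs} {zero} {k} l z≤n) q
at-antitone {x ∷ xs} {suc j} {suc k} l (s≤s p) = at-antitone {xs} {j} {k} (Linked.tail l) p

-- The way back: an entry known only from the multiset gets a position in the sorted list, as the
-- definition of a move requires.
norm-entry : ∀ {P} x R → P ≡ norm (x ∷ R) → ∃ λ j → at P j ≡ x × ∀ w → norm (setAt j w P) ≡ norm (w ∷ R)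
norm-entry x R refl with at-norm x R
... | j , q with norm-setAt (norm (x ∷ R)) j
...   | R′ , e , h = j , q , λ w → trans (h w) (norm-∷-cong w
        (norm-∷-cancel x (trans (cong (λ v → norm (v ∷ R′)) (sym q)) (trans (sym e) (norm-idem (x ∷ R))))))

norm-entries : ∀ {P} x y R → x < y → P ≡ norm (x ∷ y ∷ R) → ∃₂ λ j k → j < k × at P j ≡ y × at P k ≡ x ×
  ∀ v w → norm (setAt k w (setAt j v P)) ≡ norm (v ∷ w ∷ R)
norm-entries x y R x<y refl with norm-entry y (x ∷ R) (norm-swap x y R) | at-norm x (y ∷ R)
... | j , qj , _ | k , qk with ℕₚ.<-cmp j k
...   | tri≈ _ refl _ = ⊥-elim (ℕₚ.<-irrefl (trans (sym qk) qj) x<y)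
...   | tri> _ _ k<j  = ⊥-elim (ℕₚ.<⇒≱ x<y (subst₂ _≤_ qj qk
          (at-antitone {norm (x ∷ y ∷ R)} (proj₁ (norm-isPartition (x ∷ y ∷ R))) (ℕₚ.<⇒≤ k<j))))
...   | tri< j<k _ _ with norm-setAt₂ (norm (x ∷ y ∷ R)) j<k
...     | R′ , e , h = j , k , j<k , qj , qk , λ v w → trans (h v w) (norm-∷-cong v (norm-∷-cong w
            (norm-∷-cancel x (norm-∷-cancel y (trans (cong₂ (λ v w → norm (v ∷ w ∷ R′)) (sym qj) (sym qk))
              (trans (sym e) (trans (norm-idem (x ∷ y ∷ R)) (norm-swap x y R))))))))

-- Transfers as sequences of moves

module _ {r : ℕ} where

  infixl 6 _[_≔_]

  _[_≔_] : (Fin r → List ℕ) → Fin r → List ℕ → Fin r → List ℕ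
  (X [ i ≔ l ]) j with j Fin.≟ i
  ... | yes _ = l
  ... | no  _ = X j

  ≔-here : ∀ X i l → (X [ i ≔ l ]) i ≡ l
  ≔-here X i l with i Fin.≟ i
  ... | yes _ = refl
  ... | no ¬p = ⊥-elim (¬p refl)

  ≔-there : ∀ X i l {j} → j ≢ i → (X [ i ≔ l ]) j ≡ X j
  ≔-there X i l {j} j≢i with j Fin.≟ i
  ... | yes p = ⊥-elim (j≢i p)
  ... | no  _ = refl

  Move-resp-≐ : {ν ν₁ ν′ ν′₁ : MultiPar r} → ν ≐ ν₁ → ν′ ≐ ν′₁ → Move ν ν′ → Move ν₁ ν′₁
  Move-resp-≐ {ν} {ν₁} {ν′} {ν′₁} p q (move1 i₁ i₂ j₁ j₂ lt lt′ e₁ e₂ o) =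
    move1 i₁ i₂ j₁ j₂ lt (subst₂ (λ u v → at u j₁ < at v j₂) (p i₁) (p i₂) lt′)
      (trans (sym (q i₁)) (trans e₁ (cong₂ (λ u v → norm (setAt j₁ (at v j₂) u)) (p i₁) (p i₂))))
      (trans (sym (q i₂)) (trans e₂ (cong₂ (λ u v → norm (setAt j₂ (at u j₁) v)) (p i₁) (p i₂))))
      λ k k≢ k≢′ → trans (sym (q k)) (trans (o k k≢ k≢′) (p k))
  Move-resp-≐ p q (move2 i j k lt lt′ e o) =
    move2 i j k lt (subst (λ u → suc (at u k) < at u j) (p i) lt′)
      (trans (sym (q i)) (trans e (cong (λ u → norm (setAt k (suc (at u k)) (setAt j (at u j ∸ 1) u))) (p i))))
      λ k k≢ k≢′ → trans (sym (q k)) (trans (o k k≢ k≢′) (p k))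
  Move-resp-≐ p q (move3 i₁ i₂ j₁ j₂ lt lt′ e₁ e₂ o) =
    move3 i₁ i₂ j₁ j₂ lt (subst₂ (λ u v → suc (at u j₁) < at v j₂) (p i₁) (p i₂) lt′)
      (trans (sym (q i₁)) (trans e₁ (cong (λ u → norm (setAt j₁ (suc (at u j₁)) u)) (p i₁))))
      (trans (sym (q i₂)) (trans e₂ (cong (λ u → norm (setAt j₂ (at u j₂ ∸ 1) u)) (p i₂))))
      λ k k≢ k≢′ → trans (sym (q k)) (trans (o k k≢ k≢′) (p k))

  ◁-resp-≐ : {μ μ₁ ν ν₁ : MultiPar r} → μ ≐ μ₁ → ν ≐ ν₁ → μ ◁ ν → μ₁ ◁ ν₁
  ◁-resp-≐ p q (one m)    = one (Move-resp-≐ q p m)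
  ◁-resp-≐ p q (more ν m c) = more ν (Move-resp-≐ q (λ _ → refl) m) (◁-resp-≐ p (λ _ → refl) c)

  ◁-trans : {μ ν κ : MultiPar r} → μ ◁ ν → ν ◁ κ → μ ◁ κ
  ◁-trans p (one m)      = more _ m p
  ◁-trans p (more ν m q) = more ν m (◁-trans p q)

  infix 4 _⊴_

  _⊴_ : MultiPar r → MultiPar r → Set
  μ ⊴ ν = μ ≐ ν ⊎ μ ◁ ν

  ⊴-trans : {μ ν κ : MultiPar r} → μ ⊴ ν → ν ⊴ κ → μ ⊴ κ
  ⊴-trans (inj₁ p) (inj₁ q) = inj₁ λ i → trans (p i) (q i)
  ⊴-trans (inj₁ p) (inj₂ q) = inj₂ (◁-resp-≐ (sym ∘ p) (λ _ → refl) q)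
  ⊴-trans (inj₂ p) (inj₁ q) = inj₂ (◁-resp-≐ (λ _ → refl) q p)
  ⊴-trans (inj₂ p) (inj₂ q) = inj₂ (◁-trans p q)

  Move-⊴ : {μ ν κ : MultiPar r} → Move κ ν → μ ⊴ ν → μ ◁ κ
  Move-⊴ m (inj₁ p) = one (Move-resp-≐ (λ _ → refl) (sym ∘ p) m)
  Move-⊴ m (inj₂ p) = more _ m p

  -- k and l are the distances of the new entries from the smaller old one. One move 2 lowers both
  -- by 1; once one of them is 0, the pair is unchanged up to order.
  move-within : ∀ k l {x y x′ y′ R} i {ν ν′ : MultiPar r} → y ≡ k + (l + x) → x′ ≡ k + x → y′ ≡ l + x →
    ν i ≡ norm (x ∷ y ∷ R) → ν′ i ≡ norm (x′ ∷ y′ ∷ R) → OthersEq i i ν ν′ → ν′ ⊴ ν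
  move-within zero l {x} {R = R} i {ν} {ν′} refl refl refl e e′ o = inj₁ unchanged
    where
    unchanged : ν′ ≐ ν
    unchanged j with j Fin.≟ i
    ... | yes refl = trans e′ (sym e)
    ... | no j≢i = o j j≢i j≢i
  move-within (suc k) zero {x} {R = R} i {ν} {ν′} refl refl refl e e′ o = inj₁ unchanged
    where
    unchanged : ν′ ≐ ν
    unchanged j with j Fin.≟ i
    ... | yes refl = trans e′ (trans (norm-swap (suc k + x) x R) (sym e))
    ... | no j≢i = o j j≢i j≢i
  move-within (suc k) (suc l) {x} {R = R} i {ν} {ν′} refl refl refl e e′ o
    with norm-entries x (suc k + (suc l + x)) R
      (s≤s (ℕₚ.≤-trans (ℕₚ.m≤n+m x (suc l)) (ℕₚ.m≤n+m (suc l + x) k))) e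
  ... | a , b , a<b , qa , qb , h = inj₂ (Move-⊴
    (move2 i a b a<b
      (subst₂ (λ u v → suc u < v) (sym qb) (sym qa) (s≤s (ℕₚ.≤-trans (s≤s (ℕₚ.m≤n+m x l)) (ℕₚ.m≤n+m (suc l + x) k))))
      (trans (≔-here ν i _) (trans (norm-swap (suc x) (k + (suc l + x)) R) (trans (sym (h (k + (suc l + x)) (suc x)))
        (cong₂ (λ u v → norm (setAt b (suc u) (setAt a (v ∸ 1) (ν i)))) (sym qb) (sym qa)))))
      (λ j j≢i _ → ≔-there ν i _ j≢i))
    (move-within k l i (cong (k +_) (sym (ℕₚ.+-suc l x))) (sym (ℕₚ.+-suc k x)) (sym (ℕₚ.+-suc l x))
      (≔-here ν i _) e′ (λ j j≢i j≢i′ → trans (o j j≢i j≢i′) (sym (≔-there ν i _ j≢i)))))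

  -- Here move 3 lowers both distances. If l reaches 0 while k is positive, the two entries have
  -- changed places between different partitions, which is one move 1.
  move-across : ∀ k l {x y x′ y′ R₁ R₂} i₁ i₂ → toℕ i₁ < toℕ i₂ → {ν ν′ : MultiPar r} →
    y ≡ k + (l + x) → x′ ≡ k + x → y′ ≡ l + x →
    ν i₁ ≡ norm (x ∷ R₁) → ν i₂ ≡ norm (y ∷ R₂) → ν′ i₁ ≡ norm (x′ ∷ R₁) → ν′ i₂ ≡ norm (y′ ∷ R₂) →
    OthersEq i₁ i₂ ν ν′ → ν′ ⊴ ν
  move-across zero l {x} i₁ i₂ lt {ν} {ν′} refl refl refl e₁ e₂ e₁′ e₂′ o = inj₁ unchanged
    where
    unchanged : ν′ ≐ ν
    unchanged j with j Fin.≟ i₁ | j Fin.≟ i₂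
    ... | yes refl | _ = trans e₁′ (sym e₁)
    ... | no _ | yes refl = trans e₂′ (sym e₂)
    ... | no p | no q = o j p q
  move-across (suc k) zero {x} {R₁ = R₁} {R₂} i₁ i₂ lt {ν} {ν′} refl refl refl e₁ e₂ e₁′ e₂′ o
    with norm-entry x R₁ e₁ | norm-entry (suc k + x) R₂ e₂
  ... | j₁ , q₁ , h₁ | j₂ , q₂ , h₂ = inj₂ (one (move1 i₁ i₂ j₁ j₂ lt
    (subst₂ _<_ (sym q₁) (sym q₂) (s≤s (ℕₚ.m≤n+m x k)))
    (trans e₁′ (trans (sym (h₁ (suc k + x))) (cong (λ u → norm (setAt j₁ u (ν i₁))) (sym q₂))))
    (trans e₂′ (trans (sym (h₂ x)) (cong (λ u → norm (setAt j₂ u (ν i₂))) (sym q₁)))) o))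
  move-across (suc k) (suc l) {x} {R₁ = R₁} {R₂} i₁ i₂ lt {ν} {ν′} refl refl refl e₁ e₂ e₁′ e₂′ o
    with norm-entry x R₁ e₁ | norm-entry (suc k + (suc l + x)) R₂ e₂
  ... | j₁ , q₁ , h₁ | j₂ , q₂ , h₂ = inj₂ (Move-⊴
    (move3 i₁ i₂ j₁ j₂ lt
      (subst₂ (λ u v → suc u < v) (sym q₁) (sym q₂) (s≤s (ℕₚ.≤-trans (s≤s (ℕₚ.m≤n+m x l)) (ℕₚ.m≤n+m (suc l + x) k))))
      (trans at₁ (trans (sym (h₁ (suc x))) (cong (λ u → norm (setAt j₁ (suc u) (ν i₁))) (sym q₁))))
      (trans at₂ (trans (sym (h₂ (k + (suc l + x)))) (cong (λ u → norm (setAt j₂ (u ∸ 1) (ν i₂))) (sym q₂))))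
      (λ j p q → trans (≔-there _ i₂ _ q) (≔-there ν i₁ _ p)))
    (move-across k l {R₁ = R₁} {R₂} i₁ i₂ lt (cong (k +_) (sym (ℕₚ.+-suc l x))) (sym (ℕₚ.+-suc k x)) (sym (ℕₚ.+-suc l x))
      at₁ at₂ e₁′ e₂′ (λ j p q → trans (o j p q) (sym (trans (≔-there _ i₂ _ q) (≔-there ν i₁ _ p))))))
    where
    at₁ : (ν [ i₁ ≔ norm (suc x ∷ R₁) ] [ i₂ ≔ norm (k + (suc l + x) ∷ R₂) ]) i₁ ≡ norm (suc x ∷ R₁)
    at₁ = trans (≔-there (ν [ i₁ ≔ norm (suc x ∷ R₁) ]) i₂ _ {i₁} λ { refl → ℕₚ.<-irrefl refl lt }) (≔-here ν i₁ _)
    at₂ : (ν [ i₁ ≔ norm (suc x ∷ R₁) ] [ i₂ ≔ norm (k + (suc l + x) ∷ R₂) ]) i₂ ≡ norm (k + (suc l + x) ∷ R₂)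
    at₂ = ≔-here _ i₂ _

-- Blocks of variables and the limit

flat : ∀ {r} → (Fin r → List ℕ) → List ℕ
flat {zero}  X = []
flat {suc r} X = X zero ++ flat (X ∘ suc)

concatMap-tabulate : ∀ {A : Set} (X : A → List ℕ) {r} (g : Fin r → A) → concatMap X (tabulate g) ≡ flat (X ∘ g)
concatMap-tabulate X {zero}  g = refl
concatMap-tabulate X {suc r} g = cong (X (g zero) ++_) (concatMap-tabulate X (g ∘ suc))

flat-cong : ∀ {r} {X Y : Fin r → List ℕ} → (∀ i → X i ≡ Y i) → flat X ≡ flat Y
flat-cong {zero}  h = refl
flat-cong {suc r} h = cong₂ _++_ (h zero) (flat-cong (h ∘ suc))

flat-length : ∀ {r} {X Y : Fin r → List ℕ} → (∀ i → length (X i) ≡ length (Y i)) → length (flat X) ≡ length (flat Y)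
flat-length {zero}  h = refl
flat-length {suc r} {X} {Y} h = trans (length-++ (X zero)) (trans (cong₂ _+_ (h zero) (flat-length (h ∘ suc))) (sym (length-++ (Y zero))))

length-≤-flat : ∀ {r} (X : Fin r → List ℕ) i → length (X i) ≤ length (flat X)
length-≤-flat X zero    = ℕₚ.≤-trans (ℕₚ.m≤m+n _ _) (ℕₚ.≤-reflexive (sym (length-++ (X zero))))
length-≤-flat X (suc i) = ℕₚ.≤-trans (length-≤-flat (X ∘ suc) i) (ℕₚ.≤-trans (ℕₚ.m≤n+m _ _) (ℕₚ.≤-reflexive (sym (length-++ (X zero)))))

++-injective : ∀ {u v u′ v′ : List ℕ} → length u ≡ length u′ → u ++ v ≡ u′ ++ v′ → u ≡ u′ × v ≡ v′
++-injective {[]}    {u′ = []}     len q = refl , q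
++-injective {x ∷ u} {u′ = y ∷ u′} len q with ∷-injective q
... | refl , q′ with ++-injective {u} {u′ = u′} (ℕₚ.suc-injective len) q′
...   | refl , q″ = refl , q″

flat-injective : ∀ {r} {X Y : Fin r → List ℕ} → (∀ i → length (X i) ≡ length (Y i)) → flat X ≡ flat Y → ∀ i → X i ≡ Y i
flat-injective {suc r} {X} {Y} h q zero    = proj₁ (++-injective {X zero} {u′ = Y zero} (h zero) q)
flat-injective {suc r} {X} {Y} h q (suc i) = flat-injective (h ∘ suc) (proj₂ (++-injective {X zero} {u′ = Y zero} (h zero) q)) i

-- Transfers within and between blocks

Repl-++ˡ : ∀ {y y′ u v} w → Repl y y′ u v → Repl y y′ (u ++ w) (v ++ w)
Repl-++ˡ w here      = here
Repl-++ˡ w (there r) = there (Repl-++ˡ w r)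

Repl-++ʳ : ∀ {y y′ u v} w → Repl y y′ u v → Repl y y′ (w ++ u) (w ++ v)
Repl-++ʳ []      r = r
Repl-++ʳ (x ∷ w) r = there (Repl-++ʳ w r)

⟶-++ˡ : ∀ {u v} w → u ⟶ v → u ++ w ⟶ v ++ w
⟶-++ˡ w (hd t r) = hd t (Repl-++ˡ w r)
⟶-++ˡ w (tl s)   = tl (⟶-++ˡ w s)

⟶-++ʳ : ∀ {u v} w → u ⟶ v → w ++ u ⟶ w ++ v
⟶-++ʳ []      s = s
⟶-++ʳ (x ∷ w) s = tl (⟶-++ʳ w s)

⟶-++ : ∀ {x y x′ y′ u u′ v v′} → Transfer x y x′ y′ → Repl x x′ u u′ → Repl y y′ v v′ → u ++ v ⟶ u′ ++ v′
⟶-++ t (here {l}) s = hd t (Repl-++ʳ l s)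
⟶-++ t (there r)  s = tl (⟶-++ t r s)

Repl-++⁻ : ∀ u {y y′ v w} → Repl y y′ (u ++ v) w →
  (∃ λ u′ → w ≡ u′ ++ v × Repl y y′ u u′) ⊎ (∃ λ v′ → w ≡ u ++ v′ × Repl y y′ v v′)
Repl-++⁻ []      r    = inj₂ (_ , refl , r)
Repl-++⁻ (x ∷ u) here = inj₁ (_ , refl , here)
Repl-++⁻ (x ∷ u) (there r) with Repl-++⁻ u r
... | inj₁ (u′ , refl , r′) = inj₁ (_ , refl , there r′)
... | inj₂ (v′ , refl , r′) = inj₂ (_ , refl , r′)

data Split⟶ (u v : List ℕ) : List ℕ → Set where
  left  : ∀ {u′} → u ⟶ u′ → Split⟶ u v (u′ ++ v)
  right : ∀ {v′} → v ⟶ v′ → Split⟶ u v (u ++ v′)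
  both  : ∀ {x y x′ y′ u′ v′} → Transfer x y x′ y′ → Repl x x′ u u′ → Repl y y′ v v′ → Split⟶ u v (u′ ++ v′)

⟶-++⁻ : ∀ u {v w} → u ++ v ⟶ w → Split⟶ u v w
⟶-++⁻ [] s = right s
⟶-++⁻ (x ∷ u) (hd t r) with Repl-++⁻ u r
... | inj₁ (u′ , refl , r′) = left (hd t r′)
... | inj₂ (v′ , refl , r′) = both t here r′
⟶-++⁻ (x ∷ u) (tl s) with ⟶-++⁻ u s
... | left s′      = left (tl s′)
... | right s′     = right s′
... | both t r₁ r₂ = both t (there r₁) r₂

data BlockStep {r} (X Y : Fin r → List ℕ) : Set where
  within : ∀ i → X i ⟶ Y i → OthersEq i i X Y → BlockStep X Y
  across : ∀ i₁ i₂ {x y x′ y′} → toℕ i₁ < toℕ i₂ → Transfer x y x′ y′ →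
           Repl x x′ (X i₁) (Y i₁) → Repl y y′ (X i₂) (Y i₂) → OthersEq i₁ i₂ X Y → BlockStep X Y

flat-Repl : ∀ {r} {X Y : Fin r → List ℕ} {y y′} i → Repl y y′ (X i) (Y i) → (∀ j → j ≢ i → Y j ≡ X j) → Repl y y′ (flat X) (flat Y)
flat-Repl {suc r} {X} {Y} zero s o = subst (Repl _ _ _) (cong (Y zero ++_) (flat-cong λ j → sym (o (suc j) λ ()))) (Repl-++ˡ (flat (X ∘ suc)) s)
flat-Repl {suc r} {X} {Y} (suc i) s o = subst (λ u → Repl _ _ (flat X) (u ++ flat (Y ∘ suc))) (sym (o zero λ ()))
  (Repl-++ʳ (X zero) (flat-Repl i s λ j j≢i → o (suc j) (j≢i ∘ Finₚ.suc-injective)))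

BlockStep⇒⟶ : ∀ {r} {X Y : Fin r → List ℕ} → BlockStep X Y → flat X ⟶ flat Y
BlockStep⇒⟶ {suc r} {X} {Y} (within zero s o) = subst (flat X ⟶_) (cong (Y zero ++_) (flat-cong λ j → sym (o (suc j) (λ ()) λ ())))
  (⟶-++ˡ (flat (X ∘ suc)) s)
BlockStep⇒⟶ {suc r} {X} {Y} (within (suc i) s o) = subst (λ u → flat X ⟶ u ++ flat (Y ∘ suc)) (sym (o zero (λ ()) λ ()))
  (⟶-++ʳ (X zero) (BlockStep⇒⟶ (within i s λ j p q → o (suc j) (p ∘ Finₚ.suc-injective) (q ∘ Finₚ.suc-injective))))
BlockStep⇒⟶ {suc r} {X} {Y} (across zero (suc i₂) lt t s₁ s₂ o) =
  ⟶-++ t s₁ (flat-Repl i₂ s₂ λ j p → o (suc j) (λ ()) (p ∘ Finₚ.suc-injective))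
BlockStep⇒⟶ {suc r} {X} {Y} (across (suc i₁) (suc i₂) (s≤s lt) t s₁ s₂ o) = subst (λ u → flat X ⟶ u ++ flat (Y ∘ suc)) (sym (o zero (λ ()) λ ()))
  (⟶-++ʳ (X zero) (BlockStep⇒⟶ (across i₁ i₂ lt t s₁ s₂ λ j p q → o (suc j) (p ∘ Finₚ.suc-injective) (q ∘ Finₚ.suc-injective))))

consBlock : ∀ {r} → List ℕ → (Fin r → List ℕ) → Fin (suc r) → List ℕ
consBlock l X zero    = l
consBlock l X (suc i) = X i

flat-Repl⁻ : ∀ {r} (X : Fin r → List ℕ) {y y′ w} → Repl y y′ (flat X) w →
  ∃₂ λ Y i → w ≡ flat Y × Repl y y′ (X i) (Y i) × (∀ j → j ≢ i → Y j ≡ X j)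
flat-Repl⁻ {suc r} X s with Repl-++⁻ (X zero) s
... | inj₁ (u′ , refl , s′) = consBlock u′ (X ∘ suc) , zero , refl , s′ ,
        λ { zero p → ⊥-elim (p refl) ; (suc j) p → refl }
... | inj₂ (v′ , refl , s′) with flat-Repl⁻ (X ∘ suc) s′
...   | Y , i , refl , s″ , o = consBlock (X zero) Y , suc i , refl , s″ ,
        λ { zero p → refl ; (suc j) p → o j (p ∘ cong suc) }

⟶⇒BlockStep : ∀ {r} (X : Fin r → List ℕ) {w} → flat X ⟶ w → ∃ λ Y → w ≡ flat Y × BlockStep X Y
⟶⇒BlockStep {suc r} X s with ⟶-++⁻ (X zero) s
... | left {u′} s′ = consBlock u′ (X ∘ suc) , refl , within zero s′ λ { zero p _ → ⊥-elim (p refl) ; (suc j) p _ → refl }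
... | both {u′ = u′} t s₁ s₂ with flat-Repl⁻ (X ∘ suc) s₂
...   | Y , i , refl , s₂′ , o = consBlock u′ Y , refl , across zero (suc i) (s≤s z≤n) t s₁ s₂′
          λ { zero p _ → ⊥-elim (p refl) ; (suc j) _ p → o j (p ∘ cong suc) }
⟶⇒BlockStep {suc r} X s | right s′ with ⟶⇒BlockStep (X ∘ suc) s′
... | Y , refl , within i s″ o = consBlock (X zero) Y , refl , within (suc i) s″
        λ { zero _ _ → refl ; (suc j) p q → o j (p ∘ cong suc) (q ∘ cong suc) }
... | Y , refl , across i₁ i₂ lt t s₁ s₂ o = consBlock (X zero) Y , refl , across (suc i₁) (suc i₂) (s≤s lt) t s₁ s₂
        λ { zero _ _ → refl ; (suc j) p q → o j (p ∘ cong suc) (q ∘ cong suc) }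

Repl-↭ : ∀ {y y′ u v} → Repl y y′ u v → ∃ λ R → u ↭ y ∷ R × v ↭ y′ ∷ R
Repl-↭ (here {l}) = l , ↭-refl , ↭-refl
Repl-↭ (there {x} r) with Repl-↭ r
... | R , p , q = x ∷ R , ↭-trans (↭.prep x p) (↭.swap x _ ↭-refl) , ↭-trans (↭.prep x q) (↭.swap x _ ↭-refl)

⟶-↭ : ∀ {u v} → u ⟶ v → ∃₂ λ x y → ∃₂ λ x′ y′ → ∃ λ R → Transfer x y x′ y′ × u ↭ x ∷ y ∷ R × v ↭ x′ ∷ y′ ∷ R
⟶-↭ (hd {x} {y} {x′} {y′} t r) with Repl-↭ r
... | R , p , q = x , y , x′ , y′ , R , t , ↭.prep x p , ↭.prep x′ q
⟶-↭ (tl {z} s) with ⟶-↭ s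
... | x , y , x′ , y′ , R , t , p , q = x , y , x′ , y′ , z ∷ R , t , rotate p , rotate q
  where
  rotate : ∀ {u x y} → u ↭ x ∷ y ∷ R → z ∷ u ↭ x ∷ y ∷ z ∷ R
  rotate {x = x} {y} p = ↭-trans (↭.prep z p) (↭-trans (↭.swap z x ↭-refl) (↭.prep x (↭.swap z y ↭-refl)))

Transfer-parts : ∀ {x y x′ y′} → Transfer x y x′ y′ → ∃₂ λ k l → y ≡ k + (l + x) × x′ ≡ k + x × y′ ≡ l + x
Transfer-parts {x} {y} (transfer t p q) with ℕₚ.m≤n⇒∃[o]m+o≡n p | ℕₚ.m≤n⇒∃[o]m+o≡n q
... | k , refl | l , refl = k , l , trans (ℕₚ.+-cancelˡ-≡ x y (k + (x + l)) (trans t (ℕₚ.+-assoc x k (x + l)))) (cong (k +_) (ℕₚ.+-comm x l)) ,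
  ℕₚ.+-comm x k , ℕₚ.+-comm x l

BlockStep-⊴ : ∀ {r} {X Y : Fin r → List ℕ} → BlockStep X Y → normMulti Y ⊴ normMulti X
BlockStep-⊴ (within i s o) with ⟶-↭ s
... | x , y , x′ , y′ , R , t , p , q with Transfer-parts t
...   | k , l , e , e′ , e″ = move-within k l i e e′ e″ (norm-resp-↭ p) (norm-resp-↭ q) λ j a b → cong norm (o j a b)
BlockStep-⊴ (across i₁ i₂ lt t s₁ s₂ o) with Repl-↭ s₁ | Repl-↭ s₂ | Transfer-parts t
... | R₁ , p₁ , q₁ | R₂ , p₂ , q₂ | k , l , e , e′ , e″ = move-across k l {R₁ = R₁} {R₂} i₁ i₂ lt e e′ e″
  (norm-resp-↭ p₁) (norm-resp-↭ p₂) (norm-resp-↭ q₁) (norm-resp-↭ q₂) λ j a b → cong norm (o j a b)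

BlockStep-length : ∀ {r} {X Y : Fin r → List ℕ} → BlockStep X Y → ∀ j → length (X j) ≡ length (Y j)
BlockStep-length (within i s o) j with j Fin.≟ i
... | yes refl = ⟶-length s
... | no p = cong length (sym (o j p p))
BlockStep-length (across i₁ i₂ lt t s₁ s₂ o) j with j Fin.≟ i₁ | j Fin.≟ i₂
... | yes refl | _ = Repl-length s₁
... | no _ | yes refl = Repl-length s₂
... | no p | no q = cong length (sym (o j p q))

⟶*⇒⊴ : ∀ {r} (X : Fin r → List ℕ) {w} → flat X ⟶* w →
  ∃ λ Y → w ≡ flat Y × (∀ j → length (X j) ≡ length (Y j)) × normMulti Y ⊴ normMulti X
⟶*⇒⊴ X ε = X , refl , (λ _ → refl) , inj₁ λ _ → refl
⟶*⇒⊴ X (s ◅ ss) with ⟶⇒BlockStep X s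
... | Y , refl , b with ⟶*⇒⊴ Y ss
...   | Z , eq , len , c = Z , eq , (λ j → trans (BlockStep-length b j) (len j)) , ⊴-trans c (BlockStep-⊴ b)

-- Padding by zeros

pad : ℕ → List ℕ → List ℕ
pad m l = l ++ replicate (m ∸ length l) 0

length-pad : ∀ {m} l → length l ≤ m → length (pad m l) ≡ m
length-pad {m} l p = trans (length-++ l) (trans (cong (length l +_) (length-replicate (m ∸ length l))) (ℕₚ.m+[n∸m]≡n p))

norm-zeros : ∀ m → norm (replicate m 0) ≡ []
norm-zeros zero    = refl
norm-zeros (suc m) = norm-zeros m

norm-++-zeros : ∀ l m → norm (l ++ replicate m 0) ≡ norm l
norm-++-zeros []      m = norm-zeros m
norm-++-zeros (x ∷ l) m = norm-∷-cong x (norm-++-zeros l m)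

norm-pad : ∀ m l → norm (pad m l) ≡ norm l
norm-pad m l = norm-++-zeros l (m ∸ length l)

gammaBlock : ℕ → List ℕ → List ℕ
gammaBlock m l = replicate (m ∸ length l) 0 ++ reverse l

length-gammaBlock : ∀ {m} l → length l ≤ m → length (gammaBlock m l) ≡ m
length-gammaBlock {m} l p = trans (length-++ (replicate (m ∸ length l) 0))
  (trans (cong₂ _+_ (length-replicate (m ∸ length l)) (length-reverse l)) (ℕₚ.m∸n+n≡m p))

norm-gammaBlock : ∀ m l → norm (gammaBlock m l) ≡ norm l
norm-gammaBlock m l = trans (norm-resp-↭ (++-comm (replicate (m ∸ length l) 0) (reverse l)))
  (trans (norm-++-zeros (reverse l) (m ∸ length l)) (norm-resp-↭ (↭-reverse l)))

linked-snoc : ∀ {x u} → Linked _≤_ u → All (_≤ x) u → Linked _≤_ (u ++ x ∷ [])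
linked-snoc []      []       = [-]
linked-snoc [-]     (p ∷ []) = p ∷ [-]
linked-snoc (q ∷ l) (p ∷ ps) = q ∷ linked-snoc l ps

linked-reverse : ∀ {l} → Linked _≥_ l → Linked _≤_ (reverse l)
linked-reverse {[]} d = []
linked-reverse {x ∷ l} d = subst (Linked _≤_) (sym (unfold-reverse x l))
  (linked-snoc (linked-reverse (Linked.tail d)) (All-resp-↭ (↭-sym (↭-reverse l)) (linked-head d)))

linked-zeros : ∀ m {u} → Linked _≤_ u → Linked _≤_ (replicate m 0 ++ u)
linked-zeros zero          l = l
linked-zeros (suc zero)    {[]}    l = [-]
linked-zeros (suc zero)    {x ∷ u} l = z≤n ∷ l
linked-zeros (suc (suc m)) l = z≤n ∷ linked-zeros (suc m) l

replicate-++ : ∀ m n → replicate m 0 ++ replicate n 0 ≡ replicate (m + n) 0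
replicate-++ zero    n = refl
replicate-++ (suc m) n = cong (0 ∷_) (replicate-++ m n)

gammaBlock-+ : ∀ m n l → length l ≤ n → gammaBlock (m + n) l ≡ replicate m 0 ++ gammaBlock n l
gammaBlock-+ m n l p = trans (cong (λ u → replicate u 0 ++ reverse l) (ℕₚ.+-∸-assoc m p))
  (trans (cong (_++ reverse l) (sym (replicate-++ m (n ∸ length l)))) (++-assoc (replicate m 0) _ (reverse l)))

-- Stable coefficients and the limit

module Blocks {k : List ℕ → List ℕ → ℤ} (isKey : IsKeyCoeff k) where
  open Support isKey
  open Positivity isKey
  open Stability isKey

  k-permute-blocks : ∀ {r} (G X X′ : Fin r → List ℕ) A A′ → length A′ ≡ length A →
    (∀ i → Linked _≤_ (G i)) → (∀ i → length (X i) ≡ length (G i)) → (∀ i → X i ↭ X′ i) →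
    k (A ++ flat G) (A′ ++ flat X) ≡ k (A ++ flat G) (A′ ++ flat X′)
  k-permute-blocks {zero}  G X X′ A A′ lenA asc len p = refl
  k-permute-blocks {suc r} G X X′ A A′ lenA asc len p = trans
    (k-permute (p zero) A (G zero) (flat (G ∘ suc)) A′ (flat (X ∘ suc)) (asc zero) lenA (len zero))
    (trans (cong₂ k (sym (++-assoc A (G zero) _)) (sym (++-assoc A′ (X′ zero) _)))
    (trans (k-permute-blocks (G ∘ suc) (X ∘ suc) (X′ ∘ suc) (A ++ G zero) (A′ ++ X′ zero)
             (trans (length-++ A′) (trans (cong₂ _+_ lenA (trans (sym (↭-length (p zero))) (len zero))) (sym (length-++ A))))
             (asc ∘ suc) (len ∘ suc) (p ∘ suc))
           (cong₂ k (++-assoc A (G zero) _) (++-assoc A′ (X′ zero) _))))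

  k-zeros-blocks : ∀ {r} (G X : Fin r → List ℕ) (m : Fin r → ℕ) A A′ → length A′ ≡ length A →
    (∀ i → length (X i) ≡ length (G i)) →
    k (A ++ flat (λ i → replicate (m i) 0 ++ G i)) (A′ ++ flat (λ i → replicate (m i) 0 ++ X i)) ≡ k (A ++ flat G) (A′ ++ flat X)
  k-zeros-blocks {zero}  G X m A A′ lenA len = refl
  k-zeros-blocks {suc r} G X m A A′ lenA len = trans
    (cong₂ (λ u v → k (A ++ u) (A′ ++ v)) (++-assoc (replicate (m zero) 0) (G zero) _) (++-assoc (replicate (m zero) 0) (X zero) _))
    (trans (k-insert-0s (m zero) A _ A′ _ lenA
             (trans (length-++ (X zero)) (trans (cong₂ _+_ (len zero)
               (flat-length λ i → trans (length-++ (replicate (m (suc i)) 0))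
                 (trans (cong (length (replicate (m (suc i)) 0) +_) (len (suc i))) (sym (length-++ (replicate (m (suc i)) 0))))))
               (sym (length-++ (G zero))))))
    (trans (cong₂ k (sym (++-assoc A (G zero) _)) (sym (++-assoc A′ (X zero) _)))
    (trans (k-zeros-blocks (G ∘ suc) (X ∘ suc) (m ∘ suc) (A ++ G zero) (A′ ++ X zero)
             (trans (length-++ A′) (trans (cong₂ _+_ lenA (len zero)) (sym (length-++ A)))) (len ∘ suc))
           (cong₂ k (++-assoc A (G zero) _) (++-assoc A′ (X zero) _)))))

  module Limit {r : ℕ} (κ : MultiPar r) (κ-par : IsMultiPar κ) where
    Fits : (Fin r → List ℕ) → (Fin r → ℕ) → Set
    Fits X n = ∀ i → length (X i) ≤ n i

    HasLength : (Fin r → List ℕ) → (Fin r → ℕ) → Set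
    HasLength X n = ∀ i → length (X i) ≡ n i

    Γ : (Fin r → ℕ) → Fin r → List ℕ
    Γ n i = gammaBlock (n i) (κ i)

    C : (Fin r → ℕ) → (Fin r → List ℕ) → ℤ
    C n X = k (flat (Γ n)) (flat X)

    padded : (Fin r → ℕ) → (Fin r → List ℕ) → Fin r → List ℕ
    padded n X i = pad (n i) (X i)

    Γ-length : ∀ {n} → Fits κ n → HasLength (Γ n) n
    Γ-length fits i = length-gammaBlock (κ i) (fits i)

    C-norm : ∀ {n X X′} → Fits κ n → HasLength X n → HasLength X′ n → normMulti X ≐ normMulti X′ → C n X ≡ C n X′
    C-norm {n} {X} {X′} fits len len′ q = k-permute-blocks (Γ n) X X′ [] [] refl
      (λ i → linked-zeros (n i ∸ length (κ i)) (linked-reverse (proj₁ (κ-par i))))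
      (λ i → trans (len i) (sym (Γ-length fits i)))
      (λ i → norm-≡⇒↭ (trans (len i) (sym (len′ i))) (q i))

    -- Zeros are added at the front of the blocks of γ but at the end of those of the exponent.
    -- Block symmetry moves the n i - B surplus zeros of the exponent to the front as well, and then
    -- they are removed from both at the same places.
    C-stable : ∀ {n X} B → Fits κ (λ _ → B) → Fits X (λ _ → B) → (∀ i → B ≤ n i) → C n (padded n X) ≡ C (λ _ → B) (padded (λ _ → B) X)
    C-stable {n} {X} B fitsκ fitsX B≤n = trans
      (C-norm {n} {padded n X} {λ i → replicate (m i) 0 ++ pad B (X i)}
        (λ i → ℕₚ.≤-trans (fitsκ i) (B≤n i))
        (λ i → length-pad (X i) (ℕₚ.≤-trans (fitsX i) (B≤n i)))
        (λ i → trans (length-++ (replicate (m i) 0)) (trans (cong₂ _+_ (length-replicate (m i)) (length-pad (X i) (fitsX i))) (ℕₚ.m∸n+n≡m (B≤n i))))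
        (λ i → trans (norm-pad (n i) (X i)) (sym (trans (norm-resp-↭ (++-comm (replicate (m i) 0) (pad B (X i))))
          (trans (norm-++-zeros (pad B (X i)) (m i)) (norm-pad B (X i)))))))
      (trans (cong (λ u → k u (flat λ i → replicate (m i) 0 ++ pad B (X i)))
               (flat-cong λ i → trans (cong (λ u → gammaBlock u (κ i)) (sym (ℕₚ.m∸n+n≡m (B≤n i)))) (gammaBlock-+ (m i) B (κ i) (fitsκ i))))
             (k-zeros-blocks (Γ λ _ → B) (padded (λ _ → B) X) m [] [] refl
               (λ i → trans (length-pad (X i) (fitsX i)) (sym (Γ-length fitsκ i)))))
      where
      m : Fin r → ℕ
      m i = n i ∸ B

    C-κ : ∀ {n X} → Fits κ n → HasLength X n → normMulti X ≐ κ → C n X ≡ 1ℤ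
    C-κ {n} {X} fits len q = trans (C-norm {n} {X} {Γ n} fits len (Γ-length fits)
        (λ i → trans (q i) (sym (trans (norm-gammaBlock (n i) (κ i)) (norm-partition (κ-par i))))))
      (k-diagonal (flat (Γ n)))

    C-support : ∀ {n X} → Fits κ n → HasLength X n → C n X ≢ 0ℤ → normMulti X ⊴ κ
    C-support {n} {X} fits len nz with ⟶*⇒⊴ (Γ n) (k-support _ _ nz)
    ... | Y , eq , lenY , c = ⊴-trans (inj₁ λ i → cong norm (flat-injective (λ i → trans (len i) (trans (sym (Γ-length fits i)) (lenY i))) eq i))
      (⊴-trans c (inj₁ λ i → trans (norm-gammaBlock (n i) (κ i)) (norm-partition (κ-par i))))

    -- Asked for all large n, because every further move may need longer blocks for the lists that
    -- represent it.
    Reached : MultiPar r → Set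
    Reached ν = ∃ λ B → ∀ n → Fits κ n → (∀ i → B ≤ n i) → C n (padded n ν) ≢ 0ℤ

    padded-length : ∀ {n} X → (∀ i → length (flat X) ≤ n i) → HasLength (padded n X) n
    padded-length X p i = length-pad (X i) (ℕₚ.≤-trans (length-≤-flat X i) (p i))

    padded-norm : ∀ n {X Y} → normMulti X ≐ normMulti Y → normMulti (padded n X) ≐ normMulti (padded n Y)
    padded-norm n {X} {Y} q i = trans (norm-pad (n i) (X i)) (trans (q i) (sym (norm-pad (n i) (Y i))))

    C-padded : ∀ {n} X Y → Fits κ n → (∀ i → length (flat X) ≤ n i) → (∀ i → length (flat Y) ≤ n i) →
      normMulti X ≐ normMulti Y → C n (padded n X) ≡ C n (padded n Y)
    C-padded {n} X Y fits p q e = C-norm {n} {padded n X} {padded n Y} fits (padded-length X p) (padded-length Y q) (padded-norm n {X} {Y} e)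

    Reached-κ : Reached κ
    Reached-κ = length (flat κ) , λ n fits B≤n z →
      case (trans (sym (C-κ fits (padded-length κ B≤n) λ i → trans (norm-pad (n i) (κ i)) (norm-partition (κ-par i)))) z)
      where
      case : 1ℤ ≢ 0ℤ
      case ()

    -- Z and Z′ are unsorted representatives with the moved entries in front, where a transfer can
    -- act; the coefficient depends only on the sorted blocks. A nonzero coefficient gives a path to
    -- Z, the block step extends it to Z′, and full support turns it back into a nonzero
    -- coefficient. The lengths in the bound make all four lists fit.
    Reached-step : ∀ {ν ν′} Z Z′ → normMulti Z ≐ normMulti ν → normMulti Z′ ≐ normMulti ν′ →
      (∀ n → BlockStep (padded n Z) (padded n Z′)) → Reached ν → Reached ν′
    Reached-step {ν} {ν′} Z Z′ e e′ b (B , reach) = (B + (l ν + l ν′)) + (l Z + l Z′) , λ n fits B≤ →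
      let B≤₁ = λ i → ℕₚ.m+n≤o⇒m≤o (B + (l ν + l ν′)) (B≤ i)
          B≤₂ = λ i → ℕₚ.m+n≤o⇒n≤o (B + (l ν + l ν′)) (B≤ i)
          B≤₃ = λ i → ℕₚ.m+n≤o⇒n≤o B (B≤₁ i)
          nz = reach n fits (λ i → ℕₚ.m+n≤o⇒m≤o B (B≤₁ i))
          ν≤ = λ i → ℕₚ.m+n≤o⇒m≤o (l ν) (B≤₃ i)
          ν′≤ = λ i → ℕₚ.m+n≤o⇒n≤o (l ν) (B≤₃ i)
          Z≤ = λ i → ℕₚ.m+n≤o⇒m≤o (l Z) (B≤₂ i)
          Z′≤ = λ i → ℕₚ.m+n≤o⇒n≤o (l Z) (B≤₂ i)
      in λ z → ⟶*⇒k≢0 (k-support _ _ (nz ∘ trans (sym (C-padded Z ν fits Z≤ ν≤ e))) ◅◅ BlockStep⇒⟶ (b n) ◅ ε)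
                      (trans (C-padded Z′ ν′ fits Z′≤ ν′≤ e′) z)
      where
      l : (Fin r → List ℕ) → ℕ
      l X = length (flat X)

    ≔-norm : ∀ (X Y : Fin r → List ℕ) i l → norm l ≡ norm (Y i) → (∀ j → j ≢ i → norm (X j) ≡ norm (Y j)) → normMulti (X [ i ≔ l ]) ≐ normMulti Y
    ≔-norm X Y i l p q j with j Fin.≟ i
    ... | yes refl = p
    ... | no j≢i   = q j j≢i

    ≔-norm₂ : ∀ (X Y : Fin r → List ℕ) i₁ i₂ {l₁ l₂} → norm l₁ ≡ norm (Y i₁) → norm l₂ ≡ norm (Y i₂) →
      (∀ j → j ≢ i₁ → j ≢ i₂ → norm (X j) ≡ norm (Y j)) → normMulti (X [ i₁ ≔ l₁ ] [ i₂ ≔ l₂ ]) ≐ normMulti Y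
    ≔-norm₂ X Y i₁ i₂ {l₁} {l₂} p₁ p₂ q = ≔-norm (X [ i₁ ≔ l₁ ]) Y i₂ l₂ p₂ λ j j≢i₂ → go j j≢i₂
      where
      go : ∀ j → j ≢ i₂ → norm ((X [ i₁ ≔ l₁ ]) j) ≡ norm (Y j)
      go j j≢i₂ with j Fin.≟ i₁
      ... | yes refl = p₁
      ... | no j≢i₁  = q j j≢i₁ j≢i₂

    Reached-within : ∀ i {x y x′ y′} R {ν ν′} → Transfer x y x′ y′ →
      norm (ν i) ≡ norm (x ∷ y ∷ R) → norm (ν′ i) ≡ norm (x′ ∷ y′ ∷ R) → OthersEq i i ν ν′ → Reached ν → Reached ν′
    Reached-within i {x} {y} {x′} {y′} R {ν} {ν′} t e e′ o =
      Reached-step {ν} {ν′} (ν [ i ≔ x ∷ y ∷ R ]) (ν [ i ≔ x′ ∷ y′ ∷ R ])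
        (≔-norm ν ν i _ (sym e) λ _ _ → refl)
        (≔-norm ν ν′ i _ (sym e′) λ j j≢i → cong norm (sym (o j j≢i j≢i)))
        λ n → within i
          (subst₂ _⟶_ (cong (pad (n i)) (sym (≔-here ν i _))) (cong (pad (n i)) (sym (≔-here ν i _))) (hd t here))
          λ j j≢i _ → cong (pad (n j)) (trans (≔-there ν i _ j≢i) (sym (≔-there ν i _ j≢i)))

    Reached-across : ∀ i₁ i₂ {x y x′ y′} R₁ R₂ {ν ν′} → toℕ i₁ < toℕ i₂ → Transfer x y x′ y′ →
      norm (ν i₁) ≡ norm (x ∷ R₁) → norm (ν i₂) ≡ norm (y ∷ R₂) →
      norm (ν′ i₁) ≡ norm (x′ ∷ R₁) → norm (ν′ i₂) ≡ norm (y′ ∷ R₂) → OthersEq i₁ i₂ ν ν′ → Reached ν → Reached ν′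
    Reached-across i₁ i₂ {x} {y} {x′} {y′} R₁ R₂ {ν} {ν′} lt t e₁ e₂ e₁′ e₂′ o =
      Reached-step {ν} {ν′} (Z x y) (Z x′ y′)
        (≔-norm₂ ν ν i₁ i₂ (sym e₁) (sym e₂) λ _ _ _ → refl)
        (≔-norm₂ ν ν′ i₁ i₂ (sym e₁′) (sym e₂′) λ j p q → cong norm (sym (o j p q)))
        λ n → across i₁ i₂ lt t
          (subst₂ (Repl x x′) (cong (pad (n i₁)) (sym (Z₁ x y))) (cong (pad (n i₁)) (sym (Z₁ x′ y′))) here)
          (subst₂ (Repl y y′) (cong (pad (n i₂)) (sym (Z₂ x y))) (cong (pad (n i₂)) (sym (Z₂ x′ y′))) here)
          λ j p q → cong (pad (n j)) (trans (Z₃ x′ y′ j p q) (sym (Z₃ x y j p q)))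
      where
      Z : ℕ → ℕ → Fin r → List ℕ
      Z a b = ν [ i₁ ≔ a ∷ R₁ ] [ i₂ ≔ b ∷ R₂ ]
      Z₁ : ∀ a b → Z a b i₁ ≡ a ∷ R₁
      Z₁ a b = trans (≔-there (ν [ i₁ ≔ a ∷ R₁ ]) i₂ _ {i₁} λ { refl → ℕₚ.<-irrefl refl lt }) (≔-here ν i₁ _)
      Z₂ : ∀ a b → Z a b i₂ ≡ b ∷ R₂
      Z₂ a b = ≔-here (ν [ i₁ ≔ a ∷ R₁ ]) i₂ _
      Z₃ : ∀ a b j → j ≢ i₁ → j ≢ i₂ → Z a b j ≡ ν j
      Z₃ a b j p q = trans (≔-there (ν [ i₁ ≔ a ∷ R₁ ]) i₂ _ q) (≔-there ν i₁ _ p)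

    unit-transfer : ∀ x y → suc x < y → Transfer x y (suc x) (y ∸ 1)
    unit-transfer x (suc y) (s≤s p) = transfer (ℕₚ.+-suc x y) (ℕₚ.n≤1+n x) (ℕₚ.<⇒≤ p)

    ≡norm⇒norm≡ : ∀ {u} w → u ≡ norm w → norm u ≡ norm w
    ≡norm⇒norm≡ w refl = norm-idem w

    Reached-Move : ∀ {ν ν′} → Move ν ν′ → Reached ν → Reached ν′
    Reached-Move {ν} (move1 i₁ i₂ j₁ j₂ lt lt′ e₁ e₂ o) with norm-setAt (ν i₁) j₁ | norm-setAt (ν i₂) j₂
    ... | R₁ , q₁ , h₁ | R₂ , q₂ , h₂ = Reached-across i₁ i₂ R₁ R₂ lt
      (Transfer-swap (Transfer-refl (ℕₚ.<⇒≤ lt′))) q₁ q₂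
      (≡norm⇒norm≡ (y ∷ R₁) (trans e₁ (h₁ y))) (≡norm⇒norm≡ (x ∷ R₂) (trans e₂ (h₂ x))) o
      where
      x = at (ν i₁) j₁
      y = at (ν i₂) j₂
    Reached-Move {ν} (move2 i j k lt lt′ e o) with norm-setAt₂ (ν i) lt
    ... | R , q , h = Reached-within i R (unit-transfer x y lt′) (trans q (norm-swap y x R))
      (≡norm⇒norm≡ (suc x ∷ (y ∸ 1) ∷ R) (trans e (trans (h (y ∸ 1) (suc x)) (norm-swap (y ∸ 1) (suc x) R)))) o
      where
      x = at (ν i) k
      y = at (ν i) j
    Reached-Move {ν} (move3 i₁ i₂ j₁ j₂ lt lt′ e₁ e₂ o) with norm-setAt (ν i₁) j₁ | norm-setAt (ν i₂) j₂
    ... | R₁ , q₁ , h₁ | R₂ , q₂ , h₂ = Reached-across i₁ i₂ R₁ R₂ lt (unit-transfer x y lt′) q₁ q₂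
      (≡norm⇒norm≡ (suc x ∷ R₁) (trans e₁ (h₁ (suc x)))) (≡norm⇒norm≡ ((y ∸ 1) ∷ R₂) (trans e₂ (h₂ (y ∸ 1)))) o
      where
      x = at (ν i₁) j₁
      y = at (ν i₂) j₂

    Reached-◁ : ∀ {μ ν} → μ ◁ ν → Reached ν → Reached μ
    Reached-◁ (one m)      p = Reached-Move m p
    Reached-◁ (more ν m c) p = Reached-◁ c (Reached-Move m p)

gammaVec-flat : ∀ {r} (κ : MultiPar r) n → gammaVec κ n ≡ flat (λ i → gammaBlock (n i) (κ i))
gammaVec-flat κ n = concatMap-tabulate (λ i → gammaBlock (n i) (κ i)) (λ i → i)

expoVec-flat : ∀ {r} (e : Fin r → List ℕ) n → expoVec e n ≡ flat (λ i → pad (n i) (e i))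
expoVec-flat e n = concatMap-tabulate (λ i → pad (n i) (e i)) (λ i → i)

mainTheorem3 : (K : List ℕ → Poly) → IsKeyFamily K →
  (r : ℕ) (λ' μ : MultiPar r) → IsMultiPar λ' → IsMultiPar μ →
  -- coefficient of m_(λ) is 1
  ((μ ≐ λ') → (e : Fin r → List ℕ) → normMulti e ≐ μ → LimCoeff K λ' e 1ℤ) ×
  -- for (μ) ◁ (λ): a common nonzero coefficient K^(λ)_(μ) of m_(μ)
  ((μ ◁ λ') → Σ ℤ (λ c → (c ≢ 0ℤ) ×
     ((e : Fin r → List ℕ) → normMulti e ≐ μ → LimCoeff K λ' e c))) ×
  -- all other m_(μ) have coefficient 0
  (¬ (μ ≐ λ') → ¬ (μ ◁ λ') →
     (e : Fin r → List ℕ) → normMulti e ≐ μ → LimCoeff K λ' e 0ℤ)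
mainTheorem3 K isKF r κ μ κ-par μ-par = equal , lower , neither
  where
  open Blocks (keyCoeff-isKeyCoeff {K = K} isKF)
  open Limit κ κ-par

  l : (Fin r → List ℕ) → ℕ
  l X = length (flat X)

  fits-κ : ∀ {n} → (∀ i → l κ ≤ n i) → Fits κ n
  fits-κ p i = ℕₚ.≤-trans (length-≤-flat κ i) (p i)

  coeff-C : ∀ e {n} → (∀ i → l κ ≤ n i) → (∀ i → l e ≤ n i) →
    coeff (K (gammaVec κ n)) (expoVec e n) ≡ C n (padded n e)
  coeff-C e {n} κ≤ e≤ = trans (cong₂ (λ α E → coeff (K α) E) (gammaVec-flat κ n) (expoVec-flat e n))
    (sym (keyCoeff-≡ K (flat (Γ n)) (flat (padded n e))
      (flat-length λ i → trans (padded-length e e≤ i) (sym (Γ-length (fits-κ κ≤) i)))))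

  equal : (μ ≐ κ) → (e : Fin r → List ℕ) → normMulti e ≐ μ → LimCoeff K κ e 1ℤ
  equal μ≐κ e e≐μ = l κ + l e , λ n B≤ →
    let κ≤ = λ i → ℕₚ.m+n≤o⇒m≤o (l κ) (B≤ i)
        e≤ = λ i → ℕₚ.m+n≤o⇒n≤o (l κ) (B≤ i)
    in trans (coeff-C e κ≤ e≤) (C-κ (fits-κ κ≤) (padded-length e e≤)
         λ i → trans (norm-pad (n i) (e i)) (trans (e≐μ i) (μ≐κ i)))

  lower : (μ ◁ κ) → Σ ℤ (λ c → (c ≢ 0ℤ) × ((e : Fin r → List ℕ) → normMulti e ≐ μ → LimCoeff K κ e c))
  lower μ◁κ with Reached-◁ μ◁κ Reached-κ
  ... | B , reach = C (λ _ → N) (padded (λ _ → N) μ) ,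
        reach (λ _ → N) (fits-κ λ _ → κ≤N) (λ _ → ℕₚ.m≤n+m B (l κ + l μ)) ,
        -- The threshold depends on e, which may contain arbitrarily many zeros; the value does not.
        λ e e≐μ → N + l e , λ n B≤ →
          let N≤ = λ i → ℕₚ.m+n≤o⇒m≤o N (B≤ i)
              e≤ = λ i → ℕₚ.m+n≤o⇒n≤o N (B≤ i)
              κ≤ = λ i → ℕₚ.≤-trans κ≤N (N≤ i)
          in trans (coeff-C e κ≤ e≤)
            (trans (C-padded e μ (fits-κ κ≤) e≤ (λ i → ℕₚ.≤-trans μ≤N (N≤ i))
                     (λ i → trans (e≐μ i) (sym (norm-partition (μ-par i)))))
                   (C-stable {n} {μ} N (fits-κ λ _ → κ≤N) (λ i → ℕₚ.≤-trans (length-≤-flat μ i) μ≤N) N≤))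
    where
    -- Large enough for γ and μ to fit and for `reach` to apply, so the coefficient at constant
    -- block length N is nonzero and already the stable one.
    N = (l κ + l μ) + B
    κ≤N : l κ ≤ N
    κ≤N = ℕₚ.≤-trans (ℕₚ.m≤m+n (l κ) (l μ)) (ℕₚ.m≤m+n _ B)
    μ≤N : l μ ≤ N
    μ≤N = ℕₚ.≤-trans (ℕₚ.m≤n+m (l μ) (l κ)) (ℕₚ.m≤m+n _ B)

  neither : ¬ (μ ≐ κ) → ¬ (μ ◁ κ) → (e : Fin r → List ℕ) → normMulti e ≐ μ → LimCoeff K κ e 0ℤ
  neither ¬≐ ¬◁ e e≐μ = l κ + l e , λ n B≤ →
    let κ≤ = λ i → ℕₚ.m+n≤o⇒m≤o (l κ) (B≤ i)
        e≤ = λ i → ℕₚ.m+n≤o⇒n≤o (l κ) (B≤ i)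
    in trans (coeff-C e κ≤ e≤) (vanish n κ≤ e≤ (C n (padded n e) ℤ.≟ 0ℤ))
    where
    vanish : ∀ n → (∀ i → l κ ≤ n i) → (∀ i → l e ≤ n i) → Dec (C n (padded n e) ≡ 0ℤ) → C n (padded n e) ≡ 0ℤ
    vanish n κ≤ e≤ (yes z) = z
    vanish n κ≤ e≤ (no nz) = ⊥-elim ([ ¬≐ , ¬◁ ]′ (⊴-trans (inj₁ λ i → trans (sym (e≐μ i)) (sym (norm-pad (n i) (e i))))
      (C-support (fits-κ κ≤) (padded-length e e≤) nz)))
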